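{- For all integers $n\ge0$, $b_{40}(25n+9)\equiv 0 \pmod 2$ and $b_{40}(25n+19)\equiv 0\pmod 2$.
   Context: $b_{40}(n)$ denotes the number of partitions of $n$ none of whose parts is divisible by $40$; equivalently $\sum_{n\ge0} b_{40}(n)q^n = \prod_{i\ge1}(1-q^{40i})/(1-q^i)$. -}

module Defs where

open import Data.Nat using (ℕ; zero; suc; _+_; _*_; _∸_; _≤?_; _%_)
open import Data.Nat.Divisibility using (_∣?_)
open import Relation.Nullary using (yes; no)

-- ways k n : number of partitions of n all of whose parts are at most k
-- and none of whose parts is divisible by 40.
-- Defined by the standard recursion on the largest allowed part size k,
-- summing over the multiplicity m of the part k (with m * k ≤ n).

sumMult : ℕ → ℕ → (ℕ → ℕ) → ℕ → ℕ
sumMult k n f zero = f n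
sumMult k n f (suc j) with suc j * k ≤? n
... | yes _ = f (n ∸ suc j * k) + sumMult k n f j
... | no  _ = sumMult k n f j

ways : ℕ → ℕ → ℕ
ways zero zero = 1
ways zero (suc n) = 0
ways (suc k) n with 40 ∣? suc k
... | yes _ = ways k n
... | no  _ = sumMult (suc k) n (ways k) n

-- b₄₀ n : the number of partitions of n none of whose parts is divisible by 40
-- (parts never exceed n, so it suffices to allow parts up to n).
b₄₀ : ℕ → ℕ
b₄₀ n = ways n n

{-# OPTIONS --safe #-}
module Submission where

-- Write f_c = ∏ (1 - q^(c i)), and work modulo 2, so that f_(2c) = f_c². The generating function B of
-- b₄₀ satisfies f_1 B = f_40 = f_5⁸. Jacobi's triple product writes f_c, f_c³ and f_1 f_5 through theta
-- series whose exponents are given by squares, and division by 2 + i in the Gaussian integers gives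
-- f_1 f_5 = f_1⁶ + q f_5⁶. Hence q B = f_5³ + f_5² f_1⁵ = f_10 f_5 + f_10 (f_1 f_4). The coefficient of
-- q^(5m) in f_1 f_4 counts solutions of x² + 4 y² = 5 (24 m + 1); when 5 ∤ 24 m + 1, an involution shows
-- that it has the parity of the coefficient of q^(5m) in f_5. For the exponents in question only such m
-- occur, so the two summands of q B cancel.

open import Defs
open import Algebra.Bundles using (CommutativeRing)
import Algebra.Properties.CommutativeSemigroup as CommutativeSemigroupProperties
import Algebra.Solver.Ring as RingSolver
open import Algebra.Solver.Ring.AlmostCommutativeRing using (AlmostCommutativeRing; _-Raw-AlmostCommutative⟶_)
import Algebra.Structures.Biased as Biased
open import Data.Bool using (Bool; true; false; _∧_; _xor_; not; if_then_else_)
import Data.Bool.Properties as Bool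
open import Data.Empty using (⊥; ⊥-elim)
open import Data.Integer as ℤ using (ℤ; +_; -[1+_]; ∣_∣)
import Data.Integer.DivMod as ℤ
open import Data.Integer.Divisibility.Signed as ℤ using (divides)
import Data.Integer.Properties as ℤ
import Data.Integer.Tactic.RingSolver as ℤSolver
open import Data.Maybe using (Maybe; just; nothing)
open import Data.Nat using (ℕ; zero; suc; _+_; _*_; _∸_; _%_; _≤_; _<_; z≤n; s≤s; s≤s⁻¹; _≟_; _≤?_; _<?_; NonZero; >-nonZero; >-nonZero⁻¹)
import Data.Nat.Divisibility as ℕ
open import Data.Nat.Primality using (prime?; euclidsLemma)
import Data.Nat.Properties as ℕ
import Data.Nat.Tactic.RingSolver as ℕSolver
open import Data.Product using (∃; _×_; _,_; proj₁; proj₂)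
open import Data.Sum using (_⊎_; inj₁; inj₂)
open import Function using (Equivalence; _∘_; id)
open import Level using (0ℓ)
open import Relation.Binary.PropositionalEquality using (_≡_; _≢_; refl; sym; trans; cong; cong₂; subst; module ≡-Reasoning)
import Relation.Binary.Reasoning.Setoid as SetoidReasoning
open import Relation.Nullary using (¬_; Dec; yes; no; does; contradiction)
open import Relation.Nullary.Decidable using (True; toWitness; from-yes; dec-true; dec-false; ¬?; _→-dec_; _⊎-dec_)

-- Power series over 𝔽₂

-- Modulo 2 each theta series used here is the indicator of a set of exponents, since no exponent
-- occurs twice in it. A coefficient of a product is then the parity of a number of pairs of
-- squares, and the arithmetic becomes a bijection or an involution on such pairs. Both rest on 5 =
-- (2 + i)(2 - i). The obstacle is signs: a square knows its root only up to sign, so a congruence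
-- modulo 4, 5 or 20 has to single out the relative sign of the two roots. For x² + 4 y² the
-- congruence y ≡ x modulo 5 does so only if 5 does not divide x, and 5 ∤ 24 m + 1 guarantees that.
-- This condition selects the progressions. The coefficient of q^(5 M) in q B combines 10 p from
-- f_10, where x² = 24 p + 1, with 5 m, where M = 2 p + m. Hence 2 x² + (24 m + 1) = 24 M + 3, and 5
-- ∣ 24 m + 1 would make 2 x² ≡ 24 M + 3 modulo 5, which is impossible for M ≡ 2 and M ≡ 4. Since 5
-- M is the degree in q B, the arguments of b₄₀ are 5 M - 1, that is 25 n + 9 and 25 n + 19.

module 𝔽₂ = CommutativeRing Bool.xor-∧-commutativeRing

xor-self : ∀ a b → a xor (a xor b) ≡ b
xor-self false b = refl
xor-self true false = refl
xor-self true true = refl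

open CommutativeSemigroupProperties 𝔽₂.+-commutativeSemigroup using () renaming (interchange to xor-interchange; x∙yz≈y∙xz to xor-swap)

Series : Set
Series = ℕ → Bool

infixl 6 _⊕_
infixl 7 _⊛_

-- Opaque, so that the summands can be inferred from a sum.
opaque
  _⊕_ : Series → Series → Series
  (f ⊕ g) n = f n xor g n

  ⊕-coeff : ∀ f g n → (f ⊕ g) n ≡ f n xor g n
  ⊕-coeff f g n = refl

-- The Cauchy product, peeled at the constant term of the left factor, so that the ring laws follow
-- by induction on the degree without reindexing sums.
_⊛_ : Series → Series → Series
(f ⊛ g) zero = f 0 ∧ g 0
(f ⊛ g) (suc n) = (f 0 ∧ g (suc n)) xor ((f ∘ suc) ⊛ g) n

𝟎 𝟏 : Series
𝟎 _ = false
𝟏 zero = true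
𝟏 (suc _) = false

constant : Bool → Series
constant true = 𝟏
constant false = 𝟎

q^ : ℕ → Series
q^ zero = 𝟏
q^ (suc e) zero = false
q^ (suc e) (suc n) = q^ e n

-- The hypothesis compares products and not factors, so it also serves when the right factors agree
-- only where the left one has a nonzero coefficient.
⊛-cong-pairs : ∀ n {f f′ g g′} → (∀ i j → i + j ≡ n → f i ∧ g j ≡ f′ i ∧ g′ j) → (f ⊛ g) n ≡ (f′ ⊛ g′) n
⊛-cong-pairs zero h = h 0 0 refl
⊛-cong-pairs (suc n) h = cong₂ _xor_ (h 0 (suc n) refl) (⊛-cong-pairs n λ i j e → h (suc i) j (cong suc e))

⊛-scaleˡ : ∀ b f g n → ((λ i → b ∧ f i) ⊛ g) n ≡ b ∧ (f ⊛ g) n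
⊛-scaleˡ b f g zero = Bool.∧-assoc b (f 0) (g 0)
⊛-scaleˡ b f g (suc n) =
  trans (cong₂ _xor_ (Bool.∧-assoc b (f 0) _) (⊛-scaleˡ b (f ∘ suc) g n)) (sym (𝔽₂.distribˡ b _ _))

⊛-suc : ∀ f g n → (f ⊛ g) (suc n) ≡ (f (suc n) ∧ g 0) xor (f ⊛ (g ∘ suc)) n
⊛-suc f g zero = 𝔽₂.+-comm (f 0 ∧ g 1) _
⊛-suc f g (suc n) = 
  trans (cong ((f 0 ∧ g (suc (suc n))) xor_) (⊛-suc (f ∘ suc) g n))
        (xor-swap (f 0 ∧ g (suc (suc n))) (f (suc (suc n)) ∧ g 0) (((f ∘ suc) ⊛ (g ∘ suc)) n))

⊛-comm : ∀ f g n → (f ⊛ g) n ≡ (g ⊛ f) n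
⊛-comm f g zero = Bool.∧-comm (f 0) (g 0)
⊛-comm f g (suc n) =
  trans (cong₂ _xor_ (Bool.∧-comm (f 0) _) (⊛-comm (f ∘ suc) g n)) (sym (⊛-suc g f n))

opaque
  unfolding _⊕_

  ⊛-distribʳ : ∀ f g h n → ((f ⊕ g) ⊛ h) n ≡ (f ⊛ h ⊕ g ⊛ h) n
  ⊛-distribʳ f g h zero = 𝔽₂.distribʳ (h 0) (f 0) (g 0)
  ⊛-distribʳ f g h (suc n) =
    trans (cong₂ _xor_ (𝔽₂.distribʳ (h (suc n)) (f 0) (g 0)) (⊛-distribʳ (f ∘ suc) (g ∘ suc) h n))
          (xor-interchange (f 0 ∧ h (suc n)) (g 0 ∧ h (suc n)) _ _)

  ⊛-assoc : ∀ f g h n → ((f ⊛ g) ⊛ h) n ≡ (f ⊛ (g ⊛ h)) n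
  ⊛-assoc f g h zero = Bool.∧-assoc (f 0) (g 0) (h 0)
  ⊛-assoc f g h (suc n) = begin
    ((f 0 ∧ g 0) ∧ h (suc n)) xor (((λ i → f 0 ∧ g (suc i)) ⊕ ((f ∘ suc) ⊛ g)) ⊛ h) n
      ≡⟨ cong₂ _xor_ (Bool.∧-assoc (f 0) _ _)
           (trans (⊛-distribʳ _ _ h n) (cong₂ _xor_ (⊛-scaleˡ (f 0) _ h n) (⊛-assoc (f ∘ suc) g h n))) ⟩
    (f 0 ∧ (g 0 ∧ h (suc n))) xor ((f 0 ∧ ((g ∘ suc) ⊛ h) n) xor ((f ∘ suc) ⊛ (g ⊛ h)) n)
      ≡⟨ 𝔽₂.+-assoc (f 0 ∧ (g 0 ∧ h (suc n))) _ _ ⟨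
    ((f 0 ∧ (g 0 ∧ h (suc n))) xor (f 0 ∧ ((g ∘ suc) ⊛ h) n)) xor ((f ∘ suc) ⊛ (g ⊛ h)) n
      ≡⟨ cong (_xor ((f ∘ suc) ⊛ (g ⊛ h)) n) (𝔽₂.distribˡ (f 0) (g 0 ∧ h (suc n)) (((g ∘ suc) ⊛ h) n)) ⟨
    (f 0 ∧ (g ⊛ h) (suc n)) xor ((f ∘ suc) ⊛ (g ⊛ h)) n ∎
    where open ≡-Reasoning

  ⊕-assoc : ∀ f g h n → ((f ⊕ g) ⊕ h) n ≡ (f ⊕ (g ⊕ h)) n
  ⊕-assoc f g h n = 𝔽₂.+-assoc (f n) (g n) (h n)

  ⊕-comm : ∀ f g n → (f ⊕ g) n ≡ (g ⊕ f) n
  ⊕-comm f g n = 𝔽₂.+-comm (f n) (g n)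

  ⊕-identityˡ : ∀ f n → (𝟎 ⊕ f) n ≡ f n
  ⊕-identityˡ f n = refl

  constant-xor : ∀ a b n → constant (a xor b) n ≡ (constant a ⊕ constant b) n
  constant-xor true true zero = refl
  constant-xor true true (suc n) = refl
  constant-xor true false zero = refl
  constant-xor true false (suc n) = refl
  constant-xor false b n = refl

⊛-zeroˡ : ∀ f n → (𝟎 ⊛ f) n ≡ false
⊛-zeroˡ f zero = refl
⊛-zeroˡ f (suc n) = ⊛-zeroˡ f n

⊛-identityˡ : ∀ f n → (𝟏 ⊛ f) n ≡ f n
⊛-identityˡ f zero = refl
⊛-identityˡ f (suc n) = trans (cong (f (suc n) xor_) (⊛-zeroˡ f n)) (𝔽₂.+-identityʳ _)

q^-+ : ∀ a b n → (q^ a ⊛ q^ b) n ≡ q^ (a + b) n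
q^-+ zero b n = ⊛-identityˡ (q^ b) n
q^-+ (suc a) b zero = refl
q^-+ (suc a) b (suc n) = q^-+ a b n

q^-small : ∀ e n → n < e → q^ e n ≡ false
q^-small (suc e) zero _ = refl
q^-small (suc e) (suc n) (s≤s l) = q^-small e n l

q^-at : ∀ e → q^ e e ≡ true
q^-at zero = refl
q^-at (suc e) = q^-at e

q^-true : ∀ e n → q^ e n ≡ true → e ≡ n
q^-true zero zero _ = refl
q^-true (suc e) (suc n) h = cong suc (q^-true e n h)

module Truncated (N : ℕ) where

  infix 4 _≈_

  -- Congruence modulo q^N, under which a long enough finite product stands for an infinite one. A
  -- record, so that both series can be inferred from a proof.
  record _≈_ (f g : Series) : Set where
    constructor mod
    field coeff : ∀ n → n < N → f n ≡ g n
  open _≈_ public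

  exact : ∀ {f g} → (∀ n → f n ≡ g n) → f ≈ g
  exact h = mod λ n _ → h n

  ≈-refl : ∀ {f} → f ≈ f
  ≈-refl = exact λ _ → refl

  ≈-sym : ∀ {f g} → f ≈ g → g ≈ f
  ≈-sym h = mod λ n l → sym (coeff h n l)

  ≈-trans : ∀ {f g h} → f ≈ g → g ≈ h → f ≈ h
  ≈-trans h k = mod λ n l → trans (coeff h n l) (coeff k n l)

  ⊕-cong : ∀ {f f′ g g′} → f ≈ f′ → g ≈ g′ → f ⊕ g ≈ f′ ⊕ g′
  ⊕-cong {f} {f′} {g} {g′} h k = mod λ n l → trans (⊕-coeff f g n)
    (trans (cong₂ _xor_ (coeff h n l) (coeff k n l)) (sym (⊕-coeff f′ g′ n)))

  ⊛-cong : ∀ {f f′ g g′} → f ≈ f′ → g ≈ g′ → f ⊛ g ≈ f′ ⊛ g′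
  ⊛-cong h k = mod λ n l → ⊛-cong-pairs n λ i j e → cong₂ _∧_
    (coeff h i (ℕ.≤-<-trans (subst (i ≤_) e (ℕ.m≤m+n i j)) l))
    (coeff k j (ℕ.≤-<-trans (subst (j ≤_) e (ℕ.m≤n+m j i)) l))

  almostCommutativeRing : AlmostCommutativeRing 0ℓ 0ℓ
  almostCommutativeRing = record
    { Carrier = Series ; _≈_ = _≈_ ; _+_ = _⊕_ ; _*_ = _⊛_ ; -_ = id ; 0# = 𝟎 ; 1# = 𝟏
    ; isAlmostCommutativeRing = record
      { isCommutativeSemiring = Biased.isCommutativeSemiringˡ record
        { +-isCommutativeMonoid = record
          { isMonoid = record
            { isSemigroup = record
              { isMagma = record
                { isEquivalence = record { refl = ≈-refl ; sym = ≈-sym ; trans = ≈-trans }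
                ; ∙-cong = ⊕-cong }
              ; assoc = λ f g h → exact (⊕-assoc f g h) }
            ; identity = (λ f → exact (⊕-identityˡ f))
                       , λ f → exact λ n → trans (⊕-comm f 𝟎 n) (⊕-identityˡ f n) }
          ; comm = λ f g → exact (⊕-comm f g) }
        ; *-isCommutativeMonoid = record
          { isMonoid = record
            { isSemigroup = record
              { isMagma = record
                { isEquivalence = record { refl = ≈-refl ; sym = ≈-sym ; trans = ≈-trans }
                ; ∙-cong = ⊛-cong }
              ; assoc = λ f g h → exact (⊛-assoc f g h) }
            ; identity = (λ f → exact (⊛-identityˡ f))
                       , λ f → exact λ n → trans (⊛-comm f 𝟏 n) (⊛-identityˡ f n) }
          ; comm = λ f g → exact (⊛-comm f g) }
        ; distribʳ = λ h f g → exact (⊛-distribʳ f g h)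
        ; zeroˡ = λ f → exact (⊛-zeroˡ f) }
      ; -‿cong = id
      ; -‿*-distribˡ = λ _ _ → ≈-refl
      ; -‿+-comm = λ _ _ → ≈-refl } }

  constant-morphism : 𝔽₂.rawRing -Raw-AlmostCommutative⟶ almostCommutativeRing
  constant-morphism = record
    { ⟦_⟧ = constant
    ; +-homo = λ a b → exact (constant-xor a b)
    ; *-homo = λ { true b → exact λ n → sym (⊛-identityˡ (constant b) n)
                 ; false b → exact λ n → sym (⊛-zeroˡ (constant b) n) }
    ; -‿homo = λ _ → ≈-refl
    ; 0-homo = ≈-refl
    ; 1-homo = ≈-refl }

  constant≟ : ∀ a b → Maybe (constant a ≈ constant b)
  constant≟ true true = just ≈-refl
  constant≟ false false = just ≈-refl
  constant≟ _ _ = nothing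

  -- With coefficients in 𝔽₂ the solver knows that 1 + 1 = 0.
  module Solver = RingSolver 𝔽₂.rawRing almostCommutativeRing constant-morphism constant≟
  open Solver using (solve; con; _:+_; _:*_; _:=_) public

  module R = AlmostCommutativeRing almostCommutativeRing
  module ≈-Reasoning = SetoidReasoning R.setoid

  q^-big : ∀ {e} → N ≤ e → q^ e ≈ 𝟎
  q^-big {e} l = mod λ n n<N → q^-small e n (ℕ.<-≤-trans n<N l)

  ⊕-self : ∀ f → f ⊕ f ≈ 𝟎
  ⊕-self = solve 1 (λ f → f :+ f := con false) ≈-refl

  ⊕-transpose : ∀ {f g h} → f ⊕ g ≈ h → f ≈ h ⊕ g
  ⊕-transpose {f} {g} {h} e =
    ≈-trans (solve 2 (λ f g → f := (f :+ g) :+ g) ≈-refl f g) (⊕-cong e ≈-refl)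

-- Jacobi's triple product

-- The binomial coefficient j (j - 1) / 2, one index behind the usual triangular numbers.
triangle : ℕ → ℕ
triangle zero = 0
triangle (suc j) = triangle j + j

module Exponents (α β : ℕ) where

  r : ℕ
  r = α + β

  -- For z = Q^(β + r b), the power Q^(negative b j) is z^j (Q^r)^(j (j - 1) / 2), the numerator of
  -- the j-th term in Euler's expansion of the product of all 1 + z (Q^r)^i.
  negative : ℕ → ℕ → ℕ
  negative b j = β * j + r * (b * j) + r * triangle j

  -- The exponents (r k² + (α - β) k) / 2 for k = a, a - 1, a - 2, ….
  exponent : ℕ → ℕ → ℕ
  exponent zero i = negative 0 i
  exponent (suc a) zero = (α + r * a) + exponent a 0
  exponent (suc a) (suc i) = exponent a i

  negative-step₁ : ∀ b i → (β + r * b) + negative (suc b) i ≡ negative b (suc i)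
  negative-step₁ b i = identity α β b i (triangle i)
    where
    identity : ∀ α β b i t → (β + (α + β) * b) + (β * i + (α + β) * (suc b * i) + (α + β) * t)
             ≡ β * suc i + (α + β) * (b * suc i) + (α + β) * (t + i)
    identity = ℕSolver.solve-∀

  negative-step₂ : ∀ b i → 0 + negative (suc b) i ≡ r * i + negative b i
  negative-step₂ b i = identity α β b i (triangle i)
    where
    identity : ∀ α β b i t → β * i + (α + β) * (suc b * i) + (α + β) * t
             ≡ (α + β) * i + (β * i + (α + β) * (b * i) + (α + β) * t)
    identity = ℕSolver.solve-∀

  -- Passing from k to k + 1 raises the exponent by α + r k; with k = a - i the term r i is moved to
  -- the other side to stay in ℕ.
  exponent-step : ∀ a i → (α + r * a) + exponent a i ≡ r * i + exponent (suc a) i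
  exponent-step a zero = sym (cong (_+ exponent (suc a) 0) (ℕ.*-zeroʳ r))
  exponent-step zero (suc i) = identity α β i (triangle i)
    where
    identity : ∀ α β i t → (α + (α + β) * 0) + (β * suc i + (α + β) * 0 + (α + β) * (t + i))
             ≡ (α + β) * suc i + (β * i + (α + β) * 0 + (α + β) * t)
    identity = ℕSolver.solve-∀
  exponent-step (suc a) (suc i) = begin
    (α + r * suc a) + exponent a i          ≡⟨ identity₁ α r a (exponent a i) ⟩
    r + ((α + r * a) + exponent a i)        ≡⟨ cong (λ z → r + z) (exponent-step a i) ⟩
    r + (r * i + exponent (suc a) i)        ≡⟨ identity₂ r i (exponent (suc a) i) ⟩
    r * suc i + exponent (suc a) i          ∎
    where
    open ≡-Reasoning
    identity₁ : ∀ α r a e → (α + r * suc a) + e ≡ r + ((α + r * a) + e)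
    identity₁ = ℕSolver.solve-∀
    identity₂ : ∀ r i e → r + (r * i + e) ≡ r * suc i + e
    identity₂ = ℕSolver.solve-∀

  module _ {{_ : NonZero α}} {{_ : NonZero β}} where

    r≢0 : NonZero r
    r≢0 = >-nonZero (ℕ.≤-trans (>-nonZero⁻¹ α) (ℕ.m≤m+n α β))

    i≤negative : ∀ b i → i ≤ negative b i
    i≤negative b i = ℕ.≤-trans (ℕ.m≤n*m i β) (ℕ.≤-trans (ℕ.m≤m+n _ _) (ℕ.m≤m+n _ _))

    b≤negative : ∀ b i → b ≤ negative b (suc i)
    b≤negative b i = ℕ.≤-trans (ℕ.≤-trans (ℕ.m≤m*n b (suc i)) (ℕ.m≤n*m (b * suc i) r {{r≢0}}))
      (ℕ.≤-trans (ℕ.m≤n+m _ (β * suc i)) (ℕ.m≤m+n _ _))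

    exponent-beyond : ∀ n a i → a + n ≤ i → n ≤ exponent a i
    exponent-beyond n zero i l = ℕ.≤-trans l (i≤negative 0 i)
    exponent-beyond n (suc a) (suc i) (s≤s l) = exponent-beyond n a i l

    a≤exponent : ∀ a → a ≤ exponent a 0
    a≤exponent zero = z≤n
    a≤exponent (suc a) = ℕ.+-mono-≤ (ℕ.≤-trans (>-nonZero⁻¹ α) (ℕ.m≤m+n α _)) (a≤exponent a)

    exponent-before : ∀ n a i → i + n ≤ a → n ≤ exponent a i
    exponent-before n a zero l = ℕ.≤-trans l (a≤exponent a)
    exponent-before n (suc a) (suc i) (s≤s l) = exponent-before n a i l

⨁ : (ℕ → Series) → ℕ → Series
⨁ f zero = 𝟎
⨁ f (suc n) = ⨁ f n ⊕ f n

⨀ : (ℕ → Series) → ℕ → Series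
⨀ f zero = 𝟏
⨀ f (suc n) = ⨀ f n ⊛ f n

∏ : (ℕ → ℕ) → ℕ → Series
∏ e = ⨀ λ i → 𝟏 ⊕ q^ (e i)

module Products (N : ℕ) where
  open Truncated N

  ⨁-cong : ∀ {f g} n → (∀ i → f i ≈ g i) → ⨁ f n ≈ ⨁ g n
  ⨁-cong zero h = ≈-refl
  ⨁-cong (suc n) h = ⊕-cong (⨁-cong n h) (h n)

  ⨀-cong : ∀ {f g} n → (∀ i → f i ≈ g i) → ⨀ f n ≈ ⨀ g n
  ⨀-cong zero h = ≈-refl
  ⨀-cong (suc n) h = ⊛-cong (⨀-cong n h) (h n)

  ⨀-⊛ : ∀ f g n → ⨀ (λ i → f i ⊛ g i) n ≈ ⨀ f n ⊛ ⨀ g n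
  ⨀-⊛ f g zero = R.sym (R.*-identityˡ 𝟏)
  ⨀-⊛ f g (suc n) = ≈-trans (⊛-cong (⨀-⊛ f g n) ≈-refl)
    (solve 4 (λ a b c d → (a :* b) :* (c :* d) := (a :* c) :* (b :* d)) ≈-refl (⨀ f n) (⨀ g n) (f n) (g n))

  ⨀-front : ∀ f n → ⨀ f (suc n) ≈ f 0 ⊛ ⨀ (f ∘ suc) n
  ⨀-front f zero = R.*-comm 𝟏 (f 0)
  ⨀-front f (suc n) = ≈-trans (⊛-cong (⨀-front f n) ≈-refl) (R.*-assoc (f 0) _ _)

  ⨀-++ : ∀ f m n → ⨀ f (m + n) ≈ ⨀ f m ⊛ ⨀ (λ i → f (m + i)) n
  ⨀-++ f m zero rewrite ℕ.+-identityʳ m = R.sym (R.*-identityʳ _)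
  ⨀-++ f m (suc n) rewrite ℕ.+-suc m n = ≈-trans (⊛-cong (⨀-++ f m n) ≈-refl) (R.*-assoc _ _ _)

  ⨀-residues : ∀ f d n → ⨀ f (d * n) ≈ ⨀ (λ t → ⨀ (λ i → f (d * i + t)) n) d
  ⨀-residues f d zero rewrite ℕ.*-zeroʳ d = ones d
    where
    ones : ∀ d → 𝟏 ≈ ⨀ (λ _ → 𝟏) d
    ones zero = ≈-refl
    ones (suc d) = ≈-trans (ones d) (R.sym (R.*-identityʳ _))
  ⨀-residues f d (suc n) rewrite ℕ.*-suc d n | ℕ.+-comm d (d * n) =
    ≈-trans (⨀-++ f (d * n) d) (≈-trans (⊛-cong (⨀-residues f d n) ≈-refl) (R.sym (⨀-⊛ _ _ d)))

  ∏-cong : ∀ {e e′} n → (∀ i → e i ≡ e′ i) → ∏ e n ≈ ∏ e′ n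
  ∏-cong n h = ⨀-cong n λ i → exact λ k → cong (λ z → (𝟏 ⊕ q^ z) k) (h i)

  ∏-one : ∀ {e} n → (∀ i → N ≤ e i) → ∏ e n ≈ 𝟏
  ∏-one zero h = ≈-refl
  ∏-one {e} (suc n) h = begin
    ∏ e n ⊛ (𝟏 ⊕ q^ (e n))  ≈⟨ ⊛-cong (∏-one n h) (⊕-cong ≈-refl (q^-big (h n))) ⟩
    𝟏 ⊛ (𝟏 ⊕ 𝟎)            ≈⟨ solve 0 (con true :* (con true :+ con false) := con true) ≈-refl ⟩
    𝟏                       ∎
    where open ≈-Reasoning

  -- From index N on, every factor is 1 modulo q^N.
  ∏-stable : ∀ {e L} → (∀ i → i ≤ e i) → N ≤ L → ∏ e L ≈ ∏ e N
  ∏-stable {e} {L} h l rewrite sym (ℕ.m+[n∸m]≡n l) = ≈-trans (⨀-++ _ N (L ∸ N))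
    (≈-trans (⊛-cong ≈-refl (∏-one (L ∸ N) λ i → ℕ.≤-trans (ℕ.m≤m+n N i) (h (N + i)))) (R.*-identityʳ _))

  square-binomial : ∀ e → (𝟏 ⊕ q^ e) ⊛ (𝟏 ⊕ q^ e) ≈ 𝟏 ⊕ q^ (2 * e)
  square-binomial e = begin
    (𝟏 ⊕ q^ e) ⊛ (𝟏 ⊕ q^ e) ≈⟨ solve 1 (λ x → (con true :+ x) :* (con true :+ x) := con true :+ x :* x) ≈-refl (q^ e) ⟩
    𝟏 ⊕ q^ e ⊛ q^ e         ≈⟨ ⊕-cong ≈-refl (exact (q^-+ e e)) ⟩
    𝟏 ⊕ q^ (e + e)          ≡⟨ cong (λ z → 𝟏 ⊕ q^ (e + z)) (ℕ.+-identityʳ e) ⟨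
    𝟏 ⊕ q^ (2 * e)          ∎
    where open ≈-Reasoning

  ∏-square : ∀ e n → ∏ e n ⊛ ∏ e n ≈ ∏ (λ i → 2 * e i) n
  ∏-square e n = ≈-trans (R.sym (⨀-⊛ _ _ n)) (⨀-cong n λ i → square-binomial (e i))

-- The starting point is Euler's expansion of the product of all 1 + z Q^(r i) at z = Q^β, cleared
-- of its denominators: the i-th term then carries the weight `Euler (suc i)`. The factors 1 + Q^(α
-- + r a) are absorbed one at a time, each shifting the range of k by one, until the weights are 1
-- at every term that is visible below degree N.
module Jacobi (N c α β : ℕ) {{_ : NonZero c}} {{_ : NonZero α}} {{_ : NonZero β}} where
  open Truncated N
  open Products N
  open Exponents α β

  Q^ : ℕ → Series
  Q^ e = q^ (c * e)

  Q^-+ : ∀ a b → Q^ a ⊛ Q^ b ≈ Q^ (a + b)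
  Q^-+ a b = exact λ n → trans (q^-+ (c * a) (c * b) n) (cong (λ e → q^ e n) (sym (ℕ.*-distribˡ-+ c a b)))

  Q^-big : ∀ {e} → N ≤ e → Q^ e ≈ 𝟎
  Q^-big {e} l = q^-big (ℕ.≤-trans l (ℕ.m≤n*m e c))

  i≤cri : ∀ m i → m + i ≤ c * (r * (m + i))
  i≤cri m i = ℕ.≤-trans (ℕ.m≤n*m (m + i) r {{r≢0}}) (ℕ.m≤n*m _ c)

  -- The product of 1 + Q^(r j) over j ≥ m, up to precision. At m = 0 it contains 1 + 1 and
  -- vanishes, which gives the empty boundary term where telescoping starts.
  Euler : ℕ → Series
  Euler m = ∏ (λ i → c * (r * (m + i))) N

  Euler-step : ∀ m → Euler m ≈ (𝟏 ⊕ Q^ (r * m)) ⊛ Euler (suc m)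
  Euler-step m = begin
    Euler m                                 ≈⟨ ∏-stable (λ i → ℕ.≤-trans (ℕ.m≤n+m i m) (i≤cri m i)) (ℕ.n≤1+n N) ⟨
    ∏ (λ i → c * (r * (m + i))) (suc N)     ≈⟨ ⨀-front _ N ⟩
    (𝟏 ⊕ Q^ (r * (m + 0))) ⊛ ∏ (λ i → c * (r * (m + suc i))) N
      ≈⟨ ⊛-cong (exact λ k → cong (λ z → (𝟏 ⊕ Q^ (r * z)) k) (ℕ.+-identityʳ m))
                (∏-cong N λ i → cong (λ z → c * (r * z)) (ℕ.+-suc m i)) ⟩
    (𝟏 ⊕ Q^ (r * m)) ⊛ Euler (suc m)        ∎
    where open ≈-Reasoning

  Euler-one : ∀ {m} → N ≤ m → Euler m ≈ 𝟏
  Euler-one {m} l = ∏-one N λ i → ℕ.≤-trans (ℕ.≤-trans l (ℕ.m≤m+n m i)) (i≤cri m i)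

  weighted : (ℕ → ℕ) → ℕ → Series
  weighted v = ⨁ λ i → Q^ (v i) ⊛ Euler (suc i)

  Euler-zero : Euler 0 ≈ 𝟎
  Euler-zero = begin
    Euler 0                            ≈⟨ Euler-step 0 ⟩
    (𝟏 ⊕ Q^ (r * 0)) ⊛ Euler 1         ≡⟨ cong (λ z → (𝟏 ⊕ q^ z) ⊛ Euler 1) (trans (cong (c *_) (ℕ.*-zeroʳ r)) (ℕ.*-zeroʳ c)) ⟩
    (𝟏 ⊕ 𝟏) ⊛ Euler 1                  ≈⟨ solve 1 (λ x → (con true :+ con true) :* x := con false) ≈-refl (Euler 1) ⟩
    𝟎                                  ∎
    where open ≈-Reasoning

  -- The recursion Euler m = (1 + Q^(r m)) Euler (m + 1) makes the sum telescope.
  weighted-step : ∀ {v w} a b → (∀ i → a + v i ≡ w (suc i)) → (∀ i → b + v i ≡ r * i + w i) →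
    ∀ M → (Q^ a ⊕ Q^ b) ⊛ weighted v M ≈ weighted w M ⊕ Q^ (w M) ⊛ Euler M
  weighted-step {v} {w} a b h₁ h₂ zero = begin
    (Q^ a ⊕ Q^ b) ⊛ 𝟎          ≈⟨ R.zeroʳ _ ⟩
    𝟎                          ≈⟨ R.zeroʳ _ ⟨
    Q^ (w 0) ⊛ 𝟎               ≈⟨ ⊛-cong ≈-refl Euler-zero ⟨
    Q^ (w 0) ⊛ Euler 0         ≈⟨ R.+-identityˡ _ ⟨
    𝟎 ⊕ Q^ (w 0) ⊛ Euler 0     ∎
    where open ≈-Reasoning
  weighted-step {v} {w} a b h₁ h₂ (suc M) = begin
    (A ⊕ B) ⊛ (weighted v M ⊕ V ⊛ E)
      ≈⟨ solve 5 (λ a b s v e → (a :+ b) :* (s :+ v :* e) := (a :+ b) :* s :+ ((a :* v) :* e :+ (b :* v) :* e)) ≈-refl A B (weighted v M) V E ⟩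
    (A ⊕ B) ⊛ weighted v M ⊕ ((A ⊛ V) ⊛ E ⊕ (B ⊛ V) ⊛ E)
      ≈⟨ ⊕-cong (weighted-step a b h₁ h₂ M) (⊕-cong (⊛-cong AV ≈-refl) (⊛-cong BV ≈-refl)) ⟩
    (weighted w M ⊕ W ⊛ Euler M) ⊕ (W′ ⊛ E ⊕ (D ⊛ W) ⊛ E)
      ≈⟨ ⊕-cong (⊕-cong ≈-refl (⊛-cong ≈-refl (Euler-step M))) ≈-refl ⟩
    (weighted w M ⊕ W ⊛ ((𝟏 ⊕ D) ⊛ E)) ⊕ (W′ ⊛ E ⊕ (D ⊛ W) ⊛ E)
      ≈⟨ solve 5 (λ s w d e w′ → (s :+ w :* ((con true :+ d) :* e)) :+ (w′ :* e :+ (d :* w) :* e) := (s :+ w :* e) :+ w′ :* e)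
           ≈-refl (weighted w M) W D E W′ ⟩
    (weighted w M ⊕ W ⊛ E) ⊕ W′ ⊛ E ∎
    where
    open ≈-Reasoning
    A = Q^ a
    B = Q^ b
    V = Q^ (v M)
    W = Q^ (w M)
    W′ = Q^ (w (suc M))
    D = Q^ (r * M)
    E = Euler (suc M)
    AV : A ⊛ V ≈ W′
    AV = ≈-trans (Q^-+ a (v M)) (exact λ k → cong (λ z → Q^ z k) (h₁ M))
    BV : B ⊛ V ≈ D ⊛ W
    BV = ≈-trans (Q^-+ b (v M)) (≈-trans (exact λ k → cong (λ z → Q^ z k) (h₂ M)) (≈-sym (Q^-+ (r * M) (w M))))

  Q^-zero : Q^ 0 ≈ 𝟏
  Q^-zero = exact λ k → cong (λ z → q^ z k) (ℕ.*-zeroʳ c)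

  drop : ∀ {f e g} → N ≤ e → f ⊕ Q^ e ⊛ g ≈ f
  drop {f} {e} {g} l = ≈-trans (⊕-cong ≈-refl (⊛-cong (Q^-big l) ≈-refl))
    (solve 2 (λ f g → f :+ con false :* g := f) ≈-refl f g)

  -- Each step splits off 1 + z and replaces z by z Q^r. The boundary term left by telescoping is
  -- beyond the precision because `negative n M` is at least M.
  weighted-negative : ∀ M → N ≤ M → ∀ n → weighted (negative 0) M ≈ ∏ (λ i → c * (β + r * i)) n ⊛ weighted (negative n) M
  weighted-negative M l zero = ≈-sym (R.*-identityˡ _)
  weighted-negative M l (suc n) = begin
    weighted (negative 0) M                          ≈⟨ weighted-negative M l n ⟩
    X ⊛ weighted (negative n) M                      ≈⟨ ⊛-cong ≈-refl (drop (ℕ.≤-trans l (i≤negative n M))) ⟨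
    X ⊛ (weighted (negative n) M ⊕ Q^ (negative n M) ⊛ Euler M)
      ≈⟨ ⊛-cong ≈-refl (weighted-step (β + r * n) 0 (negative-step₁ n) (negative-step₂ n) M) ⟨
    X ⊛ ((Y ⊕ Q^ 0) ⊛ Z)                             ≈⟨ ⊛-cong ≈-refl (⊛-cong (⊕-cong ≈-refl Q^-zero) ≈-refl) ⟩
    X ⊛ ((Y ⊕ 𝟏) ⊛ Z)                                ≈⟨ solve 3 (λ x y z → x :* ((y :+ con true) :* z) := (x :* (con true :+ y)) :* z) ≈-refl X Y Z ⟩
    (X ⊛ (𝟏 ⊕ Y)) ⊛ Z                                ∎
    where
    open ≈-Reasoning
    X = ∏ (λ i → c * (β + r * i)) n
    Y = Q^ (β + r * n)
    Z = weighted (negative (suc n)) M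

  -- With z = Q^(β + r N) every term except i = 0 has degree at least N.
  weighted-limit : ∀ M → weighted (negative N) (suc M) ≈ Euler 1
  weighted-limit zero = begin
    𝟎 ⊕ Q^ (negative N 0) ⊛ Euler 1   ≈⟨ ⊕-cong ≈-refl (⊛-cong (≈-trans (exact λ k → cong (λ z → Q^ z k) (identity β r N)) Q^-zero) ≈-refl) ⟩
    𝟎 ⊕ 𝟏 ⊛ Euler 1                   ≈⟨ solve 1 (λ e → con false :+ con true :* e := e) ≈-refl (Euler 1) ⟩
    Euler 1                           ∎
    where
    open ≈-Reasoning
    identity : ∀ β r n → β * 0 + r * (n * 0) + r * 0 ≡ 0
    identity = ℕSolver.solve-∀
  weighted-limit (suc M) = ≈-trans (drop (b≤negative N M)) (weighted-limit M)

  -- The bound on M puts the boundary term of each step at some k ≤ - N, where its power of Q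
  -- vanishes modulo q^N.
  weighted-positive : ∀ M a → a + N ≤ M → ∏ (λ i → c * (α + r * i)) a ⊛ weighted (negative 0) M ≈ weighted (exponent a) M
  weighted-positive M zero l = R.*-identityˡ _
  weighted-positive M (suc a) l = begin
    (X ⊛ (𝟏 ⊕ Y)) ⊛ Z                   ≈⟨ solve 3 (λ x y z → (x :* (con true :+ y)) :* z := (con true :+ y) :* (x :* z)) ≈-refl X Y Z ⟩
    (𝟏 ⊕ Y) ⊛ (X ⊛ Z)                   ≈⟨ ⊛-cong (⊕-cong (≈-sym Q^-zero) ≈-refl) (weighted-positive M a (ℕ.<⇒≤ l)) ⟩
    (Q^ 0 ⊕ Y) ⊛ weighted (exponent a) M ≈⟨ weighted-step 0 (α + r * a) (λ _ → refl) (exponent-step a) M ⟩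
    weighted (exponent (suc a)) M ⊕ Q^ (exponent (suc a) M) ⊛ Euler M
      ≈⟨ drop (exponent-beyond N (suc a) M l) ⟩
    weighted (exponent (suc a)) M       ∎
    where
    open ≈-Reasoning
    X = ∏ (λ i → c * (α + r * i)) a
    Y = Q^ (α + r * a)
    Z = weighted (negative 0) M

  -- The window 2 N ≥ k ≥ - N, which contains every k with exponent below N.
  theta : Series
  theta = ⨁ (λ i → Q^ (exponent (N + N) i)) (suc (N + N + N))

  -- Either i ≥ N, and the weight is 1, or k = 2 N - i ≥ N, and the power of Q is itself 0 to this
  -- precision. The window reaches up to 2 N to make these two cases exhaustive.
  weighted-theta : ∀ i → Q^ (exponent (N + N) i) ⊛ Euler (suc i) ≈ Q^ (exponent (N + N) i)
  weighted-theta i with ℕ.≤-total N i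
  ... | inj₁ N≤i = ≈-trans (⊛-cong ≈-refl (Euler-one (ℕ.m≤n⇒m≤1+n N≤i))) (R.*-identityʳ _)
  ... | inj₂ i≤N = ≈-trans (⊛-cong big ≈-refl) (≈-trans (R.zeroˡ _) (≈-sym big))
    where big = Q^-big (exponent-before N (N + N) i (ℕ.+-monoˡ-≤ N i≤N))

  jacobi : ∏ (λ i → c * (α + r * i)) N ⊛ ∏ (λ i → c * (β + r * i)) N ⊛ ∏ (λ i → c * (r * suc i)) N ≈ theta
  jacobi = begin
    ∏ (λ i → c * (α + r * i)) N ⊛ B ⊛ Euler 1
      ≈⟨ ⊛-cong (⊛-cong (≈-sym (∏-stable α-large (ℕ.m≤m+n N N))) ≈-refl) (≈-sym (weighted-limit (N + N + N))) ⟩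
    A ⊛ B ⊛ weighted (negative N) M
      ≈⟨ R.*-assoc A B _ ⟩
    A ⊛ (B ⊛ weighted (negative N) M)
      ≈⟨ ⊛-cong ≈-refl (≈-sym (weighted-negative M N≤M N)) ⟩
    A ⊛ weighted (negative 0) M
      ≈⟨ weighted-positive M (N + N) (ℕ.n≤1+n _) ⟩
    weighted (exponent (N + N)) M
      ≈⟨ ⨁-cong M weighted-theta ⟩
    theta ∎
    where
    open ≈-Reasoning
    M = suc (N + N + N)
    A = ∏ (λ i → c * (α + r * i)) (N + N)
    B = ∏ (λ i → c * (β + r * i)) N
    N≤M : N ≤ M
    N≤M = ℕ.m≤n⇒m≤1+n (ℕ.m≤n+m N (N + N))
    α-large : ∀ i → i ≤ c * (α + r * i)
    α-large i = ℕ.≤-trans (ℕ.m≤n*m i r {{r≢0}}) (ℕ.≤-trans (ℕ.m≤n+m _ α) (ℕ.m≤n*m _ c))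

-- Theta series and squares

-- The ring solver proves only unconditional identities. Hypotheses therefore enter through a
-- certificate: x - y is written as a combination of their differences with explicit coefficients,
-- which the solver checks.
linear₁ : ∀ k {a b x y} → a ≡ b → x ℤ.- y ≡ k ℤ.* (a ℤ.- b) → x ≡ y
linear₁ k {a} {x = x} {y} refl e = ℤ.i-j≡0⇒i≡j x y (trans e (identity k a))
  where
  identity : ∀ k a → k ℤ.* (a ℤ.- a) ≡ + 0
  identity = ℤSolver.solve-∀

linear₂ : ∀ k l {a b c d x y} → a ≡ b → c ≡ d → x ℤ.- y ≡ k ℤ.* (a ℤ.- b) ℤ.+ l ℤ.* (c ℤ.- d) → x ≡ y
linear₂ k l {a} {c = c} {x = x} {y} refl refl e = ℤ.i-j≡0⇒i≡j x y (trans e (identity k l a c))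
  where
  identity : ∀ k l a c → k ℤ.* (a ℤ.- a) ℤ.+ l ℤ.* (c ℤ.- c) ≡ + 0
  identity = ℤSolver.solve-∀

linear₃ : ∀ k l m {a b c d e f x y} → a ≡ b → c ≡ d → e ≡ f →
  x ℤ.- y ≡ k ℤ.* (a ℤ.- b) ℤ.+ l ℤ.* (c ℤ.- d) ℤ.+ m ℤ.* (e ℤ.- f) → x ≡ y
linear₃ k l m {a} {c = c} {e = e} {x = x} {y} refl refl refl h = ℤ.i-j≡0⇒i≡j x y (trans h (identity k l m a c e))
  where
  identity : ∀ k l m a c e → k ℤ.* (a ℤ.- a) ℤ.+ l ℤ.* (c ℤ.- c) ℤ.+ m ℤ.* (e ℤ.- e) ≡ + 0
  identity = ℤSolver.solve-∀

no-multiple : ∀ d r z → 0 < r → r < d → + d ℤ.* z ≢ + r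
no-multiple d r z 0<r r<d e = contradiction
  (ℕ.∣⇒≤ {{>-nonZero 0<r}} (ℕ.divides ∣ z ∣ (trans (sym (cong ∣_∣ e)) (trans (ℤ.abs-* (+ d) z) (ℕ.*-comm d ∣ z ∣)))))
  (ℕ.<⇒≱ r<d)

residue : ∀ d {{_ : NonZero d}} z → ∃ λ r → ∃ λ q → r < d × z ≡ + r ℤ.+ q ℤ.* + d
residue d z = z ℤ.%ℕ d , z ℤ./ℕ d , ℤ.n%ℕd<d z d , ℤ.a≡a%ℕn+[a/ℕn]*n z d

*-zero : ∀ x y → x ℤ.* y ≡ + 0 → x ≡ + 0 ⊎ y ≡ + 0
*-zero x y = ℤ.i*j≡0⇒i≡0∨j≡0 x

square≡⇒± : ∀ x y → x ℤ.* x ≡ y ℤ.* y → x ≡ y ⊎ x ≡ ℤ.- y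
square≡⇒± x y e with *-zero (x ℤ.- y) (x ℤ.+ y) (linear₁ (+ 1) e (identity x y))
  where
  identity : ∀ x y → (x ℤ.- y) ℤ.* (x ℤ.+ y) ℤ.- + 0 ≡ + 1 ℤ.* (x ℤ.* x ℤ.- y ℤ.* y)
  identity = ℤSolver.solve-∀
... | inj₁ h = inj₁ (linear₁ (+ 1) h (identity x y))
  where
  identity : ∀ x y → x ℤ.- y ≡ + 1 ℤ.* (x ℤ.- y ℤ.- + 0)
  identity = ℤSolver.solve-∀
... | inj₂ h = inj₂ (linear₁ (+ 1) h (identity x y))
  where
  identity : ∀ x y → x ℤ.- ℤ.- y ≡ + 1 ℤ.* (x ℤ.+ y ℤ.- + 0)
  identity = ℤSolver.solve-∀

Square : ℕ → ℕ → ℕ → Set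
Square a b p = ∃ λ x → x ℤ.* x ≡ + a ℤ.* + p ℤ.+ + b

module ExponentSquares (α β : ℕ) where
  open Exponents α β

  triangle-double : ∀ i → + 2 ℤ.* + triangle i ≡ + i ℤ.* + i ℤ.- + i
  triangle-double zero = refl
  triangle-double (suc i) = linear₁ (+ 1) (triangle-double i) (identity (+ i) (+ triangle i))
    where
    identity : ∀ i t → + 2 ℤ.* (t ℤ.+ i) ℤ.- ((+ 1 ℤ.+ i) ℤ.* (+ 1 ℤ.+ i) ℤ.- (+ 1 ℤ.+ i)) ≡ + 1 ℤ.* (+ 2 ℤ.* t ℤ.- (i ℤ.* i ℤ.- i))
    identity = ℤSolver.solve-∀

  exponent-double : ∀ a i → let k = + a ℤ.- + i in
    + 2 ℤ.* + exponent a i ≡ + r ℤ.* (k ℤ.* k) ℤ.+ (+ α ℤ.- + β) ℤ.* k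
  exponent-double zero i = trans (cong (+ 2 ℤ.*_) cast) (linear₁ (+ r) (triangle-double i) (identity (+ α) (+ β) (+ i) (+ triangle i)))
    where
    cast : + negative 0 i ≡ + β ℤ.* + i ℤ.+ + r ℤ.* + 0 ℤ.+ + r ℤ.* + triangle i
    cast = cong₂ ℤ._+_ (cong₂ ℤ._+_ (ℤ.pos-* β i) (ℤ.pos-* r 0)) (ℤ.pos-* r (triangle i))
    identity : ∀ α β i t → let k = + 0 ℤ.- i ; r = α ℤ.+ β in
      + 2 ℤ.* (β ℤ.* i ℤ.+ r ℤ.* + 0 ℤ.+ r ℤ.* t) ℤ.- (r ℤ.* (k ℤ.* k) ℤ.+ (α ℤ.- β) ℤ.* k) ≡ r ℤ.* (+ 2 ℤ.* t ℤ.- (i ℤ.* i ℤ.- i))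
    identity = ℤSolver.solve-∀
  exponent-double (suc a) zero = trans (cong (+ 2 ℤ.*_) cast) (linear₁ (+ 1) (exponent-double a 0) (identity (+ α) (+ β) (+ a) (+ exponent a 0)))
    where
    cast : + exponent (suc a) 0 ≡ + α ℤ.+ + r ℤ.* + a ℤ.+ + exponent a 0
    cast = cong (λ z → + α ℤ.+ z ℤ.+ + exponent a 0) (ℤ.pos-* r a)
    identity : ∀ α β a e → let k = a ℤ.- + 0 ; k′ = (+ 1 ℤ.+ a) ℤ.- + 0 ; r = α ℤ.+ β in
      + 2 ℤ.* (α ℤ.+ r ℤ.* a ℤ.+ e) ℤ.- (r ℤ.* (k′ ℤ.* k′) ℤ.+ (α ℤ.- β) ℤ.* k′)
        ≡ + 1 ℤ.* (+ 2 ℤ.* e ℤ.- (r ℤ.* (k ℤ.* k) ℤ.+ (α ℤ.- β) ℤ.* k))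
    identity = ℤSolver.solve-∀
  exponent-double (suc a) (suc i) = trans (exponent-double a i)
    (cong (λ k → + r ℤ.* (k ℤ.* k) ℤ.+ (+ α ℤ.- + β) ℤ.* k) (identity (+ a) (+ i)))
    where
    identity : ∀ a i → a ℤ.- i ≡ (+ 1 ℤ.+ a) ℤ.- (+ 1 ℤ.+ i)
    identity = ℤSolver.solve-∀

  root : ℤ → ℤ
  root k = + 2 ℤ.* + r ℤ.* k ℤ.+ (+ α ℤ.- + β)

  -- The equation 2 p = r k² + (α - β) k, multiplied by 4 r and completed to a square.
  Shape : ℕ → ℤ → Set
  Shape p k = root k ℤ.* root k ≡ + 8 ℤ.* + r ℤ.* + p ℤ.+ (+ α ℤ.- + β) ℤ.* (+ α ℤ.- + β)

  exponent-shape : ∀ a i → Shape (exponent a i) (+ a ℤ.- + i)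
  exponent-shape a i = linear₁ (ℤ.- (+ 4 ℤ.* + r)) (exponent-double a i) (identity (+ r) (+ α ℤ.- + β) (+ a ℤ.- + i) (+ exponent a i))
    where
    identity : ∀ r d k e → (+ 2 ℤ.* r ℤ.* k ℤ.+ d) ℤ.* (+ 2 ℤ.* r ℤ.* k ℤ.+ d) ℤ.- (+ 8 ℤ.* r ℤ.* e ℤ.+ d ℤ.* d)
             ≡ ℤ.- (+ 4 ℤ.* r) ℤ.* (+ 2 ℤ.* e ℤ.- (r ℤ.* (k ℤ.* k) ℤ.+ d ℤ.* k))
    identity = ℤSolver.solve-∀

  exponent-shift : ∀ m a i → exponent (m + a) (m + i) ≡ exponent a i
  exponent-shift zero a i = refl
  exponent-shift (suc m) a i = exponent-shift m a i

  module _ {{_ : NonZero α}} (α<β : α < β) where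

    0<r : 0 < r
    0<r = ℕ.<-≤-trans (>-nonZero⁻¹ α) (ℕ.m≤m+n α β)

    shape-unique : ∀ {p p′} k → Shape p k → Shape p′ k → p ≡ p′
    shape-unique {p} {p′} k h h′ = ℤ.+-injective (ℤ.*-cancelˡ-≡ (+ r) (+ p) (+ p′) {{>-nonZero 0<r}}
      (ℤ.*-cancelˡ-≡ (+ 8) _ _ (linear₂ (ℤ.- + 1) (+ 1) h h′ (identity (+ r) (+ p) (+ p′) (+ α ℤ.- + β) (root k ℤ.* root k)))))
      where
      identity : ∀ r p p′ d s → + 8 ℤ.* (r ℤ.* p) ℤ.- + 8 ℤ.* (r ℤ.* p′)
        ≡ ℤ.- + 1 ℤ.* (s ℤ.- (+ 8 ℤ.* r ℤ.* p ℤ.+ d ℤ.* d)) ℤ.+ + 1 ℤ.* (s ℤ.- (+ 8 ℤ.* r ℤ.* p′ ℤ.+ d ℤ.* d))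
      identity = ℤSolver.solve-∀

    -- Two different values k and l with the same exponent satisfy r (k + l) = β - α, which is
    -- impossible since 0 < β - α < r. Hence no two terms of a theta series cancel modulo 2.
    exponent-injective : ∀ a i j → exponent a i ≡ exponent a j → i ≡ j
    exponent-injective a i j e
      with *-zero (+ i ℤ.- + j) (+ r ℤ.* (+ 2 ℤ.* + a ℤ.- + i ℤ.- + j) ℤ.+ (+ α ℤ.- + β))
             (linear₁ (+ 1) (trans (sym (exponent-double a j)) (trans (cong (λ z → + 2 ℤ.* + z) (sym e)) (exponent-double a i)))
               (identity (+ α) (+ β) (+ a) (+ i) (+ j)))
      where
      identity : ∀ α β a i j → let k = a ℤ.- i ; l = a ℤ.- j ; r = α ℤ.+ β in
        (i ℤ.- j) ℤ.* (r ℤ.* (+ 2 ℤ.* a ℤ.- i ℤ.- j) ℤ.+ (α ℤ.- β)) ℤ.- + 0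
          ≡ + 1 ℤ.* ((r ℤ.* (l ℤ.* l) ℤ.+ (α ℤ.- β) ℤ.* l) ℤ.- (r ℤ.* (k ℤ.* k) ℤ.+ (α ℤ.- β) ℤ.* k))
      identity = ℤSolver.solve-∀
    ... | inj₁ h = ℤ.+-injective (ℤ.i-j≡0⇒i≡j (+ i) (+ j) h)
    ... | inj₂ h = contradiction h′ (no-multiple r (β ∸ α) z (ℕ.m<n⇒0<n∸m α<β) (ℕ.≤-<-trans (ℕ.m∸n≤m β α) (ℕ.m<n+m β (>-nonZero⁻¹ α))))
      where
      z = + 2 ℤ.* + a ℤ.- + i ℤ.- + j
      split : + β ≡ + α ℤ.+ + (β ∸ α)
      split = cong +_ (sym (ℕ.m+[n∸m]≡n (ℕ.<⇒≤ α<β)))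
      h′ : + r ℤ.* z ≡ + (β ∸ α)
      h′ = linear₂ (+ 1) (+ 1) h split (identity (+ r ℤ.* z) (+ α) (+ β) (+ (β ∸ α)))
        where
        identity : ∀ s α β d → s ℤ.- d ≡ + 1 ℤ.* (s ℤ.+ (α ℤ.- β) ℤ.- + 0) ℤ.+ + 1 ℤ.* (β ℤ.- (α ℤ.+ d))
        identity = ℤSolver.solve-∀

⨁-q^-true : ∀ (e : ℕ → ℕ) M n → ⨁ (λ i → q^ (e i)) M n ≡ true → ∃ λ i → e i ≡ n
⨁-q^-true e (suc M) n h with ⨁ (λ i → q^ (e i)) M n in eq₁ | q^ (e M) n in eq₂
... | true | _ = ⨁-q^-true e M n eq₁
... | false | true = M , q^-true (e M) n eq₂
... | false | false = contradiction (trans (sym h) (trans (⊕-coeff (⨁ (λ i → q^ (e i)) M) (q^ (e M)) n) (cong₂ _xor_ eq₁ eq₂))) λ ()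

⨁-q^-false : ∀ (e : ℕ → ℕ) M n → (∀ i → i < M → e i ≢ n) → ⨁ (λ i → q^ (e i)) M n ≡ false
⨁-q^-false e zero n h = refl
⨁-q^-false e (suc M) n h = trans (⊕-coeff (⨁ (λ i → q^ (e i)) M) (q^ (e M)) n)
  (cong₂ _xor_ (⨁-q^-false e M n λ i l → h i (ℕ.m≤n⇒m≤1+n l)) last)
  where
  last : q^ (e M) n ≡ false
  last with q^ (e M) n in eq
  ... | true = contradiction (q^-true (e M) n eq) (h M ℕ.≤-refl)
  ... | false = refl

⨁-q^-at : ∀ (e : ℕ → ℕ) M i → i < M → (∀ j → e j ≡ e i → j ≡ i) → ⨁ (λ i → q^ (e i)) M (e i) ≡ true
⨁-q^-at e (suc M) i i<M injective with ℕ.m<1+n⇒m<n∨m≡n i<M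
... | inj₂ refl = trans (⊕-coeff (⨁ (λ i → q^ (e i)) M) (q^ (e M)) (e i))
  (cong₂ _xor_ (⨁-q^-false e M (e i) λ j l h → ℕ.<⇒≢ l (injective j h)) (q^-at (e i)))
... | inj₁ l = trans (⊕-coeff (⨁ (λ i → q^ (e i)) M) (q^ (e M)) (e i))
  (cong₂ _xor_ (⨁-q^-at e M i l injective) last)
  where
  last : q^ (e M) (e i) ≡ false
  last with q^ (e M) (e i) in eq
  ... | true = contradiction (sym (injective M (q^-true (e M) (e i) eq))) (ℕ.<⇒≢ l)
  ... | false = refl

module ThetaCoefficients (N c α β : ℕ) {{_ : NonZero c}} {{_ : NonZero α}} {{_ : NonZero β}} (α<β : α < β) where
  open Exponents α β
  open ExponentSquares α β
  open Jacobi N c α β using (theta)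

  theta-true : ∀ n → theta n ≡ true → ∃ λ p → n ≡ c * p × ∃ (Shape p)
  theta-true n h with ⨁-q^-true (λ i → c * exponent (N + N) i) (suc (N + N + N)) n h
  ... | i , e = exponent (N + N) i , sym e , + (N + N) ℤ.- + i , exponent-shape (N + N) i

  private
    hit : ∀ i → i < suc (N + N + N) → theta (c * exponent (N + N) i) ≡ true
    hit i l = ⨁-q^-at (λ i → c * exponent (N + N) i) (suc (N + N + N)) i l
      λ j e → exponent-injective α<β (N + N) j i (ℕ.*-cancelˡ-≡ _ _ c e)

  -- The absolute value of k is at most p, hence at most N, so k lies in the window;
  -- `exponent-shift` carries the exponent computed near k = 0 to its place there.
  true-theta : ∀ p k → c * p < N → Shape p k → theta (c * p) ≡ true
  true-theta p (+ a) l h = subst (λ z → theta (c * z) ≡ true) e₂ (hit (N + N ∸ a) (s≤s (ℕ.≤-trans (ℕ.m∸n≤m (N + N) a) (ℕ.m≤m+n _ N))))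
    where
    e₁ : exponent a 0 ≡ p
    e₁ = shape-unique α<β (+ a) (subst (Shape (exponent a 0)) (ℤ.+-identityʳ (+ a)) (exponent-shape a 0)) h
    a≤N : a ≤ N
    a≤N = ℕ.≤-trans (a≤exponent a) (ℕ.≤-trans (ℕ.≤-reflexive e₁) (ℕ.≤-trans (ℕ.m≤n*m p c) (ℕ.<⇒≤ l)))
    m = N + N ∸ a
    e₂ : exponent (N + N) m ≡ p
    e₂ = trans (cong₂ exponent (sym (ℕ.m∸n+n≡m (ℕ.≤-trans a≤N (ℕ.m≤m+n N N)))) (sym (ℕ.+-identityʳ m)))
               (trans (exponent-shift m a 0) e₁)
  true-theta p (-[1+ j ]) l h = subst (λ z → theta (c * z) ≡ true) e₂ (hit (N + N + suc j) (s≤s (ℕ.+-monoʳ-≤ (N + N) j≤N)))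
    where
    e₁ : exponent 0 (suc j) ≡ p
    e₁ = shape-unique α<β (-[1+ j ]) (exponent-shape 0 (suc j)) h
    j≤N : suc j ≤ N
    j≤N = ℕ.≤-trans (i≤negative 0 (suc j)) (ℕ.≤-trans (ℕ.≤-reflexive e₁) (ℕ.≤-trans (ℕ.m≤n*m p c) (ℕ.<⇒≤ l)))
    e₂ : exponent (N + N) (N + N + suc j) ≡ p
    e₂ = trans (cong (λ z → exponent z (N + N + suc j)) (sym (ℕ.+-identityʳ (N + N)))) (trans (exponent-shift (N + N) 0 (suc j)) e₁)

-- Below N, the indicator series of the numbers c p with a p + b a square. Every identity of theta
-- series is used only through this description.
record SquareSeries (N c a b : ℕ) (f : Series) : Set where
  field
    square : ∀ n → n < N → f n ≡ true → ∃ λ p → n ≡ c * p × Square a b p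
    occurs : ∀ p → c * p < N → Square a b p → f (c * p) ≡ true

SquareRoots : (d b s t : ℕ) → ℕ → Set
SquareRoots d b s t r = + d ℤ.∣ + r ℤ.* + r ℤ.- + b → r ≡ s ⊎ r ≡ t

square-roots? : ∀ d b s t → Dec (∀ {r} → r < d → SquareRoots d b s t r)
square-roots? d b s t = ℕ.allUpTo? (λ r → (+ d ℤ.∣? (+ r ℤ.* + r ℤ.- + b)) →-dec (r ≟ s ⊎-dec r ≟ t)) d

square-root : ∀ d a b s t {{_ : NonZero d}} → (∀ {r} → r < d → SquareRoots d b s t r) →
  ∀ p x → x ℤ.* x ≡ (+ d ℤ.* + a) ℤ.* + p ℤ.+ + b → ∃ λ q → x ≡ + s ℤ.+ q ℤ.* + d ⊎ x ≡ + t ℤ.+ q ℤ.* + d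
square-root d a b s t H p x e with residue d x
... | r , q , r<d , refl with H r<d (divides z (linear₁ (+ 1) e (identity (+ r) q (+ d) (+ a) (+ b) (+ p))))
  where
  z = + a ℤ.* + p ℤ.- + 2 ℤ.* + r ℤ.* q ℤ.- q ℤ.* q ℤ.* + d
  identity : ∀ r q d a b p → r ℤ.* r ℤ.- b ℤ.- (a ℤ.* p ℤ.- + 2 ℤ.* r ℤ.* q ℤ.- q ℤ.* q ℤ.* d) ℤ.* d
           ≡ + 1 ℤ.* ((r ℤ.+ q ℤ.* d) ℤ.* (r ℤ.+ q ℤ.* d) ℤ.- (d ℤ.* a ℤ.* p ℤ.+ b))
  identity = ℤSolver.solve-∀
... | inj₁ refl = q , inj₁ refl
... | inj₂ refl = q , inj₂ refl

reflected-square : ∀ {y z m} x → x ≡ y → z ≡ ℤ.- y → x ℤ.* x ≡ m → z ℤ.* z ≡ m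
reflected-square x refl refl h = trans (identity x) h
  where
  identity : ∀ x → ℤ.- x ℤ.* ℤ.- x ≡ x ℤ.* x
  identity = ℤSolver.solve-∀

-- A root x of a p + b falls into one of two opposite residue classes, so x or - x is `root k` for
-- some k. For (1 , 3) the root is 2 (4 k - 1), and the common factor 4 of the squares is removed.
record ThetaInstance (α β a b : ℕ) : Set where
  open ExponentSquares α β
  field
    shape⇒square : ∀ p k → Shape p k → Square a b p
    square⇒shape : ∀ p → Square a b p → ∃ (Shape p)

instance-1-2 : ThetaInstance 1 2 24 1
instance-1-2 = record
  { shape⇒square = λ p k h → root k , h
  ; square⇒shape = λ { p (x , e) → shape p x e (square-root 6 4 1 1 5 (from-yes (square-roots? 6 1 1 5)) p x e) } }
  where
  open ExponentSquares 1 2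
  identity₁ : ∀ q → + 6 ℤ.* ℤ.- q ℤ.+ -[1+ 0 ] ≡ ℤ.- (+ 1 ℤ.+ q ℤ.* + 6)
  identity₁ = ℤSolver.solve-∀
  identity₂ : ∀ q → + 6 ℤ.* (q ℤ.+ + 1) ℤ.+ -[1+ 0 ] ≡ + 5 ℤ.+ q ℤ.* + 6
  identity₂ = ℤSolver.solve-∀
  shape : ∀ p x → x ℤ.* x ≡ + 24 ℤ.* + p ℤ.+ + 1 → (∃ λ q → x ≡ + 1 ℤ.+ q ℤ.* + 6 ⊎ x ≡ + 5 ℤ.+ q ℤ.* + 6) → ∃ (Shape p)
  shape p x e (q , inj₁ h) = ℤ.- q , reflected-square x h (identity₁ q) e
  shape p x e (q , inj₂ h) = q ℤ.+ + 1 , trans (cong (λ y → y ℤ.* y) (trans (identity₂ q) (sym h))) e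

instance-1-3 : ThetaInstance 1 3 8 1
instance-1-3 = record
  { shape⇒square = λ p k h → + 4 ℤ.* k ℤ.- + 1 , ℤ.*-cancelˡ-≡ (+ 4) _ _ (linear₁ (+ 1) h (identity₀ k (+ p)))
  ; square⇒shape = λ { p (x , e) → shape p x e (square-root 4 2 1 1 3 (from-yes (square-roots? 4 1 1 3)) p x e) } }
  where
  open ExponentSquares 1 3
  identity₀ : ∀ k p → + 4 ℤ.* ((+ 4 ℤ.* k ℤ.- + 1) ℤ.* (+ 4 ℤ.* k ℤ.- + 1)) ℤ.- + 4 ℤ.* (+ 8 ℤ.* p ℤ.+ + 1)
            ≡ + 1 ℤ.* ((+ 8 ℤ.* k ℤ.+ -[1+ 1 ]) ℤ.* (+ 8 ℤ.* k ℤ.+ -[1+ 1 ]) ℤ.- (+ 32 ℤ.* p ℤ.+ + 4))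
  identity₀ = ℤSolver.solve-∀
  identity₁ : ∀ q p → let y = + 8 ℤ.* ℤ.- q ℤ.+ -[1+ 1 ] ; x = + 1 ℤ.+ q ℤ.* + 4 in
    y ℤ.* y ℤ.- (+ 32 ℤ.* p ℤ.+ + 4) ≡ + 4 ℤ.* (x ℤ.* x ℤ.- (+ 8 ℤ.* p ℤ.+ + 1))
  identity₁ = ℤSolver.solve-∀
  identity₂ : ∀ q p → let y = + 8 ℤ.* (q ℤ.+ + 1) ℤ.+ -[1+ 1 ] ; x = + 3 ℤ.+ q ℤ.* + 4 in
    y ℤ.* y ℤ.- (+ 32 ℤ.* p ℤ.+ + 4) ≡ + 4 ℤ.* (x ℤ.* x ℤ.- (+ 8 ℤ.* p ℤ.+ + 1))
  identity₂ = ℤSolver.solve-∀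
  shape : ∀ p x → x ℤ.* x ≡ + 8 ℤ.* + p ℤ.+ + 1 → (∃ λ q → x ≡ + 1 ℤ.+ q ℤ.* + 4 ⊎ x ≡ + 3 ℤ.+ q ℤ.* + 4) → ∃ (Shape p)
  shape p _ e (q , inj₁ refl) = ℤ.- q , linear₁ (+ 4) e (identity₁ q (+ p))
  shape p _ e (q , inj₂ refl) = q ℤ.+ + 1 , linear₁ (+ 4) e (identity₂ q (+ p))

instance-1-4 : ThetaInstance 1 4 40 9
instance-1-4 = record
  { shape⇒square = λ p k h → root k , h
  ; square⇒shape = λ { p (x , e) → shape p x e (square-root 10 4 9 3 7 (from-yes (square-roots? 10 9 3 7)) p x e) } }
  where
  open ExponentSquares 1 4
  identity₁ : ∀ q → + 10 ℤ.* ℤ.- q ℤ.+ -[1+ 2 ] ≡ ℤ.- (+ 3 ℤ.+ q ℤ.* + 10)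
  identity₁ = ℤSolver.solve-∀
  identity₂ : ∀ q → + 10 ℤ.* (q ℤ.+ + 1) ℤ.+ -[1+ 2 ] ≡ + 7 ℤ.+ q ℤ.* + 10
  identity₂ = ℤSolver.solve-∀
  shape : ∀ p x → x ℤ.* x ≡ + 40 ℤ.* + p ℤ.+ + 9 → (∃ λ q → x ≡ + 3 ℤ.+ q ℤ.* + 10 ⊎ x ≡ + 7 ℤ.+ q ℤ.* + 10) → ∃ (Shape p)
  shape p x e (q , inj₁ h) = ℤ.- q , reflected-square x h (identity₁ q) e
  shape p x e (q , inj₂ h) = q ℤ.+ + 1 , trans (cong (λ y → y ℤ.* y) (trans (identity₂ q) (sym h))) e

instance-2-3 : ThetaInstance 2 3 40 1
instance-2-3 = record
  { shape⇒square = λ p k h → root k , h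
  ; square⇒shape = λ { p (x , e) → shape p x e (square-root 10 4 1 1 9 (from-yes (square-roots? 10 1 1 9)) p x e) } }
  where
  open ExponentSquares 2 3
  identity₁ : ∀ q → + 10 ℤ.* ℤ.- q ℤ.+ -[1+ 0 ] ≡ ℤ.- (+ 1 ℤ.+ q ℤ.* + 10)
  identity₁ = ℤSolver.solve-∀
  identity₂ : ∀ q → + 10 ℤ.* (q ℤ.+ + 1) ℤ.+ -[1+ 0 ] ≡ + 9 ℤ.+ q ℤ.* + 10
  identity₂ = ℤSolver.solve-∀
  shape : ∀ p x → x ℤ.* x ≡ + 40 ℤ.* + p ℤ.+ + 1 → (∃ λ q → x ≡ + 1 ℤ.+ q ℤ.* + 10 ⊎ x ≡ + 9 ℤ.+ q ℤ.* + 10) → ∃ (Shape p)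
  shape p x e (q , inj₁ h) = ℤ.- q , reflected-square x h (identity₁ q) e
  shape p x e (q , inj₂ h) = q ℤ.+ + 1 , trans (cong (λ y → y ℤ.* y) (trans (identity₂ q) (sym h))) e

theta-squares : ∀ {α β a b} N c {{_ : NonZero c}} {{_ : NonZero α}} {{_ : NonZero β}} → α < β →
  ThetaInstance α β a b → SquareSeries N c a b (Jacobi.theta N c α β)
theta-squares {α} {β} {a} {b} N c α<β I = record
  { square = λ n _ h → square n (theta-true n h)
  ; occurs = λ p l s → let k , h = square⇒shape p s in true-theta p k l h }
  where
  open ThetaInstance I
  open ThetaCoefficients N c α β α<β
  square : ∀ n → (∃ λ p → n ≡ c * p × ∃ (ExponentSquares.Shape α β p)) → ∃ λ p → n ≡ c * p × Square a b p
  square n (p , e , k , h) = p , e , shape⇒square p k h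

-- Partitions

odd : ℕ → Bool
odd zero = false
odd (suc n) = not (odd n)

odd-+ : ∀ m n → odd (m + n) ≡ odd m xor odd n
odd-+ zero n = refl
odd-+ (suc m) n = trans (cong not (odd-+ m n)) (Bool.not-distribˡ-xor (odd m) (odd n))

odd≡false⇒even : ∀ n → odd n ≡ false → n % 2 ≡ 0
odd≡false⇒even zero _ = refl
odd≡false⇒even (suc (suc n)) h = odd≡false⇒even n (trans (sym (Bool.not-involutive (odd n))) h)

-- A multiplicity above n never fits, as the part is at least 1.
sumMult-beyond : ∀ k n f d → sumMult (suc k) n f (d + n) ≡ sumMult (suc k) n f n
sumMult-beyond k n f zero = refl
sumMult-beyond k n f (suc d) with suc (d + n) * suc k ≤? n
... | yes l = contradiction (ℕ.≤-trans (ℕ.≤-trans (s≤s (ℕ.m≤n+m n d)) (ℕ.m≤m*n _ (suc k))) l) (ℕ.n≮n n)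
... | no _ = sumMult-beyond k n f d

sumMult-small : ∀ k n f j → n < k → sumMult k n f j ≡ f n
sumMult-small k n f zero l = refl
sumMult-small k n f (suc j) l with suc j * k ≤? n
... | yes h = contradiction (ℕ.≤-trans (ℕ.m≤m+n k (j * k)) h) (ℕ.<⇒≱ l)
... | no _ = sumMult-small k n f j l

-- Removing one copy of the part k matches multiplicity j + 1 at k + n with multiplicity j at n;
-- multiplicity 0 is left over.
sumMult-step : ∀ k n f j → sumMult k (k + n) f (suc j) ≡ f (k + n) + sumMult k n f j
sumMult-step k n f zero with suc 0 * k ≤? k + n
... | yes _ = trans (ℕ.+-comm _ (f (k + n))) (cong (λ z → f (k + n) + f z) (trans (cong (k + n ∸_) (ℕ.+-identityʳ k)) (ℕ.m+n∸m≡n k n)))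
... | no h = contradiction (ℕ.≤-trans (ℕ.≤-reflexive (ℕ.+-identityʳ k)) (ℕ.m≤m+n k n)) h
sumMult-step k n f (suc j) with suc (suc j) * k ≤? k + n | suc j * k ≤? n
... | yes _ | yes _ = trans (cong₂ _+_ (cong f (ℕ.[m+n]∸[m+o]≡n∸o k n (suc j * k))) (sumMult-step k n f j))
  (trans (sym (ℕ.+-assoc a b c)) (trans (cong (_+ c) (ℕ.+-comm a b)) (ℕ.+-assoc b a c)))
  where
  a = f (n ∸ suc j * k)
  b = f (k + n)
  c = sumMult k n f j
... | yes h | no h′ = contradiction (ℕ.+-cancelˡ-≤ k _ _ h) h′
... | no h | yes h′ = contradiction (ℕ.+-monoʳ-≤ k h′) h
... | no _ | no _ = sumMult-step k n f j

ways-skip : ∀ k n → 40 ℕ.∣ suc k → ways (suc k) n ≡ ways k n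
ways-skip k n d with 40 ℕ.∣? suc k
... | yes _ = refl
... | no h = contradiction d h

ways-small : ∀ k n → n < suc k → ways (suc k) n ≡ ways k n
ways-small k n l with 40 ℕ.∣? suc k
... | yes _ = refl
... | no h = sumMult-small (suc k) n (ways k) n l

ways-step : ∀ k n → ¬ 40 ℕ.∣ suc k → ways (suc k) (suc k + n) ≡ ways k (suc k + n) + ways (suc k) n
ways-step k n h with 40 ℕ.∣? suc k
... | yes d = contradiction d h
... | no _ = trans (sumMult-step (suc k) n (ways k) (k + n)) (cong (λ z → ways k (suc k + n) + z) (sumMult-beyond k n (ways k) k))

ways-large : ∀ d n → ways (d + n) n ≡ b₄₀ n
ways-large zero n = refl
ways-large (suc d) n = trans (ways-small (d + n) n (s≤s (ℕ.m≤n+m n d))) (ways-large d n)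

W : ℕ → Series
W k n = odd (ways k n)

q^-⊛-small : ∀ e f n → n < e → (q^ e ⊛ f) n ≡ false
q^-⊛-small (suc e) f zero l = refl
q^-⊛-small (suc e) f (suc n) (s≤s l) = q^-⊛-small e f n l

q^-⊛-+ : ∀ e f n → (q^ e ⊛ f) (e + n) ≡ f n
q^-⊛-+ zero f n = ⊛-identityˡ f n
q^-⊛-+ (suc e) f n = q^-⊛-+ e f n

W-step : ∀ k → ¬ 40 ℕ.∣ suc k → ∀ n → W k n ≡ (W (suc k) ⊕ q^ (suc k) ⊛ W (suc k)) n
W-step k h n = trans (by-size (n <? suc k)) (sym (⊕-coeff _ _ n))
  where
  large : ∀ a b c → c ≡ a xor b → a ≡ c xor b
  large true true false refl = refl
  large true false true refl = refl
  large false true true refl = refl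
  large false false false refl = refl
  by-size : Dec (n < suc k) → W k n ≡ W (suc k) n xor (q^ (suc k) ⊛ W (suc k)) n
  by-size (yes l) = sym (trans (cong₂ _xor_ (cong odd (ways-small k n l)) (q^-⊛-small (suc k) (W (suc k)) n l)) (𝔽₂.+-identityʳ _))
  by-size (no l) = subst (λ z → W k z ≡ W (suc k) z xor (q^ (suc k) ⊛ W (suc k)) z) (ℕ.m+[n∸m]≡n (ℕ.≮⇒≥ l))
    (trans (large (W k (suc k + m)) (W (suc k) m) (W (suc k) (suc k + m)) (trans (cong odd (ways-step k m h)) (odd-+ (ways k (suc k + m)) (ways (suc k) m))))
           (cong (W (suc k) (suc k + m) xor_) (sym (q^-⊛-+ (suc k) (W (suc k)) m))))
    where m = n ∸ suc k

module Partitions (N : ℕ) where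
  open Truncated N
  open Products N

  -- What remains of the factor for the part i + 1 after multiplication by the partition series: an
  -- allowed part cancels its factor, a multiple of 40 leaves it standing.
  missing-factor : ℕ → Series
  missing-factor i = if does (40 ℕ.∣? suc i) then 𝟏 ⊕ q^ (suc i) else 𝟏

  missing-factor-multiple : ∀ {i} → 40 ℕ.∣ suc i → missing-factor i ≈ 𝟏 ⊕ q^ (suc i)
  missing-factor-multiple {i} d rewrite dec-true (40 ℕ.∣? suc i) d = ≈-refl

  missing-factor-other : ∀ {i} → ¬ 40 ℕ.∣ suc i → missing-factor i ≈ 𝟏
  missing-factor-other {i} h rewrite dec-false (40 ℕ.∣? suc i) h = ≈-refl

  W-product : ∀ k → W k ⊛ ∏ suc k ≈ ⨀ missing-factor k
  W-product zero = exact λ n → trans (⊛-comm (W 0) 𝟏 n) (trans (⊛-identityˡ (W 0) n) (W-zero n))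
    where
    W-zero : ∀ n → W 0 n ≡ 𝟏 n
    W-zero zero = refl
    W-zero (suc n) = refl
  W-product (suc k) = by-cases (40 ℕ.∣? suc k)
    where
    open ≈-Reasoning
    by-cases : Dec (40 ℕ.∣ suc k) → W (suc k) ⊛ ∏ suc (suc k) ≈ ⨀ missing-factor (suc k)
    by-cases (yes d) = begin
      W (suc k) ⊛ (∏ suc k ⊛ (𝟏 ⊕ q^ (suc k)))   ≈⟨ ⊛-cong (exact λ n → cong odd (ways-skip k n d)) ≈-refl ⟩
      W k ⊛ (∏ suc k ⊛ (𝟏 ⊕ q^ (suc k)))         ≈⟨ R.*-assoc (W k) (∏ suc k) _ ⟨
      W k ⊛ ∏ suc k ⊛ (𝟏 ⊕ q^ (suc k))           ≈⟨ ⊛-cong (W-product k) (≈-sym (missing-factor-multiple d)) ⟩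
      ⨀ missing-factor k ⊛ missing-factor k      ∎
    by-cases (no h) = begin
      W (suc k) ⊛ (∏ suc k ⊛ (𝟏 ⊕ q^ (suc k)))
        ≈⟨ solve 3 (λ w p x → w :* (p :* (con true :+ x)) := (w :+ x :* w) :* p) ≈-refl (W (suc k)) (∏ suc k) (q^ (suc k)) ⟩
      (W (suc k) ⊕ q^ (suc k) ⊛ W (suc k)) ⊛ ∏ suc k
        ≈⟨ ⊛-cong (exact (W-step k h)) ≈-refl ⟨
      W k ⊛ ∏ suc k                              ≈⟨ W-product k ⟩
      ⨀ missing-factor k                         ≈⟨ R.*-identityʳ _ ⟨
      ⨀ missing-factor k ⊛ 𝟏                     ≈⟨ ⊛-cong ≈-refl (missing-factor-other h) ⟨
      ⨀ missing-factor k ⊛ missing-factor k      ∎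

  ⨀-one : ∀ {f} n → (∀ i → i < n → f i ≈ 𝟏) → ⨀ f n ≈ 𝟏
  ⨀-one zero h = ≈-refl
  ⨀-one (suc n) h = ≈-trans (⊛-cong (⨀-one n λ i l → h i (ℕ.m≤n⇒m≤1+n l)) (h n ℕ.≤-refl)) (R.*-identityˡ 𝟏)

  missing-product : ∀ n → ⨀ missing-factor (40 * n) ≈ ∏ (λ i → 40 * suc i) n
  missing-product n = begin
    ⨀ missing-factor (40 * n)                                     ≈⟨ ⨀-residues missing-factor 40 n ⟩
    ⨀ row 39 ⊛ row 39                                             ≈⟨ ⊛-cong (⨀-one {row} 39 λ t l → ⨀-one n λ i _ → not-multiple i t l) ≈-refl ⟩
    𝟏 ⊛ row 39                                                    ≈⟨ R.*-identityˡ _ ⟩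
    row 39                                                        ≈⟨ ⨀-cong n multiple ⟩
    ∏ (λ i → 40 * suc i) n                                        ∎
    where
    open ≈-Reasoning
    row : ℕ → Series
    row t = ⨀ (λ i → missing-factor (40 * i + t)) n
    not-multiple : ∀ i t → t < 39 → missing-factor (40 * i + t) ≈ 𝟏
    not-multiple i t l = missing-factor-other λ d → ℕ.<⇒≱ (s≤s l)
      (ℕ.∣⇒≤ (ℕ.∣m+n∣m⇒∣n (subst (40 ℕ.∣_) (sym (ℕ.+-suc (40 * i) t)) d) (ℕ.m∣m*n i)))
    next : ∀ i → suc (40 * i + 39) ≡ 40 * suc i
    next i = trans (sym (ℕ.+-suc (40 * i) 39)) (trans (ℕ.+-comm (40 * i) 40) (sym (ℕ.*-suc 40 i)))
    multiple : ∀ i → missing-factor (40 * i + 39) ≈ 𝟏 ⊕ q^ (40 * suc i)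
    multiple i = ≈-trans (missing-factor-multiple (subst (40 ℕ.∣_) (sym (next i)) (ℕ.m∣m*n (suc i))))
      (exact λ k → cong (λ z → (𝟏 ⊕ q^ z) k) (next i))

  euler : ℕ → Series
  euler c = ∏ (λ i → c * suc i) N

  -- Parts up to 40 N leave exactly N missing factors, the same number as in `euler 40`.
  B : Series
  B = W (40 * N)

  B-coeff : ∀ n → n < N → B n ≡ odd (b₄₀ n)
  B-coeff n l = cong odd (trans (cong (λ z → ways z n) (sym (ℕ.m∸n+n≡m (ℕ.≤-trans (ℕ.<⇒≤ l) (ℕ.m≤n*m N 40))))) (ways-large (40 * N ∸ n) n))

  B-product : B ⊛ euler 1 ≈ euler 40
  B-product = begin
    B ⊛ euler 1                         ≈⟨ ⊛-cong ≈-refl (∏-cong N λ i → ℕ.*-identityˡ (suc i)) ⟩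
    B ⊛ ∏ suc N                         ≈⟨ ⊛-cong ≈-refl (∏-stable ℕ.n≤1+n (ℕ.m≤n*m N 40)) ⟨
    B ⊛ ∏ suc (40 * N)                  ≈⟨ W-product (40 * N) ⟩
    ⨀ missing-factor (40 * N)           ≈⟨ missing-product N ⟩
    euler 40                            ∎
    where open ≈-Reasoning

-- Product identities

⊛-lowest : ∀ d h n → (∀ i → i < n → d i ≡ false) → (d ⊛ h) n ≡ d n ∧ h 0
⊛-lowest d h zero _ = refl
⊛-lowest d h (suc n) z = trans (cong (λ b → (b ∧ h (suc n)) xor ((d ∘ suc) ⊛ h) n) (z 0 (s≤s z≤n)))
  (⊛-lowest (d ∘ suc) h n λ i l → z (suc i) (s≤s l))

module Identities (N : ℕ) where
  open Truncated N
  open Products N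
  open Partitions N

  -- The lowest nonzero coefficient of f would reappear in f ⊛ h, because h has constant term 1.
  ⊛-cancel-zero : ∀ {f h} → h 0 ≡ true → f ⊛ h ≈ 𝟎 → f ≈ 𝟎
  ⊛-cancel-zero {f} {h} h₀ e = mod λ n l → below (suc n) l n ℕ.≤-refl
    where
    below : ∀ n → n ≤ N → ∀ i → i < n → f i ≡ false
    below (suc n) l i i<1+n with ℕ.m<1+n⇒m<n∨m≡n i<1+n
    ... | inj₁ i<n = below n (ℕ.<⇒≤ l) i i<n
    ... | inj₂ refl = begin
      f n          ≡⟨ Bool.∧-identityʳ (f n) ⟨
      f n ∧ true   ≡⟨ cong (f n ∧_) h₀ ⟨
      f n ∧ h 0    ≡⟨ ⊛-lowest f h n (below n (ℕ.<⇒≤ l)) ⟨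
      (f ⊛ h) n    ≡⟨ coeff e n l ⟩
      false        ∎
      where open ≡-Reasoning

  ⊛-cancel : ∀ {f g h} → h 0 ≡ true → f ⊛ h ≈ g ⊛ h → f ≈ g
  ⊛-cancel {f} {g} {h} h₀ e = ≈-trans (⊕-transpose difference) (R.+-identityˡ g)
    where
    difference : f ⊕ g ≈ 𝟎
    difference = ⊛-cancel-zero h₀ (≈-trans (R.distribʳ h f g) (≈-trans (⊕-cong e ≈-refl) (⊕-self (g ⊛ h))))

  ∏-constant-term : ∀ e n → (∀ i → 0 < e i) → ∏ e n 0 ≡ true
  ∏-constant-term e zero _ = refl
  ∏-constant-term e (suc n) pos = cong₂ _∧_ (∏-constant-term e n pos)
    (trans (⊕-coeff 𝟏 (q^ (e n)) 0) (cong (true xor_) (q^-small (e n) 0 (pos n))))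

  module _ (c : ℕ) {{_ : NonZero c}} where

    euler-constant-term : euler c 0 ≡ true
    euler-constant-term = ∏-constant-term _ N λ i → ℕ.≤-trans (s≤s z≤n) (ℕ.m≤n*m (suc i) c)

    euler-residues : ∀ d {{_ : NonZero d}} → euler c ≈ ⨀ (λ t → ∏ (λ i → c * suc (d * i + t)) N) d
    euler-residues d = ≈-trans (≈-sym (∏-stable (λ i → ℕ.≤-trans (ℕ.n≤1+n i) (ℕ.m≤n*m (suc i) c)) (ℕ.m≤n*m N d)))
      (⨀-residues _ d N)

    euler-square : euler c ⊛ euler c ≈ euler (2 * c)
    euler-square = ≈-trans (∏-square (λ i → c * suc i) N) (∏-cong N λ i → sym (ℕ.*-assoc 2 c (suc i)))

    -- Euler's pentagonal number theorem: for r = 3 the three products of the triple product run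
    -- through all residue classes modulo 3.
    pentagonal : euler c ≈ Jacobi.theta N c 1 2
    pentagonal = begin
      euler c              ≈⟨ euler-residues 3 ⟩
      𝟏 ⊛ a 0 ⊛ a 1 ⊛ a 2  ≈⟨ ⊛-cong (⊛-cong (≈-trans (R.*-identityˡ _) (∏-cong N λ i → cong (c *_) (identity₀ i)))
                                (∏-cong N λ i → cong (c *_) (identity₁ i))) (∏-cong N λ i → cong (c *_) (identity₂ i)) ⟩
      ∏ (λ i → c * (1 + 3 * i)) N ⊛ ∏ (λ i → c * (2 + 3 * i)) N ⊛ ∏ (λ i → c * (3 * suc i)) N
                           ≈⟨ Jacobi.jacobi N c 1 2 ⟩
      Jacobi.theta N c 1 2 ∎
      where
      open ≈-Reasoning
      a : ℕ → Series
      a t = ∏ (λ i → c * suc (3 * i + t)) N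
      identity₀ : ∀ i → suc (3 * i + 0) ≡ 1 + 3 * i
      identity₀ = ℕSolver.solve-∀
      identity₁ : ∀ i → suc (3 * i + 1) ≡ 2 + 3 * i
      identity₁ = ℕSolver.solve-∀
      identity₂ : ∀ i → suc (3 * i + 2) ≡ 3 * suc i
      identity₂ = ℕSolver.solve-∀

  -- After multiplication by f_c² the left side is f_c f_(4c). Split f_c by classes modulo 4: the
  -- classes 1, 3 and 0 form a triple product, and class 2 together with f_(4c), a second copy of
  -- class 0, gives f_(2c) = f_c².
  euler-cube : ∀ c {{_ : NonZero c}} → euler c ⊛ euler c ⊛ euler c ≈ Jacobi.theta N c 1 3
  euler-cube c@(suc _) = ⊛-cancel {h = euler c} (euler-constant-term c) (⊛-cancel {h = euler c} (euler-constant-term c) (begin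
    f ⊛ f ⊛ f ⊛ f ⊛ f                  ≈⟨ solve 1 (λ f → f :* f :* f :* f :* f := f :* ((f :* f) :* (f :* f))) ≈-refl f ⟩
    f ⊛ ((f ⊛ f) ⊛ (f ⊛ f))            ≈⟨ ⊛-cong (euler-residues c 4) (≈-trans (⊛-cong (euler-square c) (euler-square c)) (euler-square (2 * c))) ⟩
    𝟏 ⊛ a 0 ⊛ a 1 ⊛ a 2 ⊛ a 3 ⊛ euler (2 * (2 * c))
      ≈⟨ ⊛-cong ≈-refl (∏-cong N λ i → identity₃ c i) ⟩
    𝟏 ⊛ a 0 ⊛ a 1 ⊛ a 2 ⊛ a 3 ⊛ a 3
      ≈⟨ solve 4 (λ x y z w → con true :* x :* y :* z :* w :* w := (x :* z :* w) :* (y :* w)) ≈-refl (a 0) (a 1) (a 2) (a 3) ⟩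
    (a 0 ⊛ a 2 ⊛ a 3) ⊛ (a 1 ⊛ a 3)    ≈⟨ ⊛-cong theta-product (⊛-cong (∏-cong N λ i → identity₁ c i) (∏-cong N λ i → identity₂ c i)) ⟩
    ψ ⊛ (b 0 ⊛ b 1)                    ≈⟨ ⊛-cong ≈-refl (≈-trans (euler-residues (2 * c) 2) (⊛-cong (R.*-identityˡ (b 0)) ≈-refl)) ⟨
    ψ ⊛ euler (2 * c)                  ≈⟨ ⊛-cong ≈-refl (euler-square c) ⟨
    ψ ⊛ (f ⊛ f)                        ≈⟨ R.*-assoc ψ f f ⟨
    ψ ⊛ f ⊛ f                          ∎))
    where
    open ≈-Reasoning
    f = euler c
    ψ = Jacobi.theta N c 1 3
    a b : ℕ → Series
    a t = ∏ (λ i → c * suc (4 * i + t)) N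
    b t = ∏ (λ i → 2 * c * suc (2 * i + t)) N
    identity₁ : ∀ c i → c * suc (4 * i + 1) ≡ 2 * c * suc (2 * i + 0)
    identity₁ = ℕSolver.solve-∀
    identity₂ : ∀ c i → c * suc (4 * i + 3) ≡ 2 * c * suc (2 * i + 1)
    identity₂ = ℕSolver.solve-∀
    identity₃ : ∀ c i → 2 * (2 * c) * suc i ≡ c * suc (4 * i + 3)
    identity₃ = ℕSolver.solve-∀
    identity₄ : ∀ i → suc (4 * i + 0) ≡ 1 + 4 * i
    identity₄ = ℕSolver.solve-∀
    identity₅ : ∀ i → suc (4 * i + 2) ≡ 3 + 4 * i
    identity₅ = ℕSolver.solve-∀
    identity₆ : ∀ i → suc (4 * i + 3) ≡ 4 * suc i
    identity₆ = ℕSolver.solve-∀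
    theta-product : a 0 ⊛ a 2 ⊛ a 3 ≈ ψ
    theta-product = ≈-trans
      (⊛-cong (⊛-cong (∏-cong N λ i → cong (c *_) (identity₄ i)) (∏-cong N λ i → cong (c *_) (identity₅ i))) (∏-cong N λ i → cong (c *_) (identity₆ i)))
      (Jacobi.jacobi N c 1 3)

  -- The factor f_5 doubles the class 0 modulo 5 of f_1, so that the classes 1, 4, 0 and the classes
  -- 2, 3, 0 each form a triple product.
  euler-level-5 : euler 1 ⊛ euler 5 ≈ Jacobi.theta N 1 1 4 ⊛ Jacobi.theta N 1 2 3
  euler-level-5 = begin
    euler 1 ⊛ euler 5                     ≈⟨ ⊛-cong (euler-residues 1 5) (∏-cong N λ i → identity₅ i) ⟩
    𝟏 ⊛ a 0 ⊛ a 1 ⊛ a 2 ⊛ a 3 ⊛ a 4 ⊛ a 4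
      ≈⟨ solve 5 (λ x y z w v → con true :* x :* y :* z :* w :* v :* v := (x :* w :* v) :* (y :* z :* v)) ≈-refl (a 0) (a 1) (a 2) (a 3) (a 4) ⟩
    (a 0 ⊛ a 3 ⊛ a 4) ⊛ (a 1 ⊛ a 2 ⊛ a 4) ≈⟨ ⊛-cong
      (≈-trans (⊛-cong (⊛-cong (∏-cong N identity₀) (∏-cong N identity₃)) (∏-cong N identity₄)) (Jacobi.jacobi N 1 1 4))
      (≈-trans (⊛-cong (⊛-cong (∏-cong N identity₁) (∏-cong N identity₂)) (∏-cong N identity₄)) (Jacobi.jacobi N 1 2 3)) ⟩
    Jacobi.theta N 1 1 4 ⊛ Jacobi.theta N 1 2 3 ∎
    where
    open ≈-Reasoning
    a : ℕ → Series
    a t = ∏ (λ i → 1 * suc (5 * i + t)) N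
    identity₀ : ∀ i → 1 * suc (5 * i + 0) ≡ 1 * (1 + 5 * i)
    identity₀ = ℕSolver.solve-∀
    identity₁ : ∀ i → 1 * suc (5 * i + 1) ≡ 1 * (2 + 5 * i)
    identity₁ = ℕSolver.solve-∀
    identity₂ : ∀ i → 1 * suc (5 * i + 2) ≡ 1 * (3 + 5 * i)
    identity₂ = ℕSolver.solve-∀
    identity₃ : ∀ i → 1 * suc (5 * i + 3) ≡ 1 * (4 + 5 * i)
    identity₃ = ℕSolver.solve-∀
    identity₄ : ∀ i → 1 * suc (5 * i + 4) ≡ 1 * (5 * suc i)
    identity₄ = ℕSolver.solve-∀
    identity₅ : ∀ i → 5 * suc i ≡ 1 * suc (5 * i + 4)
    identity₅ = ℕSolver.solve-∀

-- Parity of finite sums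

sum : (ℕ → Bool) → ℕ → Bool
sum p zero = false
sum p (suc n) = sum p n xor p n

sum-cong : ∀ {p p′} n → (∀ i → i < n → p i ≡ p′ i) → sum p n ≡ sum p′ n
sum-cong zero h = refl
sum-cong (suc n) h = cong₂ _xor_ (sum-cong n λ i l → h i (ℕ.m≤n⇒m≤1+n l)) (h n ℕ.≤-refl)

sum-zero : ∀ n → sum (λ _ → false) n ≡ false
sum-zero zero = refl
sum-zero (suc n) = trans (𝔽₂.+-identityʳ _) (sum-zero n)

sum-none : ∀ p n → (∀ i → i < n → p i ≡ false) → sum p n ≡ false
sum-none p n h = trans (sum-cong n h) (sum-zero n)

sum-xor : ∀ p p′ n → sum (λ i → p i xor p′ i) n ≡ sum p n xor sum p′ n
sum-xor p p′ zero = refl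
sum-xor p p′ (suc n) = trans (cong (_xor (p n xor p′ n)) (sum-xor p p′ n)) (xor-interchange (sum p n) (sum p′ n) (p n) (p′ n))

sum-single : ∀ p n i → i < n → (∀ j → j < n → j ≢ i → p j ≡ false) → sum p n ≡ p i
sum-single p (suc n) i l h with ℕ.m<1+n⇒m<n∨m≡n l
... | inj₂ refl = cong (_xor p i) (sum-none p n λ j k → h j (ℕ.m≤n⇒m≤1+n k) (ℕ.<⇒≢ k))
... | inj₁ k = trans (cong₂ _xor_ (sum-single p n i k λ j m → h j (ℕ.m≤n⇒m≤1+n m)) (h n ℕ.≤-refl (ℕ.<⇒≢ k ∘ sym))) (𝔽₂.+-identityʳ (p i))

sum-swap : ∀ (M : ℕ → ℕ → Bool) m n → sum (λ i → sum (M i) n) m ≡ sum (λ j → sum (λ i → M i j) m) n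
sum-swap M zero n = sym (sum-zero n)
sum-swap M (suc m) n = trans (cong (_xor sum (M m) n) (sum-swap M m n)) (sym (sum-xor _ (M m) n))

-- Entries off the diagonal cancel in pairs.
sum-symmetric : ∀ (M : ℕ → ℕ → Bool) → (∀ i j → M i j ≡ M j i) → ∀ n → sum (λ i → sum (M i) n) n ≡ sum (λ i → M i i) n
sum-symmetric M h zero = refl
sum-symmetric M h (suc n) = begin
  sum (λ i → sum (M i) n xor M i n) n xor (sum (M n) n xor M n n)
    ≡⟨ cong (_xor (sum (M n) n xor M n n)) (sum-xor (λ i → sum (M i) n) (λ i → M i n) n) ⟩
  (sum (λ i → sum (M i) n) n xor sum (λ i → M i n) n) xor (sum (M n) n xor M n n)
    ≡⟨ cong₂ (λ a b → (a xor b) xor (sum (M n) n xor M n n)) (sum-symmetric M h n) (sum-cong n λ i _ → h i n) ⟩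
  (sum (λ i → M i i) n xor sum (M n) n) xor (sum (M n) n xor M n n)
    ≡⟨ 𝔽₂.+-assoc (sum (λ i → M i i) n) _ _ ⟩
  sum (λ i → M i i) n xor (sum (M n) n xor (sum (M n) n xor M n n))
    ≡⟨ cong (sum (λ i → M i i) n xor_) (xor-self (sum (M n) n) (M n n)) ⟩
  sum (λ i → M i i) n xor M n n ∎
  where open ≡-Reasoning

sum-front : ∀ p n → sum p (suc n) ≡ p 0 xor sum (p ∘ suc) n
sum-front p zero = 𝔽₂.+-comm false (p 0)
sum-front p (suc n) = trans (cong (_xor p (suc n)) (sum-front p n)) (𝔽₂.+-assoc (p 0) _ _)

⊛-sum : ∀ f g n → (f ⊛ g) n ≡ sum (λ i → f i ∧ g (n ∸ i)) (suc n)
⊛-sum f g zero = refl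
⊛-sum f g (suc n) = trans (cong ((f 0 ∧ g (suc n)) xor_) (⊛-sum (f ∘ suc) g n)) (sym (sum-front (λ i → f i ∧ g (suc n ∸ i)) (suc n)))

bool-ext : ∀ {a b : Bool} → (a ≡ true → b ≡ true) → (b ≡ true → a ≡ true) → a ≡ b
bool-ext {true} f g = sym (f refl)
bool-ext {false} {true} f g = g refl
bool-ext {false} {false} f g = refl

-- The graph of a map defined where p holds. As a relation it may be described by the existence of
-- integer roots, so no choice of signs has to be turned into a function; `functional` says that the
-- choice does not affect the image.
record Graph (n : ℕ) (p : ℕ → Bool) (_~_ : ℕ → ℕ → Set) : Set where
  field
    valid      : ∀ {i j} → i ~ j → i < n × j < n × p i ≡ true
    image      : ∀ {i} → i < n → p i ≡ true → ∃ (i ~_)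
    functional : ∀ {i j k} → i ~ j → i ~ k → j ≡ k

  -- The only candidate for j is the image supplied for i.
  decide : ∀ i j → Dec (i ~ j)
  decide i j with i <? n
  ... | no i≮n = no λ r → i≮n (proj₁ (valid r))
  ... | yes i<n with p i in eq
  ...   | false = no λ r → contradiction (trans (sym eq) (proj₂ (proj₂ (valid r)))) λ ()
  ...   | true with image i<n eq
  ...     | k , r with j ≟ k
  ...       | yes refl = yes r
  ...       | no j≢k = no λ r′ → j≢k (functional r′ r)

  matrix : ℕ → ℕ → Bool
  matrix i j = does (decide i j)

  matrix⇒~ : ∀ {i j} → matrix i j ≡ true → i ~ j
  matrix⇒~ {i} {j} h with decide i j
  ... | yes r = r

  ~⇒matrix : ∀ {i j} → i ~ j → matrix i j ≡ true
  ~⇒matrix {i} {j} = dec-true (decide i j)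

  row : ∀ i → i < n → p i ≡ sum (matrix i) n
  row i i<n with p i in eq
  ... | false = sym (sum-none (matrix i) n λ j _ → dec-false (decide i j) λ r → contradiction (trans (sym eq) (proj₂ (proj₂ (valid r)))) λ ())
  ... | true with image i<n eq
  ...   | k , r = sym (trans
    (sum-single (matrix i) n k (proj₁ (proj₂ (valid r))) λ j _ j≢k → dec-false (decide i j) λ r′ → j≢k (functional r′ r))
    (~⇒matrix r))

  sum-rows : sum p n ≡ sum (λ i → sum (matrix i) n) n
  sum-rows = sum-cong n row

  column-one : ∀ {i j} → i ~ j → (∀ {k} → k ~ j → k ≡ i) → sum (λ k → matrix k j) n ≡ true
  column-one {i} {j} r injective = trans
    (sum-single _ n i (proj₁ (valid r)) λ k _ k≢i → dec-false (decide k j) (k≢i ∘ injective))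
    (~⇒matrix r)

  column-none : ∀ {j} → (∀ {k} → ¬ k ~ j) → sum (λ k → matrix k j) n ≡ false
  column-none {j} h = sum-none _ n λ k _ → dec-false (decide k j) h

-- The row sums of the matrix of the relation give p, symmetry reduces the total to the trace, and
-- the trace counts the fixed points.
involution-sum : ∀ {n p _~_} → Graph n p _~_ → (∀ {i j} → i ~ j → j ~ i) →
  ∀ δ → (∀ {i} → i ~ i → δ i ≡ true) → (∀ {i} → δ i ≡ true → i ~ i) → sum p n ≡ sum δ n
involution-sum {n} {p} {_~_} G symmetric δ to from = begin
  sum p n                         ≡⟨ sum-rows ⟩
  sum (λ i → sum (matrix i) n) n  ≡⟨ sum-symmetric matrix (λ i j → bool-ext (~⇒matrix ∘ symmetric ∘ matrix⇒~) (~⇒matrix ∘ symmetric ∘ matrix⇒~)) n ⟩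
  sum (λ i → matrix i i) n        ≡⟨ sum-cong n (λ i _ → bool-ext (to ∘ matrix⇒~) (~⇒matrix ∘ from)) ⟩
  sum δ n                         ∎
  where
  open Graph G
  open ≡-Reasoning

-- Double counting: rows of the two matrices give s and d, columns taken together give t.
bijection-sum : ∀ {n s d t _~₁_ _~₂_} → Graph n s _~₁_ → Graph n d _~₂_ →
  (∀ {i j} → i ~₁ j → t j ≡ true) → (∀ {i j} → i ~₂ j → t j ≡ true) →
  (∀ {i k j} → i ~₁ j → k ~₁ j → i ≡ k) → (∀ {i k j} → i ~₂ j → k ~₂ j → i ≡ k) →
  (∀ {i k j} → i ~₁ j → ¬ k ~₂ j) →
  (∀ j → j < n → t j ≡ true → ∃ (_~₁ j) ⊎ ∃ (_~₂ j)) →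
  sum s n xor sum d n ≡ sum t n
bijection-sum {n} {s} {d} {t} {_~₁_} {_~₂_} G₁ G₂ t₁ t₂ injective₁ injective₂ disjoint surjective = begin
  sum s n xor sum d n
    ≡⟨ cong₂ _xor_ (trans G₁.sum-rows (sum-swap G₁.matrix n n)) (trans G₂.sum-rows (sum-swap G₂.matrix n n)) ⟩
  sum (λ j → sum (λ i → G₁.matrix i j) n) n xor sum (λ j → sum (λ i → G₂.matrix i j) n) n
    ≡⟨ sum-xor _ _ n ⟨
  sum (λ j → sum (λ i → G₁.matrix i j) n xor sum (λ i → G₂.matrix i j) n) n
    ≡⟨ sum-cong n column ⟩
  sum t n ∎
  where
  open ≡-Reasoning
  module G₁ = Graph G₁
  module G₂ = Graph G₂
  column : ∀ j → j < n → sum (λ i → G₁.matrix i j) n xor sum (λ i → G₂.matrix i j) n ≡ t j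
  column j j<n with t j in eq
  ... | false = cong₂ _xor_ (G₁.column-none λ r → contradiction (trans (sym eq) (t₁ r)) λ ())
                            (G₂.column-none λ r → contradiction (trans (sym eq) (t₂ r)) λ ())
  ... | true with surjective j j<n eq
  ...   | inj₁ (_ , r) = cong₂ _xor_ (G₁.column-one r λ r′ → injective₁ r′ r) (G₂.column-none (disjoint r))
  ...   | inj₂ (_ , r) = cong₂ _xor_ (G₁.column-none λ r′ → disjoint r′ r) (G₂.column-one r λ r′ → injective₂ r′ r)

-- Solutions of x² + 4 y² = 5 (24 m + 1)

nonmultiple : ∀ d r {_ : True (0 <? r)} {_ : True (r <? d)} {z} → + d ℤ.* z ≢ + r
nonmultiple d r {0<r} {r<d} {z} = no-multiple d r z (toWitness 0<r) (toWitness r<d)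

square-abs : ∀ x → x ℤ.* x ≡ + (∣ x ∣ * ∣ x ∣)
square-abs (+ n) = sym (ℤ.pos-* n n)
square-abs -[1+ n ] = refl

-- For negative J the right side is negative, because b < d.
natural : ∀ d b {_ : True (b <? d)} x J → x ℤ.* x ≡ + d ℤ.* J ℤ.+ + b → ∃ λ j → J ≡ + j
natural d b x (+ j) _ = j , refl
natural d b {b<d} x -[1+ k ] e = contradiction
  (ℕ.≤-trans (ℕ.≤-trans (ℕ.m≤m*n d (suc k)) (ℕ.m≤n+m _ (∣ x ∣ * ∣ x ∣))) (ℕ.≤-reflexive (ℤ.+-injective total)))
  (ℕ.<⇒≱ (toWitness b<d))
  where
  identity : ∀ s d k b → s ℤ.+ d ℤ.* k ℤ.- b ≡ + 1 ℤ.* (s ℤ.- (d ℤ.* ℤ.- k ℤ.+ b))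
  identity = ℤSolver.solve-∀
  total : + (∣ x ∣ * ∣ x ∣ + d * suc k) ≡ + b
  total = trans (cong₂ ℤ._+_ (sym (square-abs x)) (ℤ.pos-* d (suc k))) (linear₁ (+ 1) e (identity (x ℤ.* x) (+ d) (+ suc k) (+ b)))

even-or-odd : ∀ e → ∃ λ q → e ≡ + 2 ℤ.* q ⊎ e ≡ + 1 ℤ.+ + 2 ℤ.* q
even-or-odd e with residue 2 e
... | 0 , q , _ , h = q , inj₁ (trans h (identity q))
  where
  identity : ∀ q → + 0 ℤ.+ q ℤ.* + 2 ≡ + 2 ℤ.* q
  identity = ℤSolver.solve-∀
... | 1 , q , _ , h = q , inj₂ (trans h (cong (λ z → + 1 ℤ.+ z) (ℤ.*-comm q (+ 2))))
... | suc (suc _) , _ , s≤s (s≤s ()) , _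

square-parity : ∀ e → ∃ λ t → e ℤ.* e ≡ e ℤ.+ + 2 ℤ.* t
square-parity e with even-or-odd e
... | q , inj₁ refl = + 2 ℤ.* q ℤ.* q ℤ.- q , identity q
  where
  identity : ∀ q → (+ 2 ℤ.* q) ℤ.* (+ 2 ℤ.* q) ≡ + 2 ℤ.* q ℤ.+ + 2 ℤ.* (+ 2 ℤ.* q ℤ.* q ℤ.- q)
  identity = ℤSolver.solve-∀
... | q , inj₂ refl = + 2 ℤ.* q ℤ.* q ℤ.+ q , identity q
  where
  identity : ∀ q → (+ 1 ℤ.+ + 2 ℤ.* q) ℤ.* (+ 1 ℤ.+ + 2 ℤ.* q) ≡ + 1 ℤ.+ + 2 ℤ.* q ℤ.+ + 2 ℤ.* (+ 2 ℤ.* q ℤ.* q ℤ.+ q)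
  identity = ℤSolver.solve-∀

Odd : ℤ → Set
Odd x = ∃ λ e → x ≡ + 1 ℤ.+ + 2 ℤ.* e

odd-root : ∀ a b {_ : True (square-roots? 2 b 1 1)} {p x} → x ℤ.* x ≡ (+ 2 ℤ.* + a) ℤ.* + p ℤ.+ + b → Odd x
odd-root a b {roots} {p} {x} h with square-root 2 a b 1 1 (toWitness roots) p x h
... | q , inj₁ e = q , trans e (cong (λ z → + 1 ℤ.+ z) (ℤ.*-comm q (+ 2)))
... | q , inj₂ e = q , trans e (cong (λ z → + 1 ℤ.+ z) (ℤ.*-comm q (+ 2)))

five-divides : ∀ x y z → x ℤ.* y ≡ + 5 ℤ.* z → (∃ λ a → x ≡ a ℤ.* + 5) ⊎ (∃ λ b → y ≡ b ℤ.* + 5)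
five-divides x y z e with euclidsLemma ∣ x ∣ ∣ y ∣ (from-yes (prime? 5))
  (subst (5 ℕ.∣_) (ℤ.abs-* x y) (ℤ.∣⇒∣ᵤ {+ 5} (divides z (trans e (ℤ.*-comm (+ 5) z)))))
... | inj₁ d = inj₁ (let divides a h = ℤ.∣ᵤ⇒∣ {+ 5} {x} d in a , h)
... | inj₂ d = inj₂ (let divides a h = ℤ.∣ᵤ⇒∣ {+ 5} {y} d in a , h)

ten-divides : ∀ x a b → x ≡ a ℤ.* + 5 → x ≡ + 2 ℤ.* b → ∃ λ c → x ≡ + 10 ℤ.* c
ten-divides x a b e f = b ℤ.- + 2 ℤ.* a , linear₂ (ℤ.- + 4) (+ 5) e f (identity x a b)
  where
  identity : ∀ x a b → x ℤ.- + 10 ℤ.* (b ℤ.- + 2 ℤ.* a) ≡ ℤ.- + 4 ℤ.* (x ℤ.- a ℤ.* + 5) ℤ.+ + 5 ℤ.* (x ℤ.- + 2 ℤ.* b)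
  identity = ℤSolver.solve-∀

square-cong : ∀ x {y m} → y ≡ x → x ℤ.* x ≡ m → y ℤ.* y ≡ m
square-cong _ refl h = h

cancel-coeff : ∀ a b {{_ : NonZero a}} {i j} → + a ℤ.* + i ℤ.+ + b ≡ + a ℤ.* + j ℤ.+ + b → i ≡ j
cancel-coeff a@(suc _) b {i = i} {j} h = ℤ.+-injective (ℤ.*-cancelˡ-≡ (+ a) (+ i) (+ j) (linear₁ (+ 1) h (identity (+ a ℤ.* + i) (+ a ℤ.* + j) (+ b))))
  where
  identity : ∀ x y b → x ℤ.- y ≡ + 1 ℤ.* (x ℤ.+ b ℤ.- (y ℤ.+ b))
  identity = ℤSolver.solve-∀

-- If x + 2 i y = (1 + 2 i)(s + 2 i t), then y = x + 10 w with t = 2 w, and conjugating s + 2 i t sends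
-- (x , y) to (x + 16 w , x + 6 w).
record Reflection (m i j : ℕ) : Set where
  field
    x w    : ℤ
    i′ j′  : ℕ
    first  : x ℤ.* x ≡ + 24 ℤ.* + i ℤ.+ + 1
    second : (x ℤ.+ + 10 ℤ.* w) ℤ.* (x ℤ.+ + 10 ℤ.* w) ≡ + 24 ℤ.* + i′ ℤ.+ + 1
    third  : (x ℤ.+ + 16 ℤ.* w) ℤ.* (x ℤ.+ + 16 ℤ.* w) ≡ + 24 ℤ.* + j ℤ.+ + 1
    fourth : (x ℤ.+ + 6 ℤ.* w) ℤ.* (x ℤ.+ + 6 ℤ.* w) ≡ + 24 ℤ.* + j′ ℤ.+ + 1
    total  : + i ℤ.+ + 4 ℤ.* + i′ ≡ + 5 ℤ.* + m
    total′ : + j ℤ.+ + 4 ℤ.* + j′ ≡ + 5 ℤ.* + m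

reflection-symmetric : ∀ {m i j} → Reflection m i j → Reflection m j i
reflection-symmetric r = record
  { x = x ℤ.+ + 16 ℤ.* w ; w = ℤ.- w ; i′ = j′ ; j′ = i′
  ; first = third ; second = square-cong (x ℤ.+ + 6 ℤ.* w) (identity₁ x w) fourth
  ; third = square-cong x (identity₂ x w) first ; fourth = square-cong (x ℤ.+ + 10 ℤ.* w) (identity₃ x w) second
  ; total = total′ ; total′ = total }
  where
  open Reflection r
  identity₁ : ∀ x w → x ℤ.+ + 16 ℤ.* w ℤ.+ + 10 ℤ.* ℤ.- w ≡ x ℤ.+ + 6 ℤ.* w
  identity₁ = ℤSolver.solve-∀
  identity₂ : ∀ x w → x ℤ.+ + 16 ℤ.* w ℤ.+ + 16 ℤ.* ℤ.- w ≡ x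
  identity₂ = ℤSolver.solve-∀
  identity₃ : ∀ x w → x ℤ.+ + 16 ℤ.* w ℤ.+ + 6 ℤ.* ℤ.- w ≡ x ℤ.+ + 10 ℤ.* w
  identity₃ = ℤSolver.solve-∀

module _ {m : ℕ} where

  reflection-totals : ∀ {i i′} → + i ℤ.+ + 4 ℤ.* + i′ ≡ + 5 ℤ.* + m → i + 4 * i′ ≡ 5 * m
  reflection-totals {i} {i′} h = ℤ.+-injective (trans (cong (λ z → + i ℤ.+ z) (ℤ.pos-* 4 i′)) (trans h (sym (ℤ.pos-* 5 m))))

  -- The third square exceeds the second by 12 w (x + 13 w), the fourth exceeds the first by 12 w (x
  -- + 3 w). Since x is odd, both cofactors of 12 are even, so the residue 1 modulo 24 is kept; t
  -- records this parity.
  reflection-exists : ∀ {i i′} x w → x ℤ.* x ≡ + 24 ℤ.* + i ℤ.+ + 1 →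
    (x ℤ.+ + 10 ℤ.* w) ℤ.* (x ℤ.+ + 10 ℤ.* w) ≡ + 24 ℤ.* + i′ ℤ.+ + 1 →
    + i ℤ.+ + 4 ℤ.* + i′ ≡ + 5 ℤ.* + m → ∃ (Reflection m i)
  reflection-exists {i} {i′} x w h₁ h₂ h₃ with odd-root 12 1 {p = i} {x} h₁ | square-parity w
  ... | a , refl | t , s = j , record
    { x = x ; w = w ; i′ = i′ ; j′ = j′ ; first = h₁ ; second = h₂
    ; third = third ; fourth = fourth ; total = h₃
    ; total′ = ℤ.*-cancelˡ-≡ (+ 24) _ _ (linear₃ (+ 24) (+ 1) (+ 4) h₃ (sym third) (sym fourth) (linear-total h₁ h₂)) }
    where
    J = + i′ ℤ.+ a ℤ.* w ℤ.+ + 7 ℤ.* w ℤ.+ + 13 ℤ.* t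
    J′ = + i ℤ.+ + 2 ℤ.* w ℤ.+ a ℤ.* w ℤ.+ + 3 ℤ.* t
    identity₁ : ∀ a w t i′ → let x = + 1 ℤ.+ + 2 ℤ.* a in
      (x ℤ.+ + 16 ℤ.* w) ℤ.* (x ℤ.+ + 16 ℤ.* w) ℤ.- (+ 24 ℤ.* (i′ ℤ.+ a ℤ.* w ℤ.+ + 7 ℤ.* w ℤ.+ + 13 ℤ.* t) ℤ.+ + 1)
        ≡ + 1 ℤ.* ((x ℤ.+ + 10 ℤ.* w) ℤ.* (x ℤ.+ + 10 ℤ.* w) ℤ.- (+ 24 ℤ.* i′ ℤ.+ + 1)) ℤ.+ + 156 ℤ.* (w ℤ.* w ℤ.- (w ℤ.+ + 2 ℤ.* t))
    identity₁ = ℤSolver.solve-∀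
    identity₂ : ∀ a w t i → let x = + 1 ℤ.+ + 2 ℤ.* a in
      (x ℤ.+ + 6 ℤ.* w) ℤ.* (x ℤ.+ + 6 ℤ.* w) ℤ.- (+ 24 ℤ.* (i ℤ.+ + 2 ℤ.* w ℤ.+ a ℤ.* w ℤ.+ + 3 ℤ.* t) ℤ.+ + 1)
        ≡ + 1 ℤ.* (x ℤ.* x ℤ.- (+ 24 ℤ.* i ℤ.+ + 1)) ℤ.+ + 36 ℤ.* (w ℤ.* w ℤ.- (w ℤ.+ + 2 ℤ.* t))
    identity₂ = ℤSolver.solve-∀
    third-J : (x ℤ.+ + 16 ℤ.* w) ℤ.* (x ℤ.+ + 16 ℤ.* w) ≡ + 24 ℤ.* J ℤ.+ + 1
    third-J = linear₂ (+ 1) (+ 156) h₂ s (identity₁ a w t (+ i′))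
    fourth-J : (x ℤ.+ + 6 ℤ.* w) ℤ.* (x ℤ.+ + 6 ℤ.* w) ≡ + 24 ℤ.* J′ ℤ.+ + 1
    fourth-J = linear₂ (+ 1) (+ 36) h₁ s (identity₂ a w t (+ i))
    nat₁ = natural 24 1 (x ℤ.+ + 16 ℤ.* w) J third-J
    nat₂ = natural 24 1 (x ℤ.+ + 6 ℤ.* w) J′ fourth-J
    j = proj₁ nat₁
    j′ = proj₁ nat₂
    third = trans third-J (cong (λ z → + 24 ℤ.* z ℤ.+ + 1) (proj₂ nat₁))
    fourth = trans fourth-J (cong (λ z → + 24 ℤ.* z ℤ.+ + 1) (proj₂ nat₂))
    linear-total : x ℤ.* x ≡ + 24 ℤ.* + i ℤ.+ + 1 → (x ℤ.+ + 10 ℤ.* w) ℤ.* (x ℤ.+ + 10 ℤ.* w) ≡ + 24 ℤ.* + i′ ℤ.+ + 1 →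
      + 24 ℤ.* (+ j ℤ.+ + 4 ℤ.* + j′) ℤ.- + 24 ℤ.* (+ 5 ℤ.* + m)
        ≡ + 24 ℤ.* (+ i ℤ.+ + 4 ℤ.* + i′ ℤ.- + 5 ℤ.* + m)
          ℤ.+ + 1 ℤ.* (+ 24 ℤ.* + j ℤ.+ + 1 ℤ.- (x ℤ.+ + 16 ℤ.* w) ℤ.* (x ℤ.+ + 16 ℤ.* w))
          ℤ.+ + 4 ℤ.* (+ 24 ℤ.* + j′ ℤ.+ + 1 ℤ.- (x ℤ.+ + 6 ℤ.* w) ℤ.* (x ℤ.+ + 6 ℤ.* w))
    linear-total h₁ h₂ = linear₂ (+ 1) (+ 4) h₁ h₂ (identity x w (+ i) (+ i′) (+ j) (+ j′) (+ m))
      where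
      identity : ∀ x w i i′ j j′ m →
        + 24 ℤ.* (j ℤ.+ + 4 ℤ.* j′) ℤ.- + 24 ℤ.* (+ 5 ℤ.* m)
          ℤ.- (+ 24 ℤ.* (i ℤ.+ + 4 ℤ.* i′ ℤ.- + 5 ℤ.* m)
          ℤ.+ + 1 ℤ.* (+ 24 ℤ.* j ℤ.+ + 1 ℤ.- (x ℤ.+ + 16 ℤ.* w) ℤ.* (x ℤ.+ + 16 ℤ.* w))
          ℤ.+ + 4 ℤ.* (+ 24 ℤ.* j′ ℤ.+ + 1 ℤ.- (x ℤ.+ + 6 ℤ.* w) ℤ.* (x ℤ.+ + 6 ℤ.* w)))
        ≡ + 1 ℤ.* (x ℤ.* x ℤ.- (+ 24 ℤ.* i ℤ.+ + 1)) ℤ.+ + 4 ℤ.* ((x ℤ.+ + 10 ℤ.* w) ℤ.* (x ℤ.+ + 10 ℤ.* w) ℤ.- (+ 24 ℤ.* i′ ℤ.+ + 1))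
      identity = ℤSolver.solve-∀

  -- From i + 4 i′ = 5 m follows x² ≡ y² modulo 5, so y or - y is congruent to x. Both roots are
  -- odd, so the difference is even as well and hence a multiple 10 w.
  reflection-image : ∀ {i i′} x y → x ℤ.* x ≡ + 24 ℤ.* + i ℤ.+ + 1 → y ℤ.* y ≡ + 24 ℤ.* + i′ ℤ.+ + 1 →
    + i ℤ.+ + 4 ℤ.* + i′ ≡ + 5 ℤ.* + m → ∃ (Reflection m i)
  reflection-image {i} {i′} x y h₁ h₂ h₃ = choose (five-divides (y ℤ.- x) (y ℤ.+ x) (+ 24 ℤ.* (+ i′ ℤ.- + m))
      (linear₃ (+ 1) (ℤ.- + 1) (ℤ.- + 24) h₂ h₁ h₃ (identity₁ x y (+ i) (+ i′) (+ m))))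
    where
    identity₁ : ∀ x y i i′ m → (y ℤ.- x) ℤ.* (y ℤ.+ x) ℤ.- + 5 ℤ.* (+ 24 ℤ.* (i′ ℤ.- m))
        ≡ + 1 ℤ.* (y ℤ.* y ℤ.- (+ 24 ℤ.* i′ ℤ.+ + 1)) ℤ.+ ℤ.- + 1 ℤ.* (x ℤ.* x ℤ.- (+ 24 ℤ.* i ℤ.+ + 1)) ℤ.+ ℤ.- + 24 ℤ.* (i ℤ.+ + 4 ℤ.* i′ ℤ.- + 5 ℤ.* m)
    identity₁ = ℤSolver.solve-∀
    identity₂ : ∀ x y w → x ℤ.+ + 10 ℤ.* w ℤ.- y ≡ ℤ.- + 1 ℤ.* (y ℤ.- x ℤ.- + 10 ℤ.* w)
    identity₂ = ℤSolver.solve-∀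
    identity₃ : ∀ x y w → x ℤ.+ + 10 ℤ.* ℤ.- w ℤ.- ℤ.- y ≡ + 1 ℤ.* (y ℤ.+ x ℤ.- + 10 ℤ.* w)
    identity₃ = ℤSolver.solve-∀
    difference : ∀ x y a b → y ℤ.- x ℤ.- + 2 ℤ.* (b ℤ.- a) ≡ + 1 ℤ.* (y ℤ.- (+ 1 ℤ.+ + 2 ℤ.* b)) ℤ.+ ℤ.- + 1 ℤ.* (x ℤ.- (+ 1 ℤ.+ + 2 ℤ.* a))
    difference = ℤSolver.solve-∀
    sum-of-odd : ∀ x y a b → y ℤ.+ x ℤ.- + 2 ℤ.* (b ℤ.+ a ℤ.+ + 1) ≡ + 1 ℤ.* (y ℤ.- (+ 1 ℤ.+ + 2 ℤ.* b)) ℤ.+ + 1 ℤ.* (x ℤ.- (+ 1 ℤ.+ + 2 ℤ.* a))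
    sum-of-odd = ℤSolver.solve-∀
    x-odd = odd-root 12 1 {p = i} {x} h₁
    y-odd = odd-root 12 1 {p = i′} {y} h₂
    choose : (∃ λ a → y ℤ.- x ≡ a ℤ.* + 5) ⊎ (∃ λ b → y ℤ.+ x ≡ b ℤ.* + 5) → ∃ (Reflection m i)
    choose (inj₁ (a , e)) =
      let w , e′ = ten-divides (y ℤ.- x) a (proj₁ y-odd ℤ.- proj₁ x-odd) e
                     (linear₂ (+ 1) (ℤ.- + 1) (proj₂ y-odd) (proj₂ x-odd) (difference x y (proj₁ x-odd) (proj₁ y-odd)))
      in reflection-exists {i′ = i′} x w h₁ (square-cong y {x ℤ.+ + 10 ℤ.* w} (linear₁ (ℤ.- + 1) e′ (identity₂ x y w)) h₂) h₃
    choose (inj₂ (a , e)) =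
      let w , e′ = ten-divides (y ℤ.+ x) a (proj₁ y-odd ℤ.+ proj₁ x-odd ℤ.+ + 1) e
                     (linear₂ (+ 1) (+ 1) (proj₂ y-odd) (proj₂ x-odd) (sum-of-odd x y (proj₁ x-odd) (proj₁ y-odd)))
      in reflection-exists {i′ = i′} x (ℤ.- w) h₁ (reflected-square {y} {x ℤ.+ + 10 ℤ.* ℤ.- w} y refl (linear₁ (+ 1) e′ (identity₃ x y w)) h₂) h₃

  module _ (5∤24m+1 : ∀ z → + 24 ℤ.* + m ℤ.+ + 1 ≢ + 5 ℤ.* z) where

    -- If 5 ∣ x, then 5 ∣ x + 10 w, and 25 divides x² + 4 y² = 5 (24 m + 1). The form 2 x = 10 v is
    -- what two contradictory sign relations add up to.
    reflection-not-5 : ∀ {i j} (r : Reflection m i j) v → + 2 ℤ.* Reflection.x r ≢ + 10 ℤ.* v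
    reflection-not-5 {i} r v e = 5∤24m+1 (v ℤ.* v ℤ.+ + 4 ℤ.* (y ℤ.* y)) (ℤ.*-cancelˡ-≡ (+ 5) _ _
      (linear₃ (ℤ.- + 1) (ℤ.- + 4) (ℤ.- + 24)
        (trans (sym (cong (λ z → z ℤ.* z) x≡)) first) (trans (sym (cong (λ z → (z ℤ.+ + 10 ℤ.* w) ℤ.* (z ℤ.+ + 10 ℤ.* w)) x≡)) second) total
        (identity v w (+ i) (+ i′) (+ m))))
      where
      open Reflection r
      y = v ℤ.+ + 2 ℤ.* w
      halve : ∀ x v → + 2 ℤ.* x ℤ.- + 2 ℤ.* (+ 5 ℤ.* v) ≡ + 1 ℤ.* (+ 2 ℤ.* x ℤ.- + 10 ℤ.* v)
      halve = ℤSolver.solve-∀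
      x≡ : x ≡ + 5 ℤ.* v
      x≡ = ℤ.*-cancelˡ-≡ (+ 2) _ _ (linear₁ (+ 1) e (halve x v))
      identity : ∀ v w i i′ m → let x = + 5 ℤ.* v ; y = v ℤ.+ + 2 ℤ.* w in
        + 5 ℤ.* (+ 24 ℤ.* m ℤ.+ + 1) ℤ.- + 5 ℤ.* (+ 5 ℤ.* (v ℤ.* v ℤ.+ + 4 ℤ.* (y ℤ.* y)))
          ≡ ℤ.- + 1 ℤ.* (x ℤ.* x ℤ.- (+ 24 ℤ.* i ℤ.+ + 1)) ℤ.+ ℤ.- + 4 ℤ.* ((x ℤ.+ + 10 ℤ.* w) ℤ.* (x ℤ.+ + 10 ℤ.* w) ℤ.- (+ 24 ℤ.* i′ ℤ.+ + 1)) ℤ.+ ℤ.- + 24 ℤ.* (i ℤ.+ + 4 ℤ.* i′ ℤ.- + 5 ℤ.* m)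
      identity = ℤSolver.solve-∀

    -- The index i determines x and y up to sign. A common change of sign only negates x + 16 w;
    -- opposite changes would give both y ≡ x and y ≡ - x modulo 10, hence 5 ∣ x.
    reflection-functional : ∀ {i j k} → Reflection m i j → Reflection m i k → j ≡ k
    reflection-functional {i} {j} {k} r s = choose
      (square≡⇒± R.x S.x (trans R.first (sym S.first)))
      (square≡⇒± (R.x ℤ.+ + 10 ℤ.* R.w) (S.x ℤ.+ + 10 ℤ.* S.w) (trans R.second (trans (cong (λ z → + 24 ℤ.* z ℤ.+ + 1) i′≡) (sym S.second))))
      where
      module R = Reflection r
      module S = Reflection s
      i′≡ : + R.i′ ≡ + S.i′
      i′≡ = ℤ.*-cancelˡ-≡ (+ 4) _ _ (linear₂ (+ 1) (ℤ.- + 1) R.total S.total (identity (+ i) (+ R.i′) (+ S.i′) (+ m)))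
        where
        identity : ∀ i a b m → + 4 ℤ.* a ℤ.- + 4 ℤ.* b ≡ + 1 ℤ.* (i ℤ.+ + 4 ℤ.* a ℤ.- + 5 ℤ.* m) ℤ.+ ℤ.- + 1 ℤ.* (i ℤ.+ + 4 ℤ.* b ℤ.- + 5 ℤ.* m)
        identity = ℤSolver.solve-∀
      identity₁ : ∀ x w x̃ w̃ → + 5 ℤ.* (x ℤ.+ + 16 ℤ.* w) ℤ.- + 5 ℤ.* (x̃ ℤ.+ + 16 ℤ.* w̃) ≡ ℤ.- + 3 ℤ.* (x ℤ.- x̃) ℤ.+ + 8 ℤ.* (x ℤ.+ + 10 ℤ.* w ℤ.- (x̃ ℤ.+ + 10 ℤ.* w̃))
      identity₁ = ℤSolver.solve-∀
      identity₂ : ∀ x w x̃ w̃ → + 5 ℤ.* ℤ.- (x ℤ.+ + 16 ℤ.* w) ℤ.- + 5 ℤ.* (x̃ ℤ.+ + 16 ℤ.* w̃) ≡ + 3 ℤ.* (x ℤ.- ℤ.- x̃) ℤ.+ ℤ.- + 8 ℤ.* (x ℤ.+ + 10 ℤ.* w ℤ.- ℤ.- (x̃ ℤ.+ + 10 ℤ.* w̃))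
      identity₂ = ℤSolver.solve-∀
      identity₃ : ∀ x w x̃ w̃ → + 2 ℤ.* x ℤ.- + 10 ℤ.* (ℤ.- w ℤ.- w̃) ≡ + 1 ℤ.* (x ℤ.- x̃) ℤ.+ + 1 ℤ.* (x ℤ.+ + 10 ℤ.* w ℤ.- ℤ.- (x̃ ℤ.+ + 10 ℤ.* w̃))
      identity₃ = ℤSolver.solve-∀
      identity₄ : ∀ x w x̃ w̃ → + 2 ℤ.* x ℤ.- + 10 ℤ.* (w̃ ℤ.- w) ≡ + 1 ℤ.* (x ℤ.- ℤ.- x̃) ℤ.+ + 1 ℤ.* (x ℤ.+ + 10 ℤ.* w ℤ.- (x̃ ℤ.+ + 10 ℤ.* w̃))
      identity₄ = ℤSolver.solve-∀
      choose : R.x ≡ S.x ⊎ R.x ≡ ℤ.- S.x →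
        R.x ℤ.+ + 10 ℤ.* R.w ≡ S.x ℤ.+ + 10 ℤ.* S.w ⊎ R.x ℤ.+ + 10 ℤ.* R.w ≡ ℤ.- (S.x ℤ.+ + 10 ℤ.* S.w) → j ≡ k
      choose (inj₁ e) (inj₁ f) = cancel-coeff 24 1 (trans (sym R.third) (square-cong (S.x ℤ.+ + 16 ℤ.* S.w) same S.third))
        where
        same : R.x ℤ.+ + 16 ℤ.* R.w ≡ S.x ℤ.+ + 16 ℤ.* S.w
        same = ℤ.*-cancelˡ-≡ (+ 5) _ _ (linear₂ (ℤ.- + 3) (+ 8) e f (identity₁ R.x R.w S.x S.w))
      choose (inj₂ e) (inj₂ f) = cancel-coeff 24 1 (trans (sym (reflected-square {R.x ℤ.+ + 16 ℤ.* R.w} {S.x ℤ.+ + 16 ℤ.* S.w} (R.x ℤ.+ + 16 ℤ.* R.w) refl (sym opposite) R.third)) S.third)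
        where
        opposite : ℤ.- (R.x ℤ.+ + 16 ℤ.* R.w) ≡ S.x ℤ.+ + 16 ℤ.* S.w
        opposite = ℤ.*-cancelˡ-≡ (+ 5) _ _ (linear₂ (+ 3) (ℤ.- + 8) e f (identity₂ R.x R.w S.x S.w))
      choose (inj₁ e) (inj₂ f) = ⊥-elim (reflection-not-5 r (ℤ.- R.w ℤ.- S.w) (linear₂ (+ 1) (+ 1) e f (identity₃ R.x R.w S.x S.w)))
      choose (inj₂ e) (inj₁ f) = ⊥-elim (reflection-not-5 r (S.w ℤ.- R.w) (linear₂ (+ 1) (+ 1) e f (identity₄ R.x R.w S.x S.w)))

    -- x + 16 w = x means w = 0, so x² = y² and i = m. The other sign gives x = - 8 w, but x² is 1
    -- modulo 8.
    reflection-fixed : ∀ {i} → Reflection m i i → i ≡ m × Square 24 1 m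
    reflection-fixed {i} r = choose (square≡⇒± (x ℤ.+ + 16 ℤ.* w) x (trans third (sym first)))
      where
      open Reflection r
      cancel : ∀ x w → + 16 ℤ.* w ℤ.- + 16 ℤ.* + 0 ≡ + 1 ℤ.* (x ℤ.+ + 16 ℤ.* w ℤ.- x)
      cancel = ℤSolver.solve-∀
      unshift : ∀ x w → x ℤ.- (x ℤ.+ + 10 ℤ.* w) ≡ ℤ.- + 10 ℤ.* (w ℤ.- + 0)
      unshift = ℤSolver.solve-∀
      same : ∀ x i i′ m → + 120 ℤ.* i ℤ.- + 120 ℤ.* m
        ≡ + 4 ℤ.* (x ℤ.* x ℤ.- (+ 24 ℤ.* i′ ℤ.+ + 1)) ℤ.+ ℤ.- + 4 ℤ.* (x ℤ.* x ℤ.- (+ 24 ℤ.* i ℤ.+ + 1)) ℤ.+ + 24 ℤ.* (i ℤ.+ + 4 ℤ.* i′ ℤ.- + 5 ℤ.* m)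
      same = ℤSolver.solve-∀
      halve : ∀ x w → + 2 ℤ.* x ℤ.- + 2 ℤ.* (ℤ.- + 8 ℤ.* w) ≡ + 1 ℤ.* (x ℤ.+ + 16 ℤ.* w ℤ.- ℤ.- x)
      halve = ℤSolver.solve-∀
      eight : ∀ w i → + 8 ℤ.* (+ 8 ℤ.* (w ℤ.* w) ℤ.- + 3 ℤ.* i) ℤ.- + 1 ≡ + 1 ℤ.* ((ℤ.- + 8 ℤ.* w) ℤ.* (ℤ.- + 8 ℤ.* w) ℤ.- (+ 24 ℤ.* i ℤ.+ + 1))
      eight = ℤSolver.solve-∀
      index : w ≡ + 0 → i ≡ m
      index w≡0 = ℤ.+-injective (ℤ.*-cancelˡ-≡ (+ 120) _ _ (linear₃ (+ 4) (ℤ.- + 4) (+ 24)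
        (square-cong (x ℤ.+ + 10 ℤ.* w) {x} (linear₁ (ℤ.- + 10) w≡0 (unshift x w)) second) first total (same x (+ i) (+ i′) (+ m))))
      choose : x ℤ.+ + 16 ℤ.* w ≡ x ⊎ x ℤ.+ + 16 ℤ.* w ≡ ℤ.- x → i ≡ m × Square 24 1 m
      choose (inj₁ e) = i≡m , x , subst (λ z → x ℤ.* x ≡ + 24 ℤ.* + z ℤ.+ + 1) i≡m first
        where i≡m = index (ℤ.*-cancelˡ-≡ (+ 16) _ _ (linear₁ (+ 1) e (cancel x w)))
      choose (inj₂ e) = ⊥-elim (nonmultiple 8 1 {z = + 8 ℤ.* (w ℤ.* w) ℤ.- + 3 ℤ.* + i}
        (linear₁ (+ 1) (square-cong x {ℤ.- + 8 ℤ.* w} (sym (ℤ.*-cancelˡ-≡ (+ 2) x (ℤ.- + 8 ℤ.* w) (linear₁ (+ 1) e (halve x w)))) first) (eight w (+ i))))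

  fixed-reflection : Square 24 1 m → Reflection m m m
  fixed-reflection (x , h) = record
    { x = x ; w = + 0 ; i′ = m ; j′ = m ; first = h ; second = square-cong x (identity₁ x) h
    ; third = square-cong x (identity₁ x) h ; fourth = square-cong x (identity₁ x) h ; total = identity₂ (+ m) ; total′ = identity₂ (+ m) }
    where
    identity₁ : ∀ x → x ℤ.+ + 0 ≡ x
    identity₁ = ℤ.+-identityʳ
    identity₂ : ∀ m → m ℤ.+ + 4 ℤ.* m ≡ + 5 ℤ.* m
    identity₂ = ℤSolver.solve-∀

reflection-coefficient : ∀ N f₁ f₄ f₅ → SquareSeries N 1 24 1 f₁ → SquareSeries N 4 24 1 f₄ → SquareSeries N 5 24 1 f₅ →
  ∀ m → 5 * m < N → (∀ z → + 24 ℤ.* + m ℤ.+ + 1 ≢ + 5 ℤ.* z) → (f₁ ⊛ f₄) (5 * m) ≡ f₅ (5 * m)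
reflection-coefficient N f₁ f₄ f₅ F₁ F₄ F₅ m 5m<N 5∤24m+1 = begin
  (f₁ ⊛ f₄) (5 * m)            ≡⟨ ⊛-sum f₁ f₄ (5 * m) ⟩
  sum p (suc (5 * m))          ≡⟨ involution-sum graph reflection-symmetric δ fixed⇒δ δ⇒fixed ⟩
  sum δ (suc (5 * m))          ≡⟨ sum-single δ (suc (5 * m)) m (s≤s (ℕ.m≤n*m m 5)) (λ j _ j≢m → cong (_∧ f₅ (5 * m)) (dec-false (j ≟ m) j≢m)) ⟩
  does (m ≟ m) ∧ f₅ (5 * m)    ≡⟨ cong (_∧ f₅ (5 * m)) (dec-true (m ≟ m) refl) ⟩
  f₅ (5 * m)                   ∎
  where
  open ≡-Reasoning
  module F₁ = SquareSeries F₁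
  module F₄ = SquareSeries F₄
  module F₅ = SquareSeries F₅
  p δ : ℕ → Bool
  p i = f₁ i ∧ f₄ (5 * m ∸ i)
  -- The only possible fixed point is i = m, and it exists exactly when f₅ has the coefficient 1 at
  -- 5 m.
  δ i = does (i ≟ m) ∧ f₅ (5 * m)
  fixed⇒δ : ∀ {i} → Reflection m i i → δ i ≡ true
  fixed⇒δ {i} r = found (reflection-fixed 5∤24m+1 r)
    where
    found : i ≡ m × Square 24 1 m → δ i ≡ true
    found (i≡m , s) = cong₂ _∧_ (dec-true (i ≟ m) i≡m) (F₅.occurs m 5m<N s)
  δ⇒fixed : ∀ {i} → δ i ≡ true → Reflection m i i
  δ⇒fixed {i} h = found (ℕ.≡ᵇ⇒≡ i m (Equivalence.from Bool.T-≡ (Bool.∧-conicalˡ _ _ h))) (F₅.square (5 * m) 5m<N (Bool.∧-conicalʳ (does (i ≟ m)) _ h))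
    where
    found : i ≡ m → (∃ λ q → 5 * m ≡ 5 * q × Square 24 1 q) → Reflection m i i
    found refl (q , e , s) = fixed-reflection (subst (Square 24 1) (sym (ℕ.*-cancelˡ-≡ i q 5 e)) s)
  graph : Graph (suc (5 * m)) p (Reflection m)
  graph = record { valid = valid ; image = image ; functional = reflection-functional 5∤24m+1 }
    where
    image : ∀ {i} → i < suc (5 * m) → p i ≡ true → ∃ (Reflection m i)
    image {i} l h = found (F₁.square i (ℕ.≤-<-trans (s≤s⁻¹ l) 5m<N) (Bool.∧-conicalˡ _ _ h))
                          (F₄.square (5 * m ∸ i) (ℕ.≤-<-trans (ℕ.m∸n≤m (5 * m) i) 5m<N) (Bool.∧-conicalʳ (f₁ i) _ h))
      where
      found : (∃ λ q → i ≡ 1 * q × Square 24 1 q) → (∃ λ i′ → 5 * m ∸ i ≡ 4 * i′ × Square 24 1 i′) → ∃ (Reflection m i)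
      found (q , e , x , s) (i′ , e′ , y , s′) = reflection-image {i′ = i′} x y
        (subst (λ z → x ℤ.* x ≡ + 24 ℤ.* + z ℤ.+ + 1) (sym (trans e (ℕ.*-identityˡ q))) s) s′
        (trans (cong (λ z → + i ℤ.+ z) (sym (ℤ.pos-* 4 i′)))
          (trans (cong +_ (trans (cong (λ z → i + z) (sym e′)) (ℕ.m+[n∸m]≡n (s≤s⁻¹ l)))) (ℤ.pos-* 5 m)))
    valid : ∀ {i j} → Reflection m i j → i < suc (5 * m) × j < suc (5 * m) × p i ≡ true
    valid {i} {j} r = s≤s i≤ , s≤s j≤ , cong₂ _∧_
      (subst (λ z → f₁ z ≡ true) (ℕ.*-identityˡ i) (F₁.occurs i (subst (_< N) (sym (ℕ.*-identityˡ i)) (ℕ.≤-<-trans i≤ 5m<N)) (x , first)))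
      (subst (λ z → f₄ z ≡ true) rest (F₄.occurs i′ (subst (_< N) (sym rest) (ℕ.≤-<-trans (ℕ.m∸n≤m (5 * m) i) 5m<N)) (x ℤ.+ + 10 ℤ.* w , second)))
      where
      open Reflection r
      t = reflection-totals {m} {i} {i′} total
      i≤ : i ≤ 5 * m
      i≤ = ℕ.≤-trans (ℕ.m≤m+n i (4 * i′)) (ℕ.≤-reflexive t)
      j≤ : j ≤ 5 * m
      j≤ = ℕ.≤-trans (ℕ.m≤m+n j (4 * j′)) (ℕ.≤-reflexive (reflection-totals {m} {j} {j′} total′))
      rest : 4 * i′ ≡ 5 * m ∸ i
      rest = trans (sym (ℕ.m+n∸m≡n i (4 * i′))) (cong (_∸ i) t)

-- Solutions of a² + b² = 8 n + 2

square-one : ∀ {N a b f} → SquareSeries N 1 a b f → ∀ n → n < N → f n ≡ true → Square a b n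
square-one {a = a} {b} F n l h with SquareSeries.square F n l h
... | p , e , s = subst (Square a b) (sym (trans e (ℕ.*-identityˡ p))) s

one-square : ∀ {N a b f} → SquareSeries N 1 a b f → ∀ n → n < N → Square a b n → f n ≡ true
one-square {N} {f = f} F n l s = subst (λ z → f z ≡ true) (ℕ.*-identityˡ n)
  (SquareSeries.occurs F n (subst (_< N) (sym (ℕ.*-identityˡ n)) l) s)

odd-square : ∀ {x} → Odd x → ∃ λ j → x ℤ.* x ≡ + 8 ℤ.* + j ℤ.+ + 1
odd-square {x} (e , x≡) = proj₁ nat , trans h (cong (λ z → + 8 ℤ.* z ℤ.+ + 1) (proj₂ nat))
  where
  t = proj₁ (square-parity e)
  identity : ∀ e t → (+ 1 ℤ.+ + 2 ℤ.* e) ℤ.* (+ 1 ℤ.+ + 2 ℤ.* e) ℤ.- (+ 8 ℤ.* (e ℤ.+ t) ℤ.+ + 1) ≡ + 4 ℤ.* (e ℤ.* e ℤ.- (e ℤ.+ + 2 ℤ.* t))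
  identity = ℤSolver.solve-∀
  h : x ℤ.* x ≡ + 8 ℤ.* (e ℤ.+ t) ℤ.+ + 1
  h = square-cong (+ 1 ℤ.+ + 2 ℤ.* e) x≡ (linear₁ (+ 4) (proj₂ (square-parity e)) (identity e t))
  nat = natural 8 1 x (e ℤ.+ t) h

Odd-≢-even : ∀ {x v} → Odd x → x ≢ + 2 ℤ.* v
Odd-≢-even {x} {v} (e , x≡) h = nonmultiple 2 1 {z = v ℤ.- e} (linear₂ (ℤ.- + 1) (+ 1) h x≡ (identity x v e))
  where
  identity : ∀ x v e → + 2 ℤ.* (v ℤ.- e) ℤ.- + 1 ≡ ℤ.- + 1 ℤ.* (x ℤ.- + 2 ℤ.* v) ℤ.+ + 1 ℤ.* (x ℤ.- (+ 1 ℤ.+ + 2 ℤ.* e))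
  identity = ℤSolver.solve-∀

Odd-≢-10 : ∀ {x} v → Odd x → + 6 ℤ.* x ≢ + 20 ℤ.* v
Odd-≢-10 {x} v o h = Odd-≢-even {x} {+ 5 ℤ.* v ℤ.- x} o (ℤ.*-cancelˡ-≡ (+ 2) _ _ (linear₁ (+ 1) h (identity x v)))
  where
  identity : ∀ x v → + 2 ℤ.* x ℤ.- + 2 ℤ.* (+ 2 ℤ.* (+ 5 ℤ.* v ℤ.- x)) ≡ + 1 ℤ.* (+ 6 ℤ.* x ℤ.- + 20 ℤ.* v)
  identity = ℤSolver.solve-∀

odd-square-mod-40 : ∀ {x} → Odd x → (∃ λ c → x ≡ + 5 ℤ.* c) ⊎ (∃ λ I → x ℤ.* x ≡ + 40 ℤ.* I ℤ.+ + 1) ⊎ (∃ λ I → x ℤ.* x ≡ + 40 ℤ.* I ℤ.+ + 9)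
odd-square-mod-40 {x} o = by-residue (residue 5 x)
  where
  v = proj₁ (odd-square o)
  h = proj₂ (odd-square o)
  -- 25 and - 24 are the idempotents of the Chinese remainder theorem for 8 and 5. For r = 4 they
  -- give 25 - 24 * 4 = 9 - 2 * 40, hence k = - 2.
  combine : ∀ s r b k → (∀ X v s → X ℤ.- (+ 40 ℤ.* (+ 5 ℤ.* v ℤ.- + 3 ℤ.* s ℤ.+ k) ℤ.+ b)
                             ≡ + 25 ℤ.* (X ℤ.- (+ 8 ℤ.* v ℤ.+ + 1)) ℤ.+ ℤ.- + 24 ℤ.* (X ℤ.- (+ 5 ℤ.* s ℤ.+ r))) →
            x ℤ.* x ≡ + 5 ℤ.* s ℤ.+ r → ∃ λ I → x ℤ.* x ≡ + 40 ℤ.* I ℤ.+ b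
  combine s r b k identity e = + 5 ℤ.* + v ℤ.- + 3 ℤ.* s ℤ.+ k , linear₂ (+ 25) (ℤ.- + 24) h e (identity (x ℤ.* x) (+ v) s)
  identity₁ : ∀ X v s → X ℤ.- (+ 40 ℤ.* (+ 5 ℤ.* v ℤ.- + 3 ℤ.* s ℤ.+ + 0) ℤ.+ + 1) ≡ + 25 ℤ.* (X ℤ.- (+ 8 ℤ.* v ℤ.+ + 1)) ℤ.+ ℤ.- + 24 ℤ.* (X ℤ.- (+ 5 ℤ.* s ℤ.+ + 1))
  identity₁ = ℤSolver.solve-∀
  identity₄ : ∀ X v s → X ℤ.- (+ 40 ℤ.* (+ 5 ℤ.* v ℤ.- + 3 ℤ.* s ℤ.+ ℤ.- + 2) ℤ.+ + 9) ≡ + 25 ℤ.* (X ℤ.- (+ 8 ℤ.* v ℤ.+ + 1)) ℤ.+ ℤ.- + 24 ℤ.* (X ℤ.- (+ 5 ℤ.* s ℤ.+ + 4))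
  identity₄ = ℤSolver.solve-∀
  expand : ∀ r q → (r ℤ.+ q ℤ.* + 5) ℤ.* (r ℤ.+ q ℤ.* + 5) ≡ + 5 ℤ.* (+ 5 ℤ.* q ℤ.* q ℤ.+ + 2 ℤ.* r ℤ.* q) ℤ.+ r ℤ.* r
  expand = ℤSolver.solve-∀
  expand₃ : ∀ q → (+ 3 ℤ.+ q ℤ.* + 5) ℤ.* (+ 3 ℤ.+ q ℤ.* + 5) ≡ + 5 ℤ.* (+ 5 ℤ.* q ℤ.* q ℤ.+ + 6 ℤ.* q ℤ.+ + 1) ℤ.+ + 4
  expand₃ = ℤSolver.solve-∀
  expand₄ : ∀ q → (+ 4 ℤ.+ q ℤ.* + 5) ℤ.* (+ 4 ℤ.+ q ℤ.* + 5) ≡ + 5 ℤ.* (+ 5 ℤ.* q ℤ.* q ℤ.+ + 8 ℤ.* q ℤ.+ + 3) ℤ.+ + 1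
  expand₄ = ℤSolver.solve-∀
  by-residue : (∃ λ r → ∃ λ q → r < 5 × x ≡ + r ℤ.+ q ℤ.* + 5) → _
  by-residue (0 , q , _ , e) = inj₁ (q , trans e (trans (ℤ.+-identityˡ _) (ℤ.*-comm q (+ 5))))
  by-residue (1 , q , _ , e) = inj₂ (inj₁ (combine (+ 5 ℤ.* q ℤ.* q ℤ.+ + 2 ℤ.* + 1 ℤ.* q) (+ 1) (+ 1) (+ 0) identity₁ (square-cong (+ 1 ℤ.+ q ℤ.* + 5) e (expand (+ 1) q))))
  by-residue (2 , q , _ , e) = inj₂ (inj₂ (combine (+ 5 ℤ.* q ℤ.* q ℤ.+ + 2 ℤ.* + 2 ℤ.* q) (+ 4) (+ 9) (ℤ.- + 2) identity₄ (square-cong (+ 2 ℤ.+ q ℤ.* + 5) e (expand (+ 2) q))))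
  by-residue (3 , q , _ , e) = inj₂ (inj₂ (combine (+ 5 ℤ.* q ℤ.* q ℤ.+ + 6 ℤ.* q ℤ.+ + 1) (+ 4) (+ 9) (ℤ.- + 2) identity₄ (square-cong (+ 3 ℤ.+ q ℤ.* + 5) e (expand₃ q))))
  by-residue (4 , q , _ , e) = inj₂ (inj₁ (combine (+ 5 ℤ.* q ℤ.* q ℤ.+ + 8 ℤ.* q ℤ.+ + 3) (+ 1) (+ 1) (+ 0) identity₁ (square-cong (+ 4 ℤ.+ q ℤ.* + 5) e (expand₄ q))))
  by-residue (suc (suc (suc (suc (suc _)))) , _ , s≤s (s≤s (s≤s (s≤s (s≤s ())))) , _)

-- Multiplication by 2 + i on pairs of odd squares

partner : ℤ → ℤ → ℤ
partner X u = + 3 ℤ.* X ℤ.- + 20 ℤ.* u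

-- For a ≡ b mod 4, put X = 2 a - b and 4 u = a - b, so that (2 + i)(a + b i) = X + (partner X u) i.
record Core (n j : ℕ) (X u : ℤ) : Set where
  field
    j′     : ℕ
    first  : (X ℤ.- + 4 ℤ.* u) ℤ.* (X ℤ.- + 4 ℤ.* u) ≡ + 8 ℤ.* + j ℤ.+ + 1
    second : (X ℤ.- + 8 ℤ.* u) ℤ.* (X ℤ.- + 8 ℤ.* u) ≡ + 8 ℤ.* + j′ ℤ.+ + 1
    total  : + j ℤ.+ + j′ ≡ + n

-- Squares modulo 40 tell P and Q apart, but the real part X may be either of them.
Outer : ℕ → ℕ → ℤ → ℤ → Set
Outer n i P Q = ∃ λ i′ → P ℤ.* P ≡ + 40 ℤ.* + i ℤ.+ + 9 × Q ℤ.* Q ≡ + 40 ℤ.* + i′ ℤ.+ + 1 × + i ℤ.+ + i′ ≡ + n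

-- The index 1 + 5 p reflects the extra factor q: 25 (8 p + 8 p′ + 2) = 40 n + 10 means n = 1 + 5 p
-- + 5 p′.
record Inner (n i : ℕ) (X Y : ℤ) : Set where
  field
    c d    : ℤ
    p p′   : ℕ
    X≡     : X ≡ + 5 ℤ.* c
    Y≡     : Y ≡ + 5 ℤ.* d
    first  : c ℤ.* c ≡ + 8 ℤ.* + p ℤ.+ + 1
    second : d ℤ.* d ≡ + 8 ℤ.* + p′ ℤ.+ + 1
    index  : + i ≡ + 1 ℤ.+ + 5 ℤ.* + p
    total  : + i ℤ.+ + 5 ℤ.* + p′ ≡ + n

-- Multiplication by 2 + i sends the pairs (a , b) counted by ψ₁ ψ₁ to those counted by θ₁ θ₂, unless the
-- product is divisible by 5; the quotients by 5 are then counted by q ψ₅ ψ₅.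
Coprime Divisible : ℕ → ℕ → ℕ → Set
Coprime n i j = ∃ λ X → ∃ λ u → Core n j X u × (Outer n i X (partner X u) ⊎ Outer n i (partner X u) X)
Divisible n i j = ∃ λ X → ∃ λ u → Core n j X u × Inner n i X (partner X u)

Core-odd-first : ∀ {n j X u} → Core n j X u → Odd (X ℤ.- + 4 ℤ.* u)
Core-odd-first {j = j} {X} {u} C = odd-root 4 1 {p = j} {X ℤ.- + 4 ℤ.* u} (Core.first C)

Core-odd : ∀ {n j X u} → Core n j X u → Odd X
Core-odd {X = X} {u} C = e ℤ.+ + 2 ℤ.* u , linear₁ (+ 1) (proj₂ (Core-odd-first C)) (identity X u e)
  where
  e = proj₁ (Core-odd-first C)
  identity : ∀ X u e → X ℤ.- (+ 1 ℤ.+ + 2 ℤ.* (e ℤ.+ + 2 ℤ.* u)) ≡ + 1 ℤ.* (X ℤ.- + 4 ℤ.* u ℤ.- (+ 1 ℤ.+ + 2 ℤ.* e))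
  identity = ℤSolver.solve-∀

Core-norm : ∀ {n j X u} → Core n j X u → X ℤ.* X ℤ.+ partner X u ℤ.* partner X u ≡ + 40 ℤ.* + n ℤ.+ + 10
Core-norm {n} {j} {X} {u} C = linear₃ (+ 5) (+ 5) (+ 40) first second total (identity X u (+ j) (+ j′) (+ n))
  where
  open Core C
  identity : ∀ X u j j′ n → let Y = + 3 ℤ.* X ℤ.- + 20 ℤ.* u ; a = X ℤ.- + 4 ℤ.* u ; b = X ℤ.- + 8 ℤ.* u in
    X ℤ.* X ℤ.+ Y ℤ.* Y ℤ.- (+ 40 ℤ.* n ℤ.+ + 10)
      ≡ + 5 ℤ.* (a ℤ.* a ℤ.- (+ 8 ℤ.* j ℤ.+ + 1)) ℤ.+ + 5 ℤ.* (b ℤ.* b ℤ.- (+ 8 ℤ.* j′ ℤ.+ + 1)) ℤ.+ + 40 ℤ.* (j ℤ.+ j′ ℤ.- n)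
  identity = ℤSolver.solve-∀

-- Division by 2 + i: once the imaginary part is 3 X - 20 u, the quotient has the integral
-- coordinates X - 4 u and X - 8 u, odd because X is.
Core-exists : ∀ {n X} u → Odd X → X ℤ.* X ℤ.+ partner X u ℤ.* partner X u ≡ + 40 ℤ.* + n ℤ.+ + 10 → ∃ λ j → Core n j X u
Core-exists {n} {X} u (e , X≡) h = proj₁ A , record
  { j′ = proj₁ B ; first = proj₂ A ; second = proj₂ B
  ; total = ℤ.*-cancelˡ-≡ (+ 40) _ _ (linear₃ (+ 1) (ℤ.- + 5) (ℤ.- + 5) h (proj₂ A) (proj₂ B) (identity X u (+ proj₁ A) (+ proj₁ B) (+ n))) }
  where
  odd-shift : ∀ X u e → X ℤ.- + 2 ℤ.* u ℤ.- (+ 1 ℤ.+ + 2 ℤ.* (e ℤ.- u)) ≡ + 1 ℤ.* (X ℤ.- (+ 1 ℤ.+ + 2 ℤ.* e))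
  odd-shift = ℤSolver.solve-∀
  double₂ : ∀ X u → X ℤ.- + 4 ℤ.* u ≡ X ℤ.- + 2 ℤ.* (+ 2 ℤ.* u)
  double₂ = ℤSolver.solve-∀
  double₄ : ∀ X u → X ℤ.- + 8 ℤ.* u ≡ X ℤ.- + 2 ℤ.* (+ 4 ℤ.* u)
  double₄ = ℤSolver.solve-∀
  A = odd-square {X ℤ.- + 4 ℤ.* u} (e ℤ.- + 2 ℤ.* u , trans (double₂ X u) (linear₁ (+ 1) X≡ (odd-shift X (+ 2 ℤ.* u) e)))
  B = odd-square {X ℤ.- + 8 ℤ.* u} (e ℤ.- + 4 ℤ.* u , trans (double₄ X u) (linear₁ (+ 1) X≡ (odd-shift X (+ 4 ℤ.* u) e)))
  identity : ∀ X u j j′ n → let Y = + 3 ℤ.* X ℤ.- + 20 ℤ.* u ; a = X ℤ.- + 4 ℤ.* u ; b = X ℤ.- + 8 ℤ.* u in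
    + 40 ℤ.* (j ℤ.+ j′) ℤ.- + 40 ℤ.* n
      ≡ + 1 ℤ.* (X ℤ.* X ℤ.+ Y ℤ.* Y ℤ.- (+ 40 ℤ.* n ℤ.+ + 10)) ℤ.+ ℤ.- + 5 ℤ.* (a ℤ.* a ℤ.- (+ 8 ℤ.* j ℤ.+ + 1)) ℤ.+ ℤ.- + 5 ℤ.* (b ℤ.* b ℤ.- (+ 8 ℤ.* j′ ℤ.+ + 1))
  identity = ℤSolver.solve-∀

-- The squares leave X and its partner each up to sign. A common sign only negates the first
-- coordinate a of the quotient; opposite signs would give 6 X = 20 v, contrary to X odd.
Core-index : ∀ {n j k X u X̃ ũ} → Core n j X u → Core n k X̃ ũ → X ℤ.* X ≡ X̃ ℤ.* X̃ →
  partner X u ℤ.* partner X u ≡ partner X̃ ũ ℤ.* partner X̃ ũ → j ≡ k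
Core-index {n} {j} {k} {X} {u} {X̃} {ũ} C D h h′ = choose (square≡⇒± X X̃ h) (square≡⇒± (partner X u) (partner X̃ ũ) h′)
  where
  identity₁ : ∀ X u X̃ ũ → + 5 ℤ.* (X ℤ.- + 4 ℤ.* u) ℤ.- + 5 ℤ.* (X̃ ℤ.- + 4 ℤ.* ũ)
            ≡ + 2 ℤ.* (X ℤ.- X̃) ℤ.+ + 1 ℤ.* ((+ 3 ℤ.* X ℤ.- + 20 ℤ.* u) ℤ.- (+ 3 ℤ.* X̃ ℤ.- + 20 ℤ.* ũ))
  identity₁ = ℤSolver.solve-∀
  identity₂ : ∀ X u X̃ ũ → + 5 ℤ.* ℤ.- (X ℤ.- + 4 ℤ.* u) ℤ.- + 5 ℤ.* (X̃ ℤ.- + 4 ℤ.* ũ)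
            ≡ ℤ.- + 2 ℤ.* (X ℤ.- ℤ.- X̃) ℤ.+ ℤ.- + 1 ℤ.* ((+ 3 ℤ.* X ℤ.- + 20 ℤ.* u) ℤ.- ℤ.- (+ 3 ℤ.* X̃ ℤ.- + 20 ℤ.* ũ))
  identity₂ = ℤSolver.solve-∀
  identity₃ : ∀ X u X̃ ũ → + 6 ℤ.* X ℤ.- + 20 ℤ.* (u ℤ.+ ũ) ≡ + 3 ℤ.* (X ℤ.- X̃) ℤ.+ + 1 ℤ.* ((+ 3 ℤ.* X ℤ.- + 20 ℤ.* u) ℤ.- ℤ.- (+ 3 ℤ.* X̃ ℤ.- + 20 ℤ.* ũ))
  identity₃ = ℤSolver.solve-∀
  identity₄ : ∀ X u X̃ ũ → + 6 ℤ.* X ℤ.- + 20 ℤ.* (u ℤ.- ũ) ≡ + 3 ℤ.* (X ℤ.- ℤ.- X̃) ℤ.+ + 1 ℤ.* ((+ 3 ℤ.* X ℤ.- + 20 ℤ.* u) ℤ.- (+ 3 ℤ.* X̃ ℤ.- + 20 ℤ.* ũ))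
  identity₄ = ℤSolver.solve-∀
  a = X ℤ.- + 4 ℤ.* u
  ã = X̃ ℤ.- + 4 ℤ.* ũ
  choose : X ≡ X̃ ⊎ X ≡ ℤ.- X̃ → partner X u ≡ partner X̃ ũ ⊎ partner X u ≡ ℤ.- partner X̃ ũ → j ≡ k
  choose (inj₁ e) (inj₁ f) = cancel-coeff 8 1 (trans (sym (Core.first C))
    (square-cong ã {a} (ℤ.*-cancelˡ-≡ (+ 5) a ã (linear₂ (+ 2) (+ 1) e f (identity₁ X u X̃ ũ))) (Core.first D)))
  choose (inj₂ e) (inj₂ f) = cancel-coeff 8 1 (trans (sym (reflected-square {a} {ã} a refl
    (sym (ℤ.*-cancelˡ-≡ (+ 5) (ℤ.- a) ã (linear₂ (ℤ.- + 2) (ℤ.- + 1) e f (identity₂ X u X̃ ũ)))) (Core.first C))) (Core.first D))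
  choose (inj₁ e) (inj₂ f) = ⊥-elim (Odd-≢-10 (u ℤ.+ ũ) (Core-odd C) (linear₂ (+ 3) (+ 1) e f (identity₃ X u X̃ ũ)))
  choose (inj₂ e) (inj₁ f) = ⊥-elim (Odd-≢-10 (u ℤ.- ũ) (Core-odd C) (linear₂ (+ 3) (+ 1) e f (identity₄ X u X̃ ũ)))

-- The index j fixes a² and b². Since a ≡ b modulo 4 and a is odd, the two signs can only change
-- together.
Core-squares : ∀ {n j X u X̃ ũ} → Core n j X u → Core n j X̃ ũ →
  X ℤ.* X ≡ X̃ ℤ.* X̃ × partner X u ℤ.* partner X u ≡ partner X̃ ũ ℤ.* partner X̃ ũ
Core-squares {n} {j} {X} {u} {X̃} {ũ} C D = choose
  (square≡⇒± a ã (trans (Core.first C) (sym (Core.first D))))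
  (square≡⇒± b b̃ (trans (Core.second C) (trans (cong (λ z → + 8 ℤ.* z ℤ.+ + 1) j′≡) (sym (Core.second D)))))
  where
  a = X ℤ.- + 4 ℤ.* u
  ã = X̃ ℤ.- + 4 ℤ.* ũ
  b = X ℤ.- + 8 ℤ.* u
  b̃ = X̃ ℤ.- + 8 ℤ.* ũ
  identity : ∀ j a b n → a ℤ.- b ≡ + 1 ℤ.* (j ℤ.+ a ℤ.- n) ℤ.+ ℤ.- + 1 ℤ.* (j ℤ.+ b ℤ.- n)
  identity = ℤSolver.solve-∀
  j′≡ : + Core.j′ C ≡ + Core.j′ D
  j′≡ = linear₂ (+ 1) (ℤ.- + 1) (Core.total C) (Core.total D) (identity (+ j) (+ Core.j′ C) (+ Core.j′ D) (+ n))
  identity₁ : ∀ X u X̃ ũ → X ℤ.- X̃ ≡ + 2 ℤ.* (X ℤ.- + 4 ℤ.* u ℤ.- (X̃ ℤ.- + 4 ℤ.* ũ)) ℤ.+ ℤ.- + 1 ℤ.* (X ℤ.- + 8 ℤ.* u ℤ.- (X̃ ℤ.- + 8 ℤ.* ũ))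
  identity₁ = ℤSolver.solve-∀
  identity₂ : ∀ X u X̃ ũ → (+ 3 ℤ.* X ℤ.- + 20 ℤ.* u) ℤ.- (+ 3 ℤ.* X̃ ℤ.- + 20 ℤ.* ũ)
            ≡ + 1 ℤ.* (X ℤ.- + 4 ℤ.* u ℤ.- (X̃ ℤ.- + 4 ℤ.* ũ)) ℤ.+ + 2 ℤ.* (X ℤ.- + 8 ℤ.* u ℤ.- (X̃ ℤ.- + 8 ℤ.* ũ))
  identity₂ = ℤSolver.solve-∀
  identity₃ : ∀ X u X̃ ũ → X ℤ.- ℤ.- X̃ ≡ + 2 ℤ.* (X ℤ.- + 4 ℤ.* u ℤ.- ℤ.- (X̃ ℤ.- + 4 ℤ.* ũ)) ℤ.+ ℤ.- + 1 ℤ.* (X ℤ.- + 8 ℤ.* u ℤ.- ℤ.- (X̃ ℤ.- + 8 ℤ.* ũ))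
  identity₃ = ℤSolver.solve-∀
  identity₄ : ∀ X u X̃ ũ → (+ 3 ℤ.* X ℤ.- + 20 ℤ.* u) ℤ.- ℤ.- (+ 3 ℤ.* X̃ ℤ.- + 20 ℤ.* ũ)
            ≡ + 1 ℤ.* (X ℤ.- + 4 ℤ.* u ℤ.- ℤ.- (X̃ ℤ.- + 4 ℤ.* ũ)) ℤ.+ + 2 ℤ.* (X ℤ.- + 8 ℤ.* u ℤ.- ℤ.- (X̃ ℤ.- + 8 ℤ.* ũ))
  identity₄ = ℤSolver.solve-∀
  identity₅ : ∀ X u X̃ ũ → + 2 ℤ.* (X ℤ.- + 4 ℤ.* u) ℤ.- + 2 ℤ.* (+ 2 ℤ.* (u ℤ.+ ũ))
            ≡ + 1 ℤ.* (X ℤ.- + 4 ℤ.* u ℤ.- (X̃ ℤ.- + 4 ℤ.* ũ)) ℤ.+ + 1 ℤ.* (X ℤ.- + 8 ℤ.* u ℤ.- ℤ.- (X̃ ℤ.- + 8 ℤ.* ũ))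
  identity₅ = ℤSolver.solve-∀
  identity₆ : ∀ X u X̃ ũ → + 2 ℤ.* (X ℤ.- + 4 ℤ.* u) ℤ.- + 2 ℤ.* (+ 2 ℤ.* (u ℤ.- ũ))
            ≡ + 1 ℤ.* (X ℤ.- + 4 ℤ.* u ℤ.- ℤ.- (X̃ ℤ.- + 4 ℤ.* ũ)) ℤ.+ + 1 ℤ.* (X ℤ.- + 8 ℤ.* u ℤ.- (X̃ ℤ.- + 8 ℤ.* ũ))
  identity₆ = ℤSolver.solve-∀
  choose : a ≡ ã ⊎ a ≡ ℤ.- ã → b ≡ b̃ ⊎ b ≡ ℤ.- b̃ → X ℤ.* X ≡ X̃ ℤ.* X̃ × partner X u ℤ.* partner X u ≡ partner X̃ ũ ℤ.* partner X̃ ũ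
  choose (inj₁ e) (inj₁ f) =
      square-cong X̃ {X} (linear₂ (+ 2) (ℤ.- + 1) e f (identity₁ X u X̃ ũ)) refl
    , square-cong (partner X̃ ũ) {partner X u} (linear₂ (+ 1) (+ 2) e f (identity₂ X u X̃ ũ)) refl
  choose (inj₂ e) (inj₂ f) =
      reflected-square {X̃} {X} X̃ refl (linear₂ (+ 2) (ℤ.- + 1) e f (identity₃ X u X̃ ũ)) refl
    , reflected-square {partner X̃ ũ} {partner X u} (partner X̃ ũ) refl (linear₂ (+ 1) (+ 2) e f (identity₄ X u X̃ ũ)) refl
  choose (inj₁ e) (inj₂ f) = ⊥-elim (Odd-≢-even {a} {u ℤ.+ ũ} (Core-odd-first C) (ℤ.*-cancelˡ-≡ (+ 2) _ _ (linear₂ (+ 1) (+ 1) e f (identity₅ X u X̃ ũ))))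
  choose (inj₂ e) (inj₁ f) = ⊥-elim (Odd-≢-even {a} {u ℤ.- ũ} (Core-odd-first C) (ℤ.*-cancelˡ-≡ (+ 2) _ _ (linear₂ (+ 1) (+ 1) e f (identity₆ X u X̃ ũ))))

outer-squares : ∀ {n i P Q P̃ Q̃} → Outer n i P Q → Outer n i P̃ Q̃ → P ℤ.* P ≡ P̃ ℤ.* P̃ × Q ℤ.* Q ≡ Q̃ ℤ.* Q̃
outer-squares {n} {i} (i′ , p , q , t) (k′ , p̃ , q̃ , t̃) =
    trans p (sym p̃)
  , trans q (trans (cong (λ z → + 40 ℤ.* z ℤ.+ + 1) (linear₂ (+ 1) (ℤ.- + 1) {x = + i′} {+ k′} t t̃ (identity (+ i) (+ i′) (+ k′) (+ n)))) (sym q̃))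
  where
  identity : ∀ i a b n → a ℤ.- b ≡ + 1 ℤ.* (i ℤ.+ a ℤ.- n) ℤ.+ ℤ.- + 1 ℤ.* (i ℤ.+ b ℤ.- n)
  identity = ℤSolver.solve-∀

outer-not-5 : ∀ {n i X Y} → Outer n i X Y → ∀ v → + 2 ℤ.* X ≢ + 5 ℤ.* v
outer-not-5 {n} {i} {X} (_ , p , _) v h = nonmultiple 5 1 {z = + 5 ℤ.* (v ℤ.* v) ℤ.- + 32 ℤ.* + i ℤ.- + 7}
  (linear₂ (ℤ.- (+ 2 ℤ.* X ℤ.+ + 5 ℤ.* v)) (+ 4) h p (identity X v (+ i)))
  where
  identity : ∀ X v i → + 5 ℤ.* (+ 5 ℤ.* (v ℤ.* v) ℤ.- + 32 ℤ.* i ℤ.- + 7) ℤ.- + 1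
    ≡ ℤ.- (+ 2 ℤ.* X ℤ.+ + 5 ℤ.* v) ℤ.* (+ 2 ℤ.* X ℤ.- + 5 ℤ.* v) ℤ.+ + 4 ℤ.* (X ℤ.* X ℤ.- (+ 40 ℤ.* i ℤ.+ + 9))
  identity = ℤSolver.solve-∀

-- With Y ≡ 3 X modulo 20, exchanging the coordinates up to sign would give 8 X ≡ 0 or 10 X ≡ 0
-- modulo 20. The former makes 5 divide X, against X² ≡ 9 modulo 40, the latter makes X even.
outer-orientation : ∀ {n i j k X u X̃ ũ} → Core n j X u → Core n k X̃ ũ → Outer n i X (partner X u) → ¬ Outer n i (partner X̃ ũ) X̃
outer-orientation {n} {i} {j} {k} {X} {u} {X̃} {ũ} C D O Õ = choose
  (square≡⇒± X (partner X̃ ũ) (proj₁ (outer-squares {P = X} {partner X u} {partner X̃ ũ} {X̃} O Õ)))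
  (square≡⇒± (partner X u) X̃ (proj₂ (outer-squares {P = X} {partner X u} {partner X̃ ũ} {X̃} O Õ)))
  where
  identity₁ : ∀ X u X̃ ũ → + 4 ℤ.* (+ 2 ℤ.* X) ℤ.- + 4 ℤ.* (+ 5 ℤ.* (+ 3 ℤ.* u ℤ.+ ũ))
    ≡ ℤ.- + 1 ℤ.* (X ℤ.- (+ 3 ℤ.* X̃ ℤ.- + 20 ℤ.* ũ)) ℤ.+ + 3 ℤ.* ((+ 3 ℤ.* X ℤ.- + 20 ℤ.* u) ℤ.- X̃)
  identity₁ = ℤSolver.solve-∀
  identity₂ : ∀ X u X̃ ũ → + 4 ℤ.* (+ 2 ℤ.* X) ℤ.- + 4 ℤ.* (+ 5 ℤ.* (+ 3 ℤ.* u ℤ.- ũ))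
    ≡ ℤ.- + 1 ℤ.* (X ℤ.- ℤ.- (+ 3 ℤ.* X̃ ℤ.- + 20 ℤ.* ũ)) ℤ.+ + 3 ℤ.* ((+ 3 ℤ.* X ℤ.- + 20 ℤ.* u) ℤ.- ℤ.- X̃)
  identity₂ = ℤSolver.solve-∀
  identity₃ : ∀ X u X̃ ũ → + 10 ℤ.* X ℤ.- + 10 ℤ.* (+ 2 ℤ.* (+ 3 ℤ.* u ℤ.+ ũ))
    ≡ + 1 ℤ.* (X ℤ.- ℤ.- (+ 3 ℤ.* X̃ ℤ.- + 20 ℤ.* ũ)) ℤ.+ + 3 ℤ.* ((+ 3 ℤ.* X ℤ.- + 20 ℤ.* u) ℤ.- X̃)
  identity₃ = ℤSolver.solve-∀
  identity₄ : ∀ X u X̃ ũ → + 10 ℤ.* X ℤ.- + 10 ℤ.* (+ 2 ℤ.* (+ 3 ℤ.* u ℤ.- ũ))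
    ≡ + 1 ℤ.* (X ℤ.- (+ 3 ℤ.* X̃ ℤ.- + 20 ℤ.* ũ)) ℤ.+ + 3 ℤ.* ((+ 3 ℤ.* X ℤ.- + 20 ℤ.* u) ℤ.- ℤ.- X̃)
  identity₄ = ℤSolver.solve-∀
  choose : X ≡ partner X̃ ũ ⊎ X ≡ ℤ.- partner X̃ ũ → partner X u ≡ X̃ ⊎ partner X u ≡ ℤ.- X̃ → ⊥
  choose (inj₁ e) (inj₁ f) = outer-not-5 {X = X} {partner X u} O (+ 3 ℤ.* u ℤ.+ ũ) (ℤ.*-cancelˡ-≡ (+ 4) _ _ (linear₂ (ℤ.- + 1) (+ 3) e f (identity₁ X u X̃ ũ)))
  choose (inj₂ e) (inj₂ f) = outer-not-5 {X = X} {partner X u} O (+ 3 ℤ.* u ℤ.- ũ) (ℤ.*-cancelˡ-≡ (+ 4) _ _ (linear₂ (ℤ.- + 1) (+ 3) e f (identity₂ X u X̃ ũ)))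
  choose (inj₂ e) (inj₁ f) = Odd-≢-even {X} {+ 3 ℤ.* u ℤ.+ ũ} (Core-odd C) (ℤ.*-cancelˡ-≡ (+ 10) _ _ (linear₂ (+ 1) (+ 3) e f (identity₃ X u X̃ ũ)))
  choose (inj₁ e) (inj₂ f) = Odd-≢-even {X} {+ 3 ℤ.* u ℤ.- ũ} (Core-odd C) (ℤ.*-cancelˡ-≡ (+ 10) _ _ (linear₂ (+ 1) (+ 3) e f (identity₄ X u X̃ ũ)))

coprime-functional : ∀ {n i j k} → Coprime n i j → Coprime n i k → j ≡ k
coprime-functional (X , u , C , inj₁ O) (X̃ , ũ , D , inj₁ Õ) =
  let h , k = outer-squares {P = X} {partner X u} {X̃} {partner X̃ ũ} O Õ in Core-index C D h k
coprime-functional (X , u , C , inj₂ O) (X̃ , ũ , D , inj₂ Õ) =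
  let h , k = outer-squares {P = partner X u} {X} {partner X̃ ũ} {X̃} O Õ in Core-index C D k h
coprime-functional (X , u , C , inj₁ O) (X̃ , ũ , D , inj₂ Õ) = ⊥-elim (outer-orientation C D O Õ)
coprime-functional (X , u , C , inj₂ O) (X̃ , ũ , D , inj₁ Õ) = ⊥-elim (outer-orientation D C Õ O)

norm : ∀ {n i i′ X Y} a b → X ℤ.* X ≡ + 40 ℤ.* + i ℤ.+ a → Y ℤ.* Y ≡ + 40 ℤ.* + i′ ℤ.+ b → + i ℤ.+ + i′ ≡ + n →
  X ℤ.* X ℤ.+ Y ℤ.* Y ≡ + 40 ℤ.* + n ℤ.+ (a ℤ.+ b)
norm {n} {i} {i′} {X} {Y} a b h k t = linear₃ (+ 1) (+ 1) (+ 40) h k t (identity (X ℤ.* X) (Y ℤ.* Y) (+ i) (+ i′) (+ n) a b)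
  where
  identity : ∀ X Y i i′ n a b → X ℤ.+ Y ℤ.- (+ 40 ℤ.* n ℤ.+ (a ℤ.+ b))
    ≡ + 1 ℤ.* (X ℤ.- (+ 40 ℤ.* i ℤ.+ a)) ℤ.+ + 1 ℤ.* (Y ℤ.- (+ 40 ℤ.* i′ ℤ.+ b)) ℤ.+ + 40 ℤ.* (i ℤ.+ i′ ℤ.- n)
  identity = ℤSolver.solve-∀

-- Write Q - 3 P = 10 c. For even c the pair (P , Q) satisfies the congruence modulo 20. For odd c
-- the pair (Q , - P) does, because 3 Q + P = 10 (P + 3 c) with P and c odd.
coprime-place : ∀ {n i P Q} v → Outer n i P Q → Odd P → Odd Q → Q ℤ.- + 3 ℤ.* P ≡ v ℤ.* + 5 → ∃ (Coprime n i)
coprime-place {n} {i} {P} {Q} v O@(i′ , p , q , t) (e , P≡) (f , Q≡) h = choose (proj₁ ten) (proj₂ ten) (even-or-odd (proj₁ ten))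
  where
  halve : ∀ P Q e f → Q ℤ.- + 3 ℤ.* P ℤ.- + 2 ℤ.* (f ℤ.- + 3 ℤ.* e ℤ.- + 1) ≡ ℤ.- + 3 ℤ.* (P ℤ.- (+ 1 ℤ.+ + 2 ℤ.* e)) ℤ.+ + 1 ℤ.* (Q ℤ.- (+ 1 ℤ.+ + 2 ℤ.* f))
  halve = ℤSolver.solve-∀
  ten = ten-divides (Q ℤ.- + 3 ℤ.* P) v (f ℤ.- + 3 ℤ.* e ℤ.- + 1) h (linear₂ (ℤ.- + 3) (+ 1) P≡ Q≡ (halve P Q e f))
  identity₁ : ∀ P Q c h → + 3 ℤ.* P ℤ.- + 20 ℤ.* ℤ.- h ℤ.- Q ≡ ℤ.- + 1 ℤ.* (Q ℤ.- + 3 ℤ.* P ℤ.- + 10 ℤ.* c) ℤ.+ ℤ.- + 10 ℤ.* (c ℤ.- + 2 ℤ.* h)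
  identity₁ = ℤSolver.solve-∀
  identity₂ : ∀ P Q c h e → + 3 ℤ.* Q ℤ.- + 20 ℤ.* (+ 2 ℤ.+ e ℤ.+ + 3 ℤ.* h) ℤ.- ℤ.- P
    ≡ + 3 ℤ.* (Q ℤ.- + 3 ℤ.* P ℤ.- + 10 ℤ.* c) ℤ.+ + 30 ℤ.* (c ℤ.- (+ 1 ℤ.+ + 2 ℤ.* h)) ℤ.+ + 10 ℤ.* (P ℤ.- (+ 1 ℤ.+ + 2 ℤ.* e))
  identity₂ = ℤSolver.solve-∀
  choose : ∀ c → Q ℤ.- + 3 ℤ.* P ≡ + 10 ℤ.* c → (∃ λ h → c ≡ + 2 ℤ.* h ⊎ c ≡ + 1 ℤ.+ + 2 ℤ.* h) → ∃ (Coprime n i)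
  choose c g (h , inj₁ c≡) =
    let Y² = square-cong Q {partner P (ℤ.- h)} (linear₂ (ℤ.- + 1) (ℤ.- + 10) g c≡ (identity₁ P Q c h)) q
        j , C = Core-exists {n} {P} (ℤ.- h) (e , P≡) (norm {n} {i} {i′} {P} {partner P (ℤ.- h)} (+ 9) (+ 1) p Y² t)
    in j , P , ℤ.- h , C , inj₁ (i′ , p , Y² , t)
  choose c g (h , inj₂ c≡) =
    -- This is (P + 3 c) / 2 for P = 1 + 2 e and c = 1 + 2 h.
    let u = + 2 ℤ.+ e ℤ.+ + 3 ℤ.* h
        Y² = reflected-square {P} {partner Q u} P refl (linear₃ (+ 3) (+ 30) (+ 10) g c≡ P≡ (identity₂ P Q c h e)) p
        j , C = Core-exists {n} {Q} u (f , Q≡) (norm {n} {i′} {i} {Q} {partner Q u} (+ 1) (+ 9) q Y² (trans (ℤ.+-comm (+ i′) (+ i)) t))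
    in j , Q , u , C , inj₂ (i′ , Y² , q , t)

-- Q² - 9 P² ≡ 1 - 81 ≡ 0 modulo 5, so Q ≡ 3 P modulo 5 after a possible change of the sign of Q.
coprime-image : ∀ {n i P Q} → Outer n i P Q → ∃ (Coprime n i)
coprime-image {n} {i} {P} {Q} O@(i′ , p , q , t) = choose (five-divides (Q ℤ.- + 3 ℤ.* P) (Q ℤ.+ + 3 ℤ.* P) (+ 8 ℤ.* + i′ ℤ.- + 72 ℤ.* + i ℤ.- + 16)
    (linear₂ (+ 1) (ℤ.- + 9) q p (identity P Q (+ i) (+ i′))))
  where
  identity : ∀ P Q i i′ → (Q ℤ.- + 3 ℤ.* P) ℤ.* (Q ℤ.+ + 3 ℤ.* P) ℤ.- + 5 ℤ.* (+ 8 ℤ.* i′ ℤ.- + 72 ℤ.* i ℤ.- + 16)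
    ≡ + 1 ℤ.* (Q ℤ.* Q ℤ.- (+ 40 ℤ.* i′ ℤ.+ + 1)) ℤ.+ ℤ.- + 9 ℤ.* (P ℤ.* P ℤ.- (+ 40 ℤ.* i ℤ.+ + 9))
  identity = ℤSolver.solve-∀
  opposite : ∀ P Q v → ℤ.- Q ℤ.- + 3 ℤ.* P ℤ.- ℤ.- v ℤ.* + 5 ≡ ℤ.- + 1 ℤ.* (Q ℤ.+ + 3 ℤ.* P ℤ.- v ℤ.* + 5)
  opposite = ℤSolver.solve-∀
  P-odd : Odd P
  P-odd = odd-root 20 9 {p = i} {P} p
  Q² : ℤ.- Q ℤ.* ℤ.- Q ≡ + 40 ℤ.* + i′ ℤ.+ + 1
  Q² = reflected-square {Q} {ℤ.- Q} Q refl refl q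
  choose : (∃ λ v → Q ℤ.- + 3 ℤ.* P ≡ v ℤ.* + 5) ⊎ (∃ λ v → Q ℤ.+ + 3 ℤ.* P ≡ v ℤ.* + 5) → ∃ (Coprime n i)
  choose (inj₁ (v , h)) = coprime-place {P = P} {Q} v O P-odd (odd-root 20 1 {p = i′} {Q} q) h
  choose (inj₂ (v , h)) = coprime-place {P = P} {ℤ.- Q} (ℤ.- v) (i′ , p , Q² , t) P-odd (odd-root 20 1 {p = i′} {ℤ.- Q} Q²) (linear₁ (ℤ.- + 1) h (opposite P Q v))

five-fold-square : ∀ {X c p} → X ≡ + 5 ℤ.* c → c ℤ.* c ≡ + 8 ℤ.* + p ℤ.+ + 1 → X ℤ.* X ≡ + 200 ℤ.* + p ℤ.+ + 25
five-fold-square {X} {c} {p} X≡ h = square-cong (+ 5 ℤ.* c) {X} X≡ (linear₁ (+ 25) h (identity c (+ p)))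
  where
  identity : ∀ c p → (+ 5 ℤ.* c) ℤ.* (+ 5 ℤ.* c) ℤ.- (+ 200 ℤ.* p ℤ.+ + 25) ≡ + 25 ℤ.* (c ℤ.* c ℤ.- (+ 8 ℤ.* p ℤ.+ + 1))
  identity = ℤSolver.solve-∀

inner-first : ∀ {n i X Y} (I : Inner n i X Y) → X ℤ.* X ≡ + 200 ℤ.* + Inner.p I ℤ.+ + 25
inner-first {X = X} I = five-fold-square {X} {Inner.c I} {Inner.p I} (Inner.X≡ I) (Inner.first I)

inner-second : ∀ {n i X Y} (I : Inner n i X Y) → Y ℤ.* Y ≡ + 200 ℤ.* + Inner.p′ I ℤ.+ + 25
inner-second {Y = Y} I = five-fold-square {Y} {Inner.d I} {Inner.p′ I} (Inner.Y≡ I) (Inner.second I)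

divisible-functional : ∀ {n i j k} → Divisible n i j → Divisible n i k → j ≡ k
divisible-functional {n} {i} (X , u , C , I) (X̃ , ũ , D , Ĩ) = Core-index C D
  (trans (inner-first I) (trans (cong (λ z → + 200 ℤ.* z ℤ.+ + 25) p≡) (sym (inner-first Ĩ))))
  (trans (inner-second I) (trans (cong (λ z → + 200 ℤ.* z ℤ.+ + 25) p′≡) (sym (inner-second Ĩ))))
  where
  module I = Inner I
  module Ĩ = Inner Ĩ
  identity : ∀ i a b → + 5 ℤ.* a ℤ.- + 5 ℤ.* b ≡ ℤ.- + 1 ℤ.* (i ℤ.- (+ 1 ℤ.+ + 5 ℤ.* a)) ℤ.+ + 1 ℤ.* (i ℤ.- (+ 1 ℤ.+ + 5 ℤ.* b))
  identity = ℤSolver.solve-∀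
  identity′ : ∀ i a b n → + 5 ℤ.* a ℤ.- + 5 ℤ.* b ≡ + 1 ℤ.* (i ℤ.+ + 5 ℤ.* a ℤ.- n) ℤ.+ ℤ.- + 1 ℤ.* (i ℤ.+ + 5 ℤ.* b ℤ.- n)
  identity′ = ℤSolver.solve-∀
  p≡ : + I.p ≡ + Ĩ.p
  p≡ = ℤ.*-cancelˡ-≡ (+ 5) _ _ (linear₂ (ℤ.- + 1) (+ 1) I.index Ĩ.index (identity (+ i) (+ I.p) (+ Ĩ.p)))
  p′≡ : + I.p′ ≡ + Ĩ.p′
  p′≡ = ℤ.*-cancelˡ-≡ (+ 5) _ _ (linear₂ (+ 1) (ℤ.- + 1) I.total Ĩ.total (identity′ (+ i) (+ I.p′) (+ Ĩ.p′) (+ n)))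

divisible-core : ∀ {n i X} u → Odd X → Inner n i X (partner X u) → ∃ (Divisible n i)
divisible-core {n} {i} {X} u o I =
  let j , C = Core-exists {n} {X} u o (norm-total total) in j , X , u , C , I
  where
  open Inner I
  identity : ∀ X Y i p p′ n → X ℤ.+ Y ℤ.- (+ 40 ℤ.* n ℤ.+ + 10)
    ≡ + 1 ℤ.* (X ℤ.+ Y ℤ.- (+ 200 ℤ.* p ℤ.+ + 25 ℤ.+ (+ 200 ℤ.* p′ ℤ.+ + 25))) ℤ.+ ℤ.- + 40 ℤ.* (i ℤ.- (+ 1 ℤ.+ + 5 ℤ.* p)) ℤ.+ + 40 ℤ.* (i ℤ.+ + 5 ℤ.* p′ ℤ.- n)
  identity = ℤSolver.solve-∀
  norm-total : + i ℤ.+ + 5 ℤ.* + p′ ≡ + n → X ℤ.* X ℤ.+ partner X u ℤ.* partner X u ≡ + 40 ℤ.* + n ℤ.+ + 10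
  norm-total t = linear₃ (+ 1) (ℤ.- + 40) (+ 40) (cong₂ ℤ._+_ (inner-first I) (inner-second I)) index t
    (identity (X ℤ.* X) (partner X u ℤ.* partner X u) (+ i) (+ p) (+ p′) (+ n))

-- For X = 5 c and Y = 5 d the relation Y = 3 X - 20 u becomes 3 c - d = 4 u. Both roots are odd, so
-- d or - d satisfies it for some u.
divisible-image : ∀ {n i p p′} c d → c ℤ.* c ≡ + 8 ℤ.* + p ℤ.+ + 1 → d ℤ.* d ≡ + 8 ℤ.* + p′ ℤ.+ + 1 →
  + i ≡ + 1 ℤ.+ + 5 ℤ.* + p → + i ℤ.+ + 5 ℤ.* + p′ ≡ + n → ∃ (Divisible n i)
divisible-image {n} {i} {p} {p′} c d h k index total = choose (even-or-odd (+ 1 ℤ.+ + 3 ℤ.* e ℤ.- f))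
  where
  c-odd = odd-root 4 1 {p = p} {c} h
  d-odd = odd-root 4 1 {p = p′} {d} k
  e = proj₁ c-odd
  f = proj₁ d-odd
  odd-multiple : ∀ c e → + 5 ℤ.* c ℤ.- (+ 1 ℤ.+ + 2 ℤ.* (+ 2 ℤ.+ + 5 ℤ.* e)) ≡ + 5 ℤ.* (c ℤ.- (+ 1 ℤ.+ + 2 ℤ.* e))
  odd-multiple = ℤSolver.solve-∀
  X-odd : Odd (+ 5 ℤ.* c)
  X-odd = + 2 ℤ.+ + 5 ℤ.* e , linear₁ (+ 5) (proj₂ c-odd) (odd-multiple c e)
  identity₁ : ∀ c d e f q → + 3 ℤ.* (+ 5 ℤ.* c) ℤ.- + 20 ℤ.* q ℤ.- + 5 ℤ.* d
    ≡ + 15 ℤ.* (c ℤ.- (+ 1 ℤ.+ + 2 ℤ.* e)) ℤ.+ ℤ.- + 5 ℤ.* (d ℤ.- (+ 1 ℤ.+ + 2 ℤ.* f)) ℤ.+ + 10 ℤ.* (+ 1 ℤ.+ + 3 ℤ.* e ℤ.- f ℤ.- + 2 ℤ.* q)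
  identity₁ = ℤSolver.solve-∀
  identity₂ : ∀ c d e f q → + 3 ℤ.* (+ 5 ℤ.* c) ℤ.- + 20 ℤ.* (+ 1 ℤ.+ + 3 ℤ.* e ℤ.- q) ℤ.- + 5 ℤ.* ℤ.- d
    ≡ + 15 ℤ.* (c ℤ.- (+ 1 ℤ.+ + 2 ℤ.* e)) ℤ.+ + 5 ℤ.* (d ℤ.- (+ 1 ℤ.+ + 2 ℤ.* f)) ℤ.+ ℤ.- + 10 ℤ.* (+ 1 ℤ.+ + 3 ℤ.* e ℤ.- f ℤ.- (+ 1 ℤ.+ + 2 ℤ.* q))
  identity₂ = ℤSolver.solve-∀
  choose : (∃ λ q → + 1 ℤ.+ + 3 ℤ.* e ℤ.- f ≡ + 2 ℤ.* q ⊎ + 1 ℤ.+ + 3 ℤ.* e ℤ.- f ≡ + 1 ℤ.+ + 2 ℤ.* q) → ∃ (Divisible n i)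
  choose (q , inj₁ g) = divisible-core q X-odd record
    { c = c ; d = d ; p = p ; p′ = p′ ; X≡ = refl ; first = h ; second = k ; index = index ; total = total
    ; Y≡ = linear₃ (+ 15) (ℤ.- + 5) (+ 10) (proj₂ c-odd) (proj₂ d-odd) g (identity₁ c d e f q) }
  choose (q , inj₂ g) = divisible-core (+ 1 ℤ.+ + 3 ℤ.* e ℤ.- q) X-odd record
    { c = c ; d = ℤ.- d ; p = p ; p′ = p′ ; X≡ = refl ; first = h ; second = reflected-square {d} {ℤ.- d} d refl refl k ; index = index ; total = total
    ; Y≡ = linear₃ (+ 15) (+ 5) (ℤ.- + 10) (proj₂ c-odd) (proj₂ d-odd) g (identity₂ c d e f q) }

-- Two odd roots are congruent modulo 4 up to sign; u is a quarter of x - y or of x + y accordingly.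
core-image : ∀ {n j j′} x y → x ℤ.* x ≡ + 8 ℤ.* + j ℤ.+ + 1 → y ℤ.* y ≡ + 8 ℤ.* + j′ ℤ.+ + 1 → + j ℤ.+ + j′ ≡ + n →
  ∃ λ X → ∃ λ u → Core n j X u
core-image {n} {j} {j′} x y h k t = choose (even-or-odd (e ℤ.- f))
  where
  x-odd = odd-root 4 1 {p = j} {x} h
  y-odd = odd-root 4 1 {p = j′} {y} k
  e = proj₁ x-odd
  f = proj₁ y-odd
  identity₀ : ∀ x u → x ℤ.+ + 4 ℤ.* u ℤ.- + 4 ℤ.* u ≡ x
  identity₀ = ℤSolver.solve-∀
  identity₁ : ∀ x y e f q → x ℤ.+ + 4 ℤ.* q ℤ.- + 8 ℤ.* q ℤ.- y
    ≡ + 1 ℤ.* (x ℤ.- (+ 1 ℤ.+ + 2 ℤ.* e)) ℤ.+ ℤ.- + 1 ℤ.* (y ℤ.- (+ 1 ℤ.+ + 2 ℤ.* f)) ℤ.+ + 2 ℤ.* (e ℤ.- f ℤ.- + 2 ℤ.* q)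
  identity₁ = ℤSolver.solve-∀
  identity₂ : ∀ x y e f q → let u = f ℤ.+ + 1 ℤ.+ q in x ℤ.+ + 4 ℤ.* u ℤ.- + 8 ℤ.* u ℤ.- ℤ.- y
    ≡ + 1 ℤ.* (x ℤ.- (+ 1 ℤ.+ + 2 ℤ.* e)) ℤ.+ + 1 ℤ.* (y ℤ.- (+ 1 ℤ.+ + 2 ℤ.* f)) ℤ.+ + 2 ℤ.* (e ℤ.- f ℤ.- (+ 1 ℤ.+ + 2 ℤ.* q))
  identity₂ = ℤSolver.solve-∀
  choose : (∃ λ q → e ℤ.- f ≡ + 2 ℤ.* q ⊎ e ℤ.- f ≡ + 1 ℤ.+ + 2 ℤ.* q) → ∃ λ X → ∃ λ u → Core n j X u
  choose (q , inj₁ g) = x ℤ.+ + 4 ℤ.* q , q , record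
    { j′ = j′ ; first = square-cong x (identity₀ x q) h ; total = t
    ; second = square-cong y {x ℤ.+ + 4 ℤ.* q ℤ.- + 8 ℤ.* q} (linear₃ (+ 1) (ℤ.- + 1) (+ 2) (proj₂ x-odd) (proj₂ y-odd) g (identity₁ x y e f q)) k }
  choose (q , inj₂ g) = let u = f ℤ.+ + 1 ℤ.+ q in x ℤ.+ + 4 ℤ.* u , u , record
    { j′ = j′ ; first = square-cong x (identity₀ x u) h ; total = t
    ; second = reflected-square {y} {x ℤ.+ + 4 ℤ.* u ℤ.- + 8 ℤ.* u} y refl (linear₃ (+ 1) (+ 1) (+ 2) (proj₂ x-odd) (proj₂ y-odd) g (identity₂ x y e f q)) k }

-- The partner satisfies Y² ≡ 9 X² modulo 40, which exchanges the classes 1 and 9, and Y ≡ 3 X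
-- modulo 5 passes divisibility by 5 on to Y.
coprime-or-divisible : ∀ {n j X u} → Core n j X u → (∃ λ i → Coprime n i j) ⊎ (∃ λ i → Divisible n i j)
coprime-or-divisible {n} {j} {X} {u} C = choose (odd-square-mod-40 (Core-odd C))
  where
  Y = partner X u
  e = proj₁ (Core-odd C)
  identity₁ : ∀ X u I → let Y = + 3 ℤ.* X ℤ.- + 20 ℤ.* u in
    Y ℤ.* Y ℤ.- (+ 40 ℤ.* (+ 9 ℤ.* I ℤ.- + 3 ℤ.* u ℤ.* X ℤ.+ + 10 ℤ.* u ℤ.* u) ℤ.+ + 9) ≡ + 9 ℤ.* (X ℤ.* X ℤ.- (+ 40 ℤ.* I ℤ.+ + 1))
  identity₁ = ℤSolver.solve-∀
  identity₂ : ∀ X u I → let Y = + 3 ℤ.* X ℤ.- + 20 ℤ.* u in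
    Y ℤ.* Y ℤ.- (+ 40 ℤ.* (+ 9 ℤ.* I ℤ.+ + 2 ℤ.- + 3 ℤ.* u ℤ.* X ℤ.+ + 10 ℤ.* u ℤ.* u) ℤ.+ + 1) ≡ + 9 ℤ.* (X ℤ.* X ℤ.- (+ 40 ℤ.* I ℤ.+ + 9))
  identity₂ = ℤSolver.solve-∀
  identity₃ : ∀ X Y i i′ n a b → + 40 ℤ.* (i ℤ.+ i′) ℤ.- + 40 ℤ.* n
    ≡ + 1 ℤ.* (X ℤ.+ Y ℤ.- (+ 40 ℤ.* n ℤ.+ (a ℤ.+ b))) ℤ.+ ℤ.- + 1 ℤ.* (X ℤ.- (+ 40 ℤ.* i ℤ.+ a)) ℤ.+ ℤ.- + 1 ℤ.* (Y ℤ.- (+ 40 ℤ.* i′ ℤ.+ b))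
  identity₃ = ℤSolver.solve-∀
  identity₄ : ∀ X u c → + 3 ℤ.* X ℤ.- + 20 ℤ.* u ℤ.- + 5 ℤ.* (+ 3 ℤ.* c ℤ.- + 4 ℤ.* u) ≡ + 3 ℤ.* (X ℤ.- + 5 ℤ.* c)
  identity₄ = ℤSolver.solve-∀
  identity₅ : ∀ X c e → c ℤ.- (+ 1 ℤ.+ + 2 ℤ.* (e ℤ.- + 2 ℤ.* c)) ≡ + 1 ℤ.* (X ℤ.- (+ 1 ℤ.+ + 2 ℤ.* e)) ℤ.+ ℤ.- + 1 ℤ.* (X ℤ.- + 5 ℤ.* c)
  identity₅ = ℤSolver.solve-∀
  identity₆ : ∀ u c e → + 3 ℤ.* c ℤ.- + 4 ℤ.* u ℤ.- (+ 1 ℤ.+ + 2 ℤ.* (+ 1 ℤ.+ + 3 ℤ.* e ℤ.- + 2 ℤ.* u)) ≡ + 3 ℤ.* (c ℤ.- (+ 1 ℤ.+ + 2 ℤ.* e))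
  identity₆ = ℤSolver.solve-∀
  identity₇ : ∀ X Y p p′ n → + 40 ℤ.* (+ 1 ℤ.+ + 5 ℤ.* p ℤ.+ + 5 ℤ.* p′) ℤ.- + 40 ℤ.* n
    ≡ + 1 ℤ.* (X ℤ.+ Y ℤ.- (+ 40 ℤ.* n ℤ.+ + 10)) ℤ.+ ℤ.- + 1 ℤ.* (X ℤ.- (+ 200 ℤ.* p ℤ.+ + 25)) ℤ.+ ℤ.- + 1 ℤ.* (Y ℤ.- (+ 200 ℤ.* p′ ℤ.+ + 25))
  identity₇ = ℤSolver.solve-∀
  total : ∀ {i i′} a b → X ℤ.* X ℤ.+ Y ℤ.* Y ≡ + 40 ℤ.* + n ℤ.+ (a ℤ.+ b) → X ℤ.* X ≡ + 40 ℤ.* + i ℤ.+ a → Y ℤ.* Y ≡ + 40 ℤ.* + i′ ℤ.+ b → + i ℤ.+ + i′ ≡ + n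
  total {i} {i′} a b N h k = ℤ.*-cancelˡ-≡ (+ 40) _ _ (linear₃ (+ 1) (ℤ.- + 1) (ℤ.- + 1) N h k
    (identity₃ (X ℤ.* X) (Y ℤ.* Y) (+ i) (+ i′) (+ n) a b))
  to-natural : ∀ b {_ : True (b <? 40)} Z I → Z ℤ.* Z ≡ + 40 ℤ.* I ℤ.+ + b → ∃ λ i → Z ℤ.* Z ≡ + 40 ℤ.* + i ℤ.+ + b
  to-natural b {l} Z I h = let i , I≡ = natural 40 b {l} Z I h in i , trans h (cong (λ z → + 40 ℤ.* z ℤ.+ + b) I≡)
  choose : (∃ λ c → X ≡ + 5 ℤ.* c) ⊎ (∃ λ I → X ℤ.* X ≡ + 40 ℤ.* I ℤ.+ + 1) ⊎ (∃ λ I → X ℤ.* X ≡ + 40 ℤ.* I ℤ.+ + 9) →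
    (∃ λ i → Coprime n i j) ⊎ (∃ λ i → Divisible n i j)
  choose (inj₂ (inj₁ (I , h))) =
    let i′ , X² = to-natural 1 X I h
        i , Y² = to-natural 9 Y (+ 9 ℤ.* I ℤ.- + 3 ℤ.* u ℤ.* X ℤ.+ + 10 ℤ.* u ℤ.* u) (linear₁ (+ 9) h (identity₁ X u I))
    in inj₁ (i , X , u , C , inj₂ (i′ , Y² , X² , trans (ℤ.+-comm (+ i) (+ i′)) (total {i′} {i} (+ 1) (+ 9) (Core-norm C) X² Y²)))
  choose (inj₂ (inj₂ (I , h))) =
    let i , X² = to-natural 9 X I h
        i′ , Y² = to-natural 1 Y (+ 9 ℤ.* I ℤ.+ + 2 ℤ.- + 3 ℤ.* u ℤ.* X ℤ.+ + 10 ℤ.* u ℤ.* u) (linear₁ (+ 9) h (identity₂ X u I))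
    in inj₁ (i , X , u , C , inj₁ (i′ , X² , Y² , total {i} {i′} (+ 9) (+ 1) (Core-norm C) X² Y²))
  choose (inj₁ (c , X≡)) = inj₂ (1 + 5 * p , X , u , C , record
    { c = c ; d = d ; p = p ; p′ = p′ ; X≡ = X≡ ; Y≡ = Y≡ ; first = c² ; second = d² ; index = index
    ; total = trans (cong (λ z → z ℤ.+ + 5 ℤ.* + p′) index) (ℤ.*-cancelˡ-≡ (+ 40) _ _ (linear₃ (+ 1) (ℤ.- + 1) (ℤ.- + 1) (Core-norm C)
        (five-fold-square {X} {c} {p} X≡ c²) (five-fold-square {Y} {d} {p′} Y≡ d²) (identity₇ (X ℤ.* X) (Y ℤ.* Y) (+ p) (+ p′) (+ n)))) })
    where
    d = + 3 ℤ.* c ℤ.- + 4 ℤ.* u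
    Y≡ : Y ≡ + 5 ℤ.* d
    Y≡ = linear₁ (+ 3) X≡ (identity₄ X u c)
    c-odd : Odd c
    c-odd = e ℤ.- + 2 ℤ.* c , linear₂ (+ 1) (ℤ.- + 1) (proj₂ (Core-odd C)) X≡ (identity₅ X c e)
    d-odd : Odd d
    d-odd = + 1 ℤ.+ + 3 ℤ.* proj₁ c-odd ℤ.- + 2 ℤ.* u , linear₁ (+ 3) (proj₂ c-odd) (identity₆ u c (proj₁ c-odd))
    p = proj₁ (odd-square c-odd)
    c² = proj₂ (odd-square c-odd)
    p′ = proj₁ (odd-square d-odd)
    d² = proj₂ (odd-square d-odd)
    index : + (1 + 5 * p) ≡ + 1 ℤ.+ + 5 ℤ.* + p
    index = cong (λ z → + 1 ℤ.+ z) (ℤ.pos-* 5 p)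

coprime-injective : ∀ {n i k j} → Coprime n i j → Coprime n k j → i ≡ k
coprime-injective {n} {i} {k} {j} (X , u , C , O) (X̃ , ũ , D , Õ) = choose O Õ
  where
  X² = proj₁ (Core-squares C D)
  Y² = proj₂ (Core-squares C D)
  identity : ∀ i k′ → + 40 ℤ.* (k′ ℤ.- i) ℤ.- + 8 ≡ ℤ.- + 1 ℤ.* (+ 40 ℤ.* i ℤ.+ + 9 ℤ.- (+ 40 ℤ.* k′ ℤ.+ + 1))
  identity = ℤSolver.solve-∀
  differ : ∀ i k′ → + 40 ℤ.* + i ℤ.+ + 9 ≢ + 40 ℤ.* + k′ ℤ.+ + 1
  differ i k′ h = nonmultiple 40 8 {z = + k′ ℤ.- + i} (linear₁ (ℤ.- + 1) h (identity (+ i) (+ k′)))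
  choose : Outer n i X (partner X u) ⊎ Outer n i (partner X u) X → Outer n k X̃ (partner X̃ ũ) ⊎ Outer n k (partner X̃ ũ) X̃ → i ≡ k
  choose (inj₁ (_ , p , _)) (inj₁ (_ , p̃ , _)) = cancel-coeff 40 9 (trans (sym p) (trans X² p̃))
  choose (inj₂ (_ , p , _)) (inj₂ (_ , p̃ , _)) = cancel-coeff 40 9 (trans (sym p) (trans Y² p̃))
  choose (inj₁ (_ , p , _)) (inj₂ (k′ , _ , q̃ , _)) = ⊥-elim (differ i k′ (trans (sym p) (trans X² q̃)))
  choose (inj₂ (i′ , _ , q , _)) (inj₁ (_ , p̃ , _)) = ⊥-elim (differ k i′ (trans (sym p̃) (trans (sym X²) q)))

divisible-injective : ∀ {n i k j} → Divisible n i j → Divisible n k j → i ≡ k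
divisible-injective (X , u , C , I) (X̃ , ũ , D , Ĩ) = ℤ.+-injective (trans (Inner.index I)
  (trans (cong (λ z → + 1 ℤ.+ + 5 ℤ.* + z) (cancel-coeff 200 25 {i = Inner.p I} {Inner.p Ĩ} (trans (sym (inner-first I)) (trans (proj₁ (Core-squares C D)) (inner-first Ĩ)))))
         (sym (Inner.index Ĩ))))

-- X² is 1 or 9 modulo 40 in one case and 25 in the other.
coprime-disjoint : ∀ {n i k j} → Coprime n i j → ¬ Divisible n k j
coprime-disjoint {n} {i} {k} {j} (X , u , C , O) (X̃ , ũ , D , I) = choose O
  where
  module I = Inner I
  X² = trans (proj₁ (Core-squares C D)) (inner-first I)
  identity₁ : ∀ i p → + 40 ℤ.* (i ℤ.- + 5 ℤ.* p) ℤ.- + 16 ≡ + 1 ℤ.* (+ 40 ℤ.* i ℤ.+ + 9 ℤ.- (+ 200 ℤ.* p ℤ.+ + 25))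
  identity₁ = ℤSolver.solve-∀
  identity₂ : ∀ i p → + 40 ℤ.* (i ℤ.- + 5 ℤ.* p) ℤ.- + 24 ≡ + 1 ℤ.* (+ 40 ℤ.* i ℤ.+ + 1 ℤ.- (+ 200 ℤ.* p ℤ.+ + 25))
  identity₂ = ℤSolver.solve-∀
  choose : ¬ (Outer n i X (partner X u) ⊎ Outer n i (partner X u) X)
  choose (inj₁ (_ , p , _)) = nonmultiple 40 16 {z = + i ℤ.- + 5 ℤ.* + I.p} (linear₁ (+ 1) (trans (sym p) X²) (identity₁ (+ i) (+ I.p)))
  choose (inj₂ (i′ , _ , q , _)) = nonmultiple 40 24 {z = + i′ ℤ.- + 5 ℤ.* + I.p} (linear₁ (+ 1) (trans (sym q) X²) (identity₂ (+ i′) (+ I.p)))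

summand-≤ : ∀ {n i i′} → + i ℤ.+ + i′ ≡ + n → i ≤ n
summand-≤ {i = i} {i′} t = ℕ.≤-trans (ℕ.m≤m+n i i′) (ℕ.≤-reflexive (ℤ.+-injective t))

complement : ∀ {n i i′} → + i ℤ.+ + i′ ≡ + n → n ∸ i ≡ i′
complement {i = i} {i′} t = trans (cong (_∸ i) (sym (ℤ.+-injective t))) (ℕ.m+n∸m≡n i i′)

module Level5 (N : ℕ) {θ₁ θ₂ ψ₁ ψ₅ : Series}
  (Θ₁ : SquareSeries N 1 40 9 θ₁) (Θ₂ : SquareSeries N 1 40 1 θ₂)
  (Ψ₁ : SquareSeries N 1 8 1 ψ₁) (Ψ₅ : SquareSeries N 5 8 1 ψ₅)
  (n : ℕ) (n<N : n < N) where

  private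
    module Ψ₅ = SquareSeries Ψ₅
    s d t : ℕ → Bool
    s i = θ₁ i ∧ θ₂ (n ∸ i)
    d i = (q^ 1 ⊛ ψ₅) i ∧ ψ₅ (n ∸ i)
    t j = ψ₁ j ∧ ψ₁ (n ∸ j)

    low : ∀ {i} → i < suc n → i < N
    low l = ℕ.≤-<-trans (s≤s⁻¹ l) n<N

    high : ∀ i → n ∸ i < N
    high i = ℕ.≤-<-trans (ℕ.m∸n≤m n i) n<N

    sum-to-n : ∀ {i i′} → i < suc n → n ∸ i ≡ i′ → + i ℤ.+ + i′ ≡ + n
    sum-to-n l refl = cong +_ (ℕ.m+[n∸m]≡n (s≤s⁻¹ l))

    outer-valid : ∀ {i} P Q → Outer n i P Q → i < suc n × s i ≡ true
    outer-valid {i} P Q (i′ , p , q , e) = s≤s (summand-≤ {i′ = i′} e) , cong₂ _∧_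
      (one-square Θ₁ i (low (s≤s (summand-≤ {i′ = i′} e))) (P , p))
      (one-square Θ₂ (n ∸ i) (high i) (subst (Square 40 1) (sym (complement {n} {i} {i′} e)) (Q , q)))

    core-valid : ∀ {j X u} → Core n j X u → j < suc n × t j ≡ true
    core-valid {j} {X} {u} C = s≤s (summand-≤ {i′ = j′} total) , cong₂ _∧_
      (one-square Ψ₁ j (low (s≤s (summand-≤ {i′ = j′} total))) (X ℤ.- + 4 ℤ.* u , first))
      (one-square Ψ₁ (n ∸ j) (high j) (subst (Square 8 1) (sym (complement {n} {j} {j′} total)) (X ℤ.- + 8 ℤ.* u , second)))
      where open Core C

    five : ∀ p → Square 8 1 p → 5 * p < N → ψ₅ (5 * p) ≡ true
    five p h l = Ψ₅.occurs p l h

    inner-valid : ∀ {i X Y} → Inner n i X Y → i < suc n × d i ≡ true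
    inner-valid {i} I = s≤s i≤n , cong₂ _∧_
      (trans (cong (q^ 1 ⊛ ψ₅) i≡) (trans (q^-⊛-+ 1 ψ₅ (5 * p)) (five p (c , first) (ℕ.<-trans (ℕ.n<1+n (5 * p)) (subst (_< N) i≡ (low (s≤s i≤n)))))))
      (trans (cong ψ₅ n∸i) (five p′ (Inner.d I , second) (subst (_< N) n∸i (high i))))
      where
      open Inner I using (c; p; p′; first; second; index; total)
      i≡ : i ≡ 1 + 5 * p
      i≡ = ℤ.+-injective (trans index (cong (λ z → + 1 ℤ.+ z) (sym (ℤ.pos-* 5 p))))
      total′ : + i ℤ.+ + (5 * p′) ≡ + n
      total′ = trans (cong (λ z → + i ℤ.+ z) (ℤ.pos-* 5 p′)) total
      i≤n = summand-≤ {n} {i} {5 * p′} total′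
      n∸i = complement {n} {i} {5 * p′} total′

    coprime-valid : ∀ {i j} → Coprime n i j → i < suc n × j < suc n × s i ≡ true
    coprime-valid (X , u , C , inj₁ O) = let i<n , h = outer-valid X (partner X u) O in i<n , proj₁ (core-valid C) , h
    coprime-valid (X , u , C , inj₂ O) = let i<n , h = outer-valid (partner X u) X O in i<n , proj₁ (core-valid C) , h

    divisible-valid : ∀ {i j} → Divisible n i j → i < suc n × j < suc n × d i ≡ true
    divisible-valid (X , u , C , I) = let i<n , h = inner-valid I in i<n , proj₁ (core-valid C) , h

    s-image : ∀ {i} → i < suc n → s i ≡ true → ∃ (Coprime n i)
    s-image {i} l h = found (square-one Θ₁ i (low l) (Bool.∧-conicalˡ _ _ h)) (square-one Θ₂ (n ∸ i) (high i) (Bool.∧-conicalʳ (θ₁ i) _ h))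
      where
      found : Square 40 9 i → Square 40 1 (n ∸ i) → ∃ (Coprime n i)
      found (P , p) (Q , q) = coprime-image {n} {i} {P} {Q} (n ∸ i , p , q , sum-to-n l refl)

    d-image : ∀ {i} → i < suc n → d i ≡ true → ∃ (Divisible n i)
    d-image {zero} l h = contradiction (trans (sym h) (cong (_∧ ψ₅ n) (q^-⊛-small 1 ψ₅ 0 (s≤s z≤n)))) λ ()
    d-image {suc i} l h = found
      (Ψ₅.square i (ℕ.<-trans (ℕ.n<1+n i) (low l)) (trans (sym (q^-⊛-+ 1 ψ₅ i)) (Bool.∧-conicalˡ ((q^ 1 ⊛ ψ₅) (suc i)) _ h)))
      (Ψ₅.square (n ∸ suc i) (high (suc i)) (Bool.∧-conicalʳ ((q^ 1 ⊛ ψ₅) (suc i)) _ h))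
      where
      found : (∃ λ p → i ≡ 5 * p × Square 8 1 p) → (∃ λ p′ → n ∸ suc i ≡ 5 * p′ × Square 8 1 p′) → ∃ (Divisible n (suc i))
      found (p , e , c , h) (p′ , e′ , d , k) = divisible-image {n} {suc i} {p} {p′} c d h k
        (cong (λ z → + 1 ℤ.+ z) (trans (cong +_ e) (ℤ.pos-* 5 p)))
        (trans (cong (λ z → + suc i ℤ.+ z) (sym (ℤ.pos-* 5 p′))) (sum-to-n l e′))

    t-image : ∀ j → j < suc n → t j ≡ true → (∃ λ i → Coprime n i j) ⊎ (∃ λ i → Divisible n i j)
    t-image j l h = found (square-one Ψ₁ j (low l) (Bool.∧-conicalˡ _ _ h)) (square-one Ψ₁ (n ∸ j) (high j) (Bool.∧-conicalʳ (ψ₁ j) _ h))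
      where
      found : Square 8 1 j → Square 8 1 (n ∸ j) → (∃ λ i → Coprime n i j) ⊎ (∃ λ i → Divisible n i j)
      found (x , p) (y , q) = let X , u , C = core-image {n} {j} {n ∸ j} x y p q (sum-to-n l refl) in coprime-or-divisible C

  level-5-coefficient : (θ₁ ⊛ θ₂) n xor ((q^ 1 ⊛ ψ₅) ⊛ ψ₅) n ≡ (ψ₁ ⊛ ψ₁) n
  level-5-coefficient = begin
    (θ₁ ⊛ θ₂) n xor ((q^ 1 ⊛ ψ₅) ⊛ ψ₅) n  ≡⟨ cong₂ _xor_ (⊛-sum θ₁ θ₂ n) (⊛-sum (q^ 1 ⊛ ψ₅) ψ₅ n) ⟩
    sum s (suc n) xor sum d (suc n)        ≡⟨ bijection-sum
      (record { valid = coprime-valid ; image = s-image ; functional = coprime-functional })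
      (record { valid = divisible-valid ; image = d-image ; functional = divisible-functional })
      (λ { (_ , _ , C , _) → proj₂ (core-valid C) }) (λ { (_ , _ , C , _) → proj₂ (core-valid C) })
      coprime-injective divisible-injective coprime-disjoint t-image ⟩
    sum t (suc n)                          ≡⟨ ⊛-sum ψ₁ ψ₁ n ⟨
    (ψ₁ ⊛ ψ₁) n                            ∎
    where open ≡-Reasoning

-- The congruences

module Assembly (N : ℕ) where
  open Truncated N
  open Products N
  open Partitions N
  open Identities N

  φ ψ : (c : ℕ) → {{NonZero c}} → Series
  φ c = Jacobi.theta N c 1 2
  ψ c = Jacobi.theta N c 1 3

  φ-squares : ∀ c {{_ : NonZero c}} → SquareSeries N c 24 1 (φ c)
  φ-squares c = theta-squares N c (s≤s (s≤s z≤n)) instance-1-2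

  ψ-squares : ∀ c {{_ : NonZero c}} → SquareSeries N c 8 1 (ψ c)
  ψ-squares c = theta-squares N c (s≤s (s≤s z≤n)) instance-1-3

  cube : Series → Series
  cube f = f ⊛ f ⊛ f

  level-5-thetas : Jacobi.theta N 1 1 4 ⊛ Jacobi.theta N 1 2 3 ⊕ (q^ 1 ⊛ ψ 5) ⊛ ψ 5 ≈ ψ 1 ⊛ ψ 1
  level-5-thetas = mod λ n n<N → trans (⊕-coeff (Jacobi.theta N 1 1 4 ⊛ Jacobi.theta N 1 2 3) ((q^ 1 ⊛ ψ 5) ⊛ ψ 5) n)
    (Level5.level-5-coefficient N
      (theta-squares N 1 (s≤s (s≤s z≤n)) instance-1-4) (theta-squares N 1 (s≤s (s≤s (s≤s z≤n))) instance-2-3)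
      (ψ-squares 1) (ψ-squares 5) n n<N)

  euler-relation : euler 1 ⊛ euler 5 ≈ cube (euler 1) ⊛ cube (euler 1) ⊕ (q^ 1 ⊛ cube (euler 5)) ⊛ cube (euler 5)
  euler-relation = begin
    euler 1 ⊛ euler 5                                        ≈⟨ euler-level-5 ⟩
    Jacobi.theta N 1 1 4 ⊛ Jacobi.theta N 1 2 3              ≈⟨ ⊕-transpose level-5-thetas ⟩
    ψ 1 ⊛ ψ 1 ⊕ (q^ 1 ⊛ ψ 5) ⊛ ψ 5
      ≈⟨ ⊕-cong (⊛-cong (euler-cube 1) (euler-cube 1)) (⊛-cong (⊛-cong ≈-refl (euler-cube 5)) (euler-cube 5)) ⟨
    cube (euler 1) ⊛ cube (euler 1) ⊕ (q^ 1 ⊛ cube (euler 5)) ⊛ cube (euler 5) ∎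
    where open ≈-Reasoning

  euler-4 : euler 4 ≈ (euler 1 ⊛ euler 1) ⊛ (euler 1 ⊛ euler 1)
  euler-4 = ≈-sym (≈-trans (⊛-cong (euler-square 1) (euler-square 1)) (euler-square 2))

  euler-40 : euler 40 ≈ ((euler 5 ⊛ euler 5) ⊛ (euler 5 ⊛ euler 5)) ⊛ ((euler 5 ⊛ euler 5) ⊛ (euler 5 ⊛ euler 5))
  euler-40 = ≈-sym (≈-trans (⊛-cong fourth fourth) (euler-square 20))
    where fourth = ≈-trans (⊛-cong (euler-square 5) (euler-square 5)) (euler-square 10)

  qB : q^ 1 ⊛ B ≈ φ 10 ⊛ φ 5 ⊕ φ 10 ⊛ (φ 1 ⊛ φ 4)
  qB = begin
    q^ 1 ⊛ B                                           ≈⟨ ⊛-cancel {h = a} (euler-constant-term 1) product ⟩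
    (b ⊛ b) ⊛ b ⊕ (b ⊛ b) ⊛ (a ⊛ ((a ⊛ a) ⊛ (a ⊛ a)))  ≈⟨ ⊕-cong (⊛-cong (euler-square 5) ≈-refl) (⊛-cong (euler-square 5) (⊛-cong ≈-refl (≈-sym euler-4))) ⟩
    euler 10 ⊛ b ⊕ euler 10 ⊛ (a ⊛ euler 4)            ≈⟨ ⊕-cong (⊛-cong (pentagonal 10) (pentagonal 5)) (⊛-cong (pentagonal 10) (⊛-cong (pentagonal 1) (pentagonal 4))) ⟩
    φ 10 ⊛ φ 5 ⊕ φ 10 ⊛ (φ 1 ⊛ φ 4)                    ∎
    where
    open ≈-Reasoning
    a = euler 1
    b = euler 5
    product : (q^ 1 ⊛ B) ⊛ a ≈ ((b ⊛ b) ⊛ b ⊕ (b ⊛ b) ⊛ (a ⊛ ((a ⊛ a) ⊛ (a ⊛ a)))) ⊛ a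
    product = begin
      (q^ 1 ⊛ B) ⊛ a                          ≈⟨ R.*-assoc (q^ 1) B a ⟩
      q^ 1 ⊛ (B ⊛ a)                          ≈⟨ ⊛-cong ≈-refl (≈-trans B-product euler-40) ⟩
      q^ 1 ⊛ (((b ⊛ b) ⊛ (b ⊛ b)) ⊛ ((b ⊛ b) ⊛ (b ⊛ b)))
        -- f_1⁶ is added twice, which changes nothing, so that q f_5⁶ appears next to f_1⁶ and the
        -- relation for f_1 f_5 can be substituted.
        ≈⟨ solve 3 (λ a b q → q :* (((b :* b) :* (b :* b)) :* ((b :* b) :* (b :* b)))
             := (b :* b) :* (((a :* a :* a) :* (a :* a :* a) :+ (q :* (b :* b :* b)) :* (b :* b :* b)) :+ (a :* a :* a) :* (a :* a :* a)))
             ≈-refl a b (q^ 1) ⟩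
      (b ⊛ b) ⊛ ((cube a ⊛ cube a ⊕ (q^ 1 ⊛ cube b) ⊛ cube b) ⊕ cube a ⊛ cube a)
        ≈⟨ ⊛-cong ≈-refl (⊕-cong euler-relation ≈-refl) ⟨
      (b ⊛ b) ⊛ (a ⊛ b ⊕ cube a ⊛ cube a)
        ≈⟨ solve 2 (λ a b → (b :* b) :* (a :* b :+ (a :* a :* a) :* (a :* a :* a))
             := ((b :* b) :* b :+ (b :* b) :* (a :* ((a :* a) :* (a :* a)))) :* a) ≈-refl a b ⟩
      ((b ⊛ b) ⊛ b ⊕ (b ⊛ b) ⊛ (a ⊛ ((a ⊛ a) ⊛ (a ⊛ a)))) ⊛ a ∎

  -- The summands of q B share the factor φ 10, so they are compared pair by pair: a nonzero
  -- coefficient at i = 10 p forces j = 5 m with 2 p + m = M, where the coefficients of φ 5 and φ 1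
  -- ⊛ φ 4 agree.
  B-even : ∀ M k → suc k ≡ 5 * M → suc k < N →
    (∀ p m → Square 24 1 p → 2 * p + m ≡ M → ∀ z → + 24 ℤ.* + m ℤ.+ + 1 ≢ + 5 ℤ.* z) → B k ≡ false
  B-even M k k≡ k<N good = begin
    B k                                                ≡⟨ q^-⊛-+ 1 B k ⟨
    (q^ 1 ⊛ B) (suc k)                                 ≡⟨ coeff qB (suc k) k<N ⟩
    (φ 10 ⊛ φ 5 ⊕ φ 10 ⊛ (φ 1 ⊛ φ 4)) (suc k)          ≡⟨ ⊕-coeff (φ 10 ⊛ φ 5) (φ 10 ⊛ (φ 1 ⊛ φ 4)) (suc k) ⟩
    (φ 10 ⊛ φ 5) (suc k) xor (φ 10 ⊛ (φ 1 ⊛ φ 4)) (suc k)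
      ≡⟨ cong (_xor (φ 10 ⊛ (φ 1 ⊛ φ 4)) (suc k)) (⊛-cong-pairs (suc k) {φ 10} {φ 10} {φ 5} {φ 1 ⊛ φ 4} pairs) ⟩
    (φ 10 ⊛ (φ 1 ⊛ φ 4)) (suc k) xor (φ 10 ⊛ (φ 1 ⊛ φ 4)) (suc k)
      ≡⟨ Bool.xor-same ((φ 10 ⊛ (φ 1 ⊛ φ 4)) (suc k)) ⟩
    false                                              ∎
    where
    open ≡-Reasoning
    pairs : ∀ i j → i + j ≡ suc k → φ 10 i ∧ φ 5 j ≡ φ 10 i ∧ (φ 1 ⊛ φ 4) j
    pairs i j e = by-value (φ 10 i) refl
      where
      i<N : i < N
      i<N = ℕ.≤-<-trans (subst (i ≤_) e (ℕ.m≤m+n i j)) k<N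
      j<N : j < N
      j<N = ℕ.≤-<-trans (subst (j ≤_) e (ℕ.m≤n+m j i)) k<N
      found : (∃ λ p → i ≡ 10 * p × Square 24 1 p) → φ 5 j ≡ (φ 1 ⊛ φ 4) j
      found (p , i≡ , s) = subst (λ z → φ 5 z ≡ (φ 1 ⊛ φ 4) z) (sym j≡)
        (sym (reflection-coefficient N (φ 1) (φ 4) (φ 5) (φ-squares 1) (φ-squares 4) (φ-squares 5) m (subst (_< N) j≡ j<N) (good p m s split)))
        where
        m = M ∸ 2 * p
        twice : 10 * p ≡ 5 * (2 * p)
        twice = ℕ.*-assoc 5 2 p
        2p≤M : 2 * p ≤ M
        2p≤M = ℕ.*-cancelˡ-≤ 5 (subst (_≤ 5 * M) (trans i≡ twice) (ℕ.≤-trans (ℕ.m≤m+n i j) (ℕ.≤-reflexive (trans e k≡))))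
        split : 2 * p + m ≡ M
        split = ℕ.m+[n∸m]≡n 2p≤M
        j≡ : j ≡ 5 * m
        j≡ = ℕ.+-cancelˡ-≡ (10 * p) j (5 * m) (trans (cong (_+ j) (sym i≡)) (trans e (trans k≡ (sym (trans (cong (_+ 5 * m) twice)
          (trans (sym (ℕ.*-distribˡ-+ 5 (2 * p) m)) (cong (5 *_) split)))))))
      by-value : ∀ v → φ 10 i ≡ v → v ∧ φ 5 j ≡ v ∧ (φ 1 ⊛ φ 4) j
      by-value false _ = refl
      by-value true h = found (SquareSeries.square (φ-squares 10) i i<N h)

-- Twice a square modulo 5, and the two progressions

not-twice-square? : ∀ b → Dec (∀ {r} → r < 5 → ¬ + 5 ℤ.∣ + 2 ℤ.* (+ r ℤ.* + r) ℤ.- + b)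
not-twice-square? b = ℕ.allUpTo? (λ r → ¬? (+ 5 ℤ.∣? (+ 2 ℤ.* (+ r ℤ.* + r) ℤ.- + b))) 5

not-twice-square : ∀ b {_ : True (not-twice-square? b)} x w → + 2 ℤ.* (x ℤ.* x) ≢ w ℤ.* + 5 ℤ.+ + b
not-twice-square b {H} x w h = choose (residue 5 x)
  where
  identity : ∀ r q w b → let x = r ℤ.+ q ℤ.* + 5 in
    + 2 ℤ.* (r ℤ.* r) ℤ.- b ℤ.- (w ℤ.- + 4 ℤ.* r ℤ.* q ℤ.- + 10 ℤ.* q ℤ.* q) ℤ.* + 5 ≡ + 1 ℤ.* (+ 2 ℤ.* (x ℤ.* x) ℤ.- (w ℤ.* + 5 ℤ.+ b))
  identity = ℤSolver.solve-∀
  choose : (∃ λ r → ∃ λ q → r < 5 × x ≡ + r ℤ.+ q ℤ.* + 5) → ⊥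
  choose (r , q , r<5 , e) = toWitness H r<5 (divides (w ℤ.- + 4 ℤ.* + r ℤ.* q ℤ.- + 10 ℤ.* q ℤ.* q)
    (linear₁ (+ 1) (trans (cong (λ z → + 2 ℤ.* (z ℤ.* z)) (sym e)) h) (identity (+ r) q w (+ b))))

-- For s = 2 and s = 4 the number 24 s + 3 is 1 and 4 modulo 5, whereas twice a square is only ever
-- 0, 2 or 3.
good-residue : ∀ s {_ : True (not-twice-square? (24 * s + 3))} n p m → Square 24 1 p → 2 * p + m ≡ 5 * n + s →
  ∀ z → + 24 ℤ.* + m ℤ.+ + 1 ≢ + 5 ℤ.* z
good-residue s {H} n p m (x , h) e z k = not-twice-square (24 * s + 3) {H} x (+ 24 ℤ.* + n ℤ.- z)
  (trans (linear₃ (+ 2) (+ 24) (ℤ.- + 1) h cast k (identity (x ℤ.* x) (+ p) (+ m) (+ n) (+ s) z))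
         (cong (λ y → (+ 24 ℤ.* + n ℤ.- z) ℤ.* + 5 ℤ.+ (y ℤ.+ + 3)) (sym (ℤ.pos-* 24 s))))
  where
  cast : + 2 ℤ.* + p ℤ.+ + m ≡ + 5 ℤ.* + n ℤ.+ + s
  cast = trans (cong (λ y → y ℤ.+ + m) (sym (ℤ.pos-* 2 p))) (trans (cong +_ e) (cong (λ y → y ℤ.+ + s) (ℤ.pos-* 5 n)))
  identity : ∀ X p m n s z → + 2 ℤ.* X ℤ.- ((+ 24 ℤ.* n ℤ.- z) ℤ.* + 5 ℤ.+ (+ 24 ℤ.* s ℤ.+ + 3))
    ≡ + 2 ℤ.* (X ℤ.- (+ 24 ℤ.* p ℤ.+ + 1)) ℤ.+ + 24 ℤ.* (+ 2 ℤ.* p ℤ.+ m ℤ.- (+ 5 ℤ.* n ℤ.+ s)) ℤ.+ ℤ.- + 1 ℤ.* (+ 24 ℤ.* m ℤ.+ + 1 ℤ.- + 5 ℤ.* z)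
  identity = ℤSolver.solve-∀

theorem4 : (n : ℕ) → (b₄₀ (25 * n + 9) % 2 ≡ 0) × (b₄₀ (25 * n + 19) % 2 ≡ 0)
theorem4 n = even 2 (25 * n + 9) (identity₁ n) , even 4 (25 * n + 19) (identity₂ n)
  where
  identity₁ : ∀ n → suc (25 * n + 9) ≡ 5 * (5 * n + 2)
  identity₁ = ℕSolver.solve-∀
  identity₂ : ∀ n → suc (25 * n + 19) ≡ 5 * (5 * n + 4)
  identity₂ = ℕSolver.solve-∀
  even : ∀ s {_ : True (not-twice-square? (24 * s + 3))} k → suc k ≡ 5 * (5 * n + s) → b₄₀ k % 2 ≡ 0
  even s {H} k k≡ = odd≡false⇒even (b₄₀ k) (trans (sym (Partitions.B-coeff N k (ℕ.m≤n⇒m≤1+n (ℕ.n<1+n k))))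
    (Assembly.B-even N (5 * n + s) k k≡ (ℕ.n<1+n (suc k)) λ p m → good-residue s {H} n p m))
    where
    -- The factor q in q B raises the degree to k + 1, which must stay below the precision.
    N = suc (suc k)
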